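{- Let $A_{\mathrm{RowCol}}=\{0001,0011,0111,00001,00011,00111,01111,000111\}$ and $\mathcal F_{\mathrm{RowCol}}=\bigcup_{k\geq3}\{M_I(k)^*,\overline{M_I(k)^*}\}\cup\{a\odot M_I(|a|)^*: a\in A_{\mathrm{RowCol}}\}\cup\{M_V^*,\overline{M_V^*}\}$, where $|a|$ is the length of $a$, and let $\mathcal F_{\mathrm{RowCol}}^{T}$ be the set of transposes of the matrices in $\mathcal F_{\mathrm{RowCol}}$. A binary matrix $M$ has the circular-ones property for rows and columns if and only if $M$ contains no matrix of $\mathcal F_{\mathrm{RowCol}}\cup\mathcal F_{\mathrm{RowCol}}^{T}$ as a configuration. Moreover, $\mathcal F_{\mathrm{RowCol}}\cup\mathcal F_{\mathrm{RowCol}}^{T}$ is a minimal set having this property, and every matrix in it is a minimal forbidden submatrix for the circular-ones property for rows and columns.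
   Context: A binary matrix has the circular-ones property for rows if its columns can be circularly arranged so that the $1$'s of each row are consecutive; for columns, the same with the roles of rows and columns exchanged; it has the property for rows and columns if it has both. $M$ contains $M'$ as a configuration if a submatrix of $M$ equals $M'$ up to permutations of rows and columns. A minimal forbidden submatrix for the circular-ones property for rows and columns is a matrix lacking that property all of whose other submatrices have it. $\overline M$ exchanges $0$'s and $1$'s; $M^*$ appends a last all-zero column; for $a=a_1\dots a_k$, $a\odot M$ complements each row $i$ of a $k$-row matrix $M$ with $a_i=1$. For $k\ge3$, $M_I(k)$ is the $k\times k$ matrix whose row $i<k$ has ones exactly in columns $i,i+1$ and row $k$ in columns $1,k$. $M_V$ is the $4\times5$ matrix with rows $(1,1,0,0,0),(1,1,1,1,0),(0,0,1,1,0),(1,0,0,1,1)$. -}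

module Defs where

open import Data.Bool using (Bool; true; false; not; _xor_; _∧_; _∨_; if_then_else_)
open import Data.Nat using (ℕ; zero; suc; _+_; _∸_; _≤_; _<_; _≤?_)
import Data.Nat as ℕ
open import Data.Nat.Properties using (_≟_)
open import Data.Fin using (Fin; toℕ; lower₁; cast)
open import Data.Fin.Permutation using (Permutation′; _⟨$⟩ʳ_)
open import Data.List using (List; []; _∷_; length; lookup)
open import Data.List.Membership.Propositional using (_∈_)
open import Data.Product using (Σ; ∃; ∃-syntax; _×_; _,_)
open import Data.Sum using (_⊎_)
open import Relation.Nullary using (¬_; yes; no)
open import Relation.Binary.PropositionalEquality using (_≡_)
open import Function.Definitions using (Injective)

Mat : ℕ → ℕ → Set
Mat m n = Fin m → Fin n → Bool

transpose : ∀ {m n} → Mat m n → Mat n m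
transpose M i j = M j i

cdist : ∀ {n} → Fin n → Fin n → ℕ
cdist {n} s j with toℕ s ≤? toℕ j
... | yes _ = toℕ j ∸ toℕ s
... | no  _ = (n + toℕ j) ∸ toℕ s

CircConsec : ∀ {n} → (Fin n → Bool) → Set
CircConsec {n} v =
  (∀ j → v j ≡ false) ⊎
  (Σ (Fin n) λ s → Σ ℕ λ l → ∀ j → (v j ≡ true → cdist s j < l) × (cdist s j < l → v j ≡ true))

C1Rows : ∀ {m n} → Mat m n → Set
C1Rows {m} {n} M = Σ (Permutation′ n) λ σ → ∀ (i : Fin m) → CircConsec (λ j → M i (σ ⟨$⟩ʳ j))

C1Cols : ∀ {m n} → Mat m n → Set
C1Cols M = C1Rows (transpose M)

C1RowCol : ∀ {m n} → Mat m n → Set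
C1RowCol M = C1Rows M × C1Cols M

-- M contains N as a configuration: some submatrix of M equals N up to
-- permutations of rows and columns (injective choice of rows and columns).
Contains : ∀ {m n p q} → Mat m n → Mat p q → Set
Contains {m} {n} {p} {q} M N =
  Σ (Fin p → Fin m) λ f → Σ (Fin q → Fin n) λ g →
    Injective _≡_ _≡_ f × Injective _≡_ _≡_ g × (∀ i j → M (f i) (g j) ≡ N i j)

StrictlyIncreasing : ∀ {p m} → (Fin p → Fin m) → Set
StrictlyIncreasing f = ∀ i j → toℕ i < toℕ j → toℕ (f i) < toℕ (f j)

MinForbidden : ∀ {m n} → Mat m n → Set
MinForbidden {m} {n} M =
  ¬ C1RowCol M ×
  (∀ p q (f : Fin p → Fin m) (g : Fin q → Fin n) →
     StrictlyIncreasing f → StrictlyIncreasing g → (p < m ⊎ q < n) →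
     C1RowCol (λ i j → M (f i) (g j)))

MatEq : ∀ {m n p q} → Mat m n → Mat p q → Set
MatEq {m} {n} {p} {q} A B =
  Σ (m ≡ p) λ e₁ → Σ (n ≡ q) λ e₂ → ∀ i j → A i j ≡ B (cast e₁ i) (cast e₂ j)

_==_ : ℕ → ℕ → Bool
a == b with a ≟ b
... | yes _ = true
... | no  _ = false

-- M_I(k) (0-indexed): row i has ones in columns i and i+1 (i < k-1),
-- row k-1 has ones in columns 0 and k-1.
MI : (k : ℕ) → Mat k k
MI k i j = (toℕ j == toℕ i) ∨ (toℕ j == suc (toℕ i)) ∨ ((toℕ i == (k ∸ 1)) ∧ (toℕ j == 0))

star : ∀ {m n} → Mat m n → Mat m (suc n)
star {m} {n} M i j with n ≟ toℕ j
... | yes _ = false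
... | no ne = M i (lower₁ j ne)

compl : ∀ {m n} → Mat m n → Mat m n
compl M i j = not (M i j)

odot : ∀ {n} (a : List Bool) → Mat (length a) n → Mat (length a) n
odot a M i j = lookup a i xor M i j

MVrow : List Bool → ∀ {n} → Fin n → Bool
MVrow [] _ = false
MVrow (b ∷ bs) Fin.zero = b
MVrow (b ∷ bs) (Fin.suc j) = MVrow bs j

MV : Mat 4 5
MV Fin.zero = MVrow (true ∷ true ∷ false ∷ false ∷ false ∷ [])
MV (Fin.suc Fin.zero) = MVrow (true ∷ true ∷ true ∷ true ∷ false ∷ [])
MV (Fin.suc (Fin.suc Fin.zero)) = MVrow (false ∷ false ∷ true ∷ true ∷ false ∷ [])
MV (Fin.suc (Fin.suc (Fin.suc Fin.zero))) = MVrow (true ∷ false ∷ false ∷ true ∷ true ∷ [])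

A-RowCol : List (List Bool)
A-RowCol =
    (false ∷ false ∷ false ∷ true ∷ [])
  ∷ (false ∷ false ∷ true ∷ true ∷ [])
  ∷ (false ∷ true ∷ true ∷ true ∷ [])
  ∷ (false ∷ false ∷ false ∷ false ∷ true ∷ [])
  ∷ (false ∷ false ∷ false ∷ true ∷ true ∷ [])
  ∷ (false ∷ false ∷ true ∷ true ∷ true ∷ [])
  ∷ (false ∷ true ∷ true ∷ true ∷ true ∷ [])
  ∷ (false ∷ false ∷ false ∷ true ∷ true ∷ true ∷ [])
  ∷ []

data FGen : Set where
  gMI    : (k : ℕ) → 3 ≤ k → FGen
  gMIbar : (k : ℕ) → 3 ≤ k → FGen
  gOdot  : (a : List Bool) → a ∈ A-RowCol → FGen
  gMV    : FGen
  gMVbar : FGen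

genRows : FGen → ℕ
genRows (gMI k _) = k
genRows (gMIbar k _) = k
genRows (gOdot a _) = length a
genRows gMV = 4
genRows gMVbar = 4

genCols : FGen → ℕ
genCols g = suc (genCols′ g)
  where
  genCols′ : FGen → ℕ
  genCols′ (gMI k _) = k
  genCols′ (gMIbar k _) = k
  genCols′ (gOdot a _) = length a
  genCols′ gMV = 5
  genCols′ gMVbar = 5

genMat : (g : FGen) → Mat (genRows g) (genCols g)
genMat (gMI k _) = star (MI k)
genMat (gMIbar k _) = compl (star (MI k))
genMat (gOdot a _) = odot a (star (MI (length a)))
genMat gMV = star MV
genMat gMVbar = compl (star MV)

-- Index set for F_RowCol ∪ F_RowCol^T : a generator and a flag
-- (false = the matrix itself, true = its transpose)
FIdx : Set
FIdx = FGen × Bool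

fRows : FIdx → ℕ
fRows (g , false) = genRows g
fRows (g , true) = genCols g

fCols : FIdx → ℕ
fCols (g , false) = genCols g
fCols (g , true) = genRows g

fMat : (x : FIdx) → Mat (fRows x) (fCols x)
fMat (g , false) = genMat g
fMat (g , true) = transpose (genMat g)

{-# OPTIONS --safe #-}
module Submission where

-- Every matrix has the circular-ones property for rows or contains, up to complementation of
-- rows, some M_I(k)* or M_IV.  This is proved by induction on the columns.  Complement rows so
-- that the deleted column c is zero, and add the row A ∩ B whenever the rows A and B together
-- cover all columns except c; this creates no new obstruction.  An arrangement of the other
-- columns then extends to c unless each of its gaps is spanned by a row, in which case a maximal
-- spanning row and rows that span the gaps outside it form a cycle, hence some M_I(k)*.
-- For k ≥ 8 and a not constant, seven consecutive rows of a ⊙ M_I(k)* contain the transpose of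
-- M_I(3)* or of its complement, so that only finitely many matrices remain to be reduced to the
-- family.  Conversely M_I(k)* is not circular: seen from the star column, none of three columns
-- of the cycle can lie between the other two.

open import Defs
open import Data.Bool using (Bool; true; false; not; _xor_; _∧_; _∨_; if_then_else_)
import Data.Bool.Properties as Bool
open import Data.Bool.Properties using (xor-same; xor-comm; xor-assoc; xor-identityʳ; ∨-zeroʳ; ∨-identityʳ; ∨-comm; ∧-zeroʳ; ∧-identityʳ; ∧-comm)
open import Data.Nat using (ℕ; zero; suc; _+_; _*_; _∸_; _⊓_; _≤_; _<_; _≤?_; _<?_; _<ᵇ_; z≤n; s≤s)
open import Data.Nat.Properties
open import Algebra.Properties.CommutativeMonoid.Sum +-0-commutativeMonoid using (sum; sum-cong-≗; sum-permute)
open import Data.Fin using (Fin; zero; suc; toℕ; fromℕ; fromℕ<; inject₁; punchOut)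
import Data.Fin.Properties as Fin
open import Data.Fin.Permutation using (Permutation′; _⟨$⟩ʳ_; _⟨$⟩ˡ_; permutation; inverseˡ; inverseʳ)
open import Data.Fin.Relation.Unary.Top using (view; ‵fromℕ; ‵inject₁)
open import Data.List using (List; []; _∷_; length; allFin; cartesianProduct)
import Data.List as List
import Data.List.Properties as List
open import Data.List.Membership.Propositional using (_∈_)
open import Data.List.Membership.Propositional.Properties using (∈-cartesianProduct⁺; ∈-allFin)
open import Data.List.Relation.Unary.All using (All; []; _∷_)
import Data.List.Relation.Unary.All as All
open import Data.List.Relation.Unary.Any using (here; there)
open import Data.Maybe using (Maybe; just; nothing)
import Data.Maybe as Maybe
open import Data.Vec using (Vec; []; _∷_; lookup; tabulate)
import Data.Vec as Vec
open import Data.Vec.Properties using (lookup∘tabulate; lookup-map)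
open import Data.Product using (Σ; ∃; _×_; _,_; proj₁; proj₂)
open import Data.Sum using (_⊎_; inj₁; inj₂; swap)
open import Data.Empty using (⊥; ⊥-elim)
open import Function using (_∘_; id)
open import Function.Definitions using (Injective)
open import Relation.Nullary using (¬_; Dec; yes; no; contradiction; does)
open import Relation.Nullary.Decidable using (⌊_⌋; toWitness; ¬?; _×-dec_; _→-dec_)
open import Relation.Binary.Definitions using (tri<; tri≈; tri>)
open import Relation.Binary.PropositionalEquality

-- The reason for adding A ∩ B: if A and B miss c and cover everything else, then in a circular
-- arrangement their complements are arcs through c, so the union of these is an arc and A ∩ B is
-- connected. Once c is deleted nothing enforces this, and an arrangement with A ∩ B in two pieces
-- cannot be extended to c. Complementing a row does not affect its circularity, so rows are read
-- relative to a reference column z, as entry xor entry at z. A twisted M_I(k)* then becomes a plain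
-- cycle with star column z, and its twist is column z itself. The words of `A-RowCol` are what
-- survives for k = 4, 5, 6: every other nonconstant twist of M_I(k)* equals one of these up to
-- permutations or contains the transpose of M_I(3)* or of its complement. The matrices of F fail
-- for rows only. Their transposes can always be arranged, so minimality has to be examined on one
-- side only.

true≢false : true ≢ false
true≢false ()

clash : ∀ {A : Set} {b} → b ≡ true → b ≡ false → A
clash refl ()

bool-case : ∀ b → b ≡ true ⊎ b ≡ false
bool-case true = inj₁ refl
bool-case false = inj₂ refl

bit : Bool → ℕ
bit true = 1
bit false = 0

count : ∀ {n} → (Fin n → Bool) → ℕ
count {zero} v = 0
count {suc n} v = bit (v zero) + count (v ∘ suc)

bit-mono : ∀ {a b} → (a ≡ true → b ≡ true) → bit a ≤ bit b
bit-mono {false} h = z≤n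
bit-mono {true} h rewrite h refl = ≤-refl

count-mono : ∀ {n} {u v : Fin n → Bool} → (∀ i → u i ≡ true → v i ≡ true) → count u ≤ count v
count-mono {zero} h = z≤n
count-mono {suc n} h = +-mono-≤ (bit-mono (h zero)) (count-mono (h ∘ suc))

count-mono-< : ∀ {n} {u v : Fin n → Bool} → (∀ i → u i ≡ true → v i ≡ true) →
  ∀ j → u j ≡ false → v j ≡ true → count u < count v
count-mono-< h zero uj vj rewrite uj | vj = s≤s (count-mono (h ∘ suc))
count-mono-< h (suc j) uj vj = +-mono-≤-< (bit-mono (h zero)) (count-mono-< (h ∘ suc) j uj vj)

count-all : ∀ n → count {n} (λ _ → true) ≡ n
count-all zero = refl
count-all (suc n) = cong suc (count-all n)

-- Circular arrangements

-- No four columns alternate in v: the circular counterpart of consecutiveness.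
NC : ∀ {n} → (Fin n → ℕ) → (Fin n → Bool) → Set
NC pos v = ∀ w x y z → pos w < pos x → pos x < pos y → pos y < pos z →
  v w ≡ v y → v x ≡ v z → v w ≡ v x

-- Positions need not be consecutive, so restriction to some of the columns is composition, and a
-- column can be inserted between two others.
Arr : ∀ {m n} → Mat m n → Set
Arr {n = n} M = Σ (Fin n → ℕ) λ pos → Injective _≡_ _≡_ pos × (∀ i → NC pos (M i))

injective⇒surjective : ∀ {n} (f : Fin n → Fin n) → Injective _≡_ _≡_ f → ∀ y → ∃ λ x → f x ≡ y
injective⇒surjective {suc n} f inj y with Fin.any? (λ x → f x Fin.≟ y)
... | yes p = p
... | no ¬p = contradiction
  (Fin.injective⇒≤ {f = λ x → punchOut (λ e → ¬p (x , sym e))}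
    (λ {i} {j} e → inj (Fin.punchOut-injective (λ q → ¬p (i , sym q)) (λ q → ¬p (j , sym q)) e)))
  1+n≰n

injective⇒permutation : ∀ {n} (f : Fin n → Fin n) → Injective _≡_ _≡_ f →
  Σ (Permutation′ n) λ π → ∀ x → π ⟨$⟩ʳ x ≡ f x
injective⇒permutation f inj =
  permutation f (λ y → proj₁ (sur y)) (λ y → proj₂ (sur y)) (λ x → inj (proj₂ (sur (f x)))) , λ _ → refl
  where sur = injective⇒surjective f inj

module Rank {n} (pos : Fin n → ℕ) where
  below : Fin n → Fin n → Bool
  below j i = ⌊ pos i <? pos j ⌋

  below-true : ∀ {i j} → pos i < pos j → below j i ≡ true
  below-true {i} {j} h with pos i <? pos j
  ... | yes _ = refl
  ... | no ¬h = contradiction h ¬h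

  below-true⁻ : ∀ {i j} → below j i ≡ true → pos i < pos j
  below-true⁻ {i} {j} h with pos i <? pos j
  ... | yes p = p
  below-true⁻ {i} {j} () | no _

  below-refl : ∀ j → below j j ≡ false
  below-refl j with pos j <? pos j
  ... | yes p = contradiction p (<-irrefl refl)
  ... | no _ = refl

  rank : Fin n → ℕ
  rank j = count (below j)

  rank< : ∀ j → rank j < n
  rank< j = subst (rank j <_) (count-all n) (count-mono-< (λ _ _ → refl) j (below-refl j) refl)

  rank-mono : ∀ {i j} → pos i < pos j → rank i < rank j
  rank-mono {i} {j} h =
    count-mono-< (λ k e → below-true (<-trans (below-true⁻ e) h)) i (below-refl i) (below-true h)

-- The rank of a column, which is the number of columns placed before it, is an injection of `Fin n`
-- into itself. Its inverse lists the columns in the order of `pos`.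
sort : ∀ {n} (pos : Fin n → ℕ) → Injective _≡_ _≡_ pos →
  Σ (Permutation′ n) λ σ → ∀ a b → toℕ a < toℕ b → pos (σ ⟨$⟩ʳ a) < pos (σ ⟨$⟩ʳ b)
sort {n} pos inj = σ , mono
  where
  open Rank pos
  rk : Fin n → Fin n
  rk j = fromℕ< (rank< j)
  toℕ-rk : ∀ j → toℕ (rk j) ≡ rank j
  toℕ-rk j = Fin.toℕ-fromℕ< (rank< j)
  rk-inj : Injective _≡_ _≡_ rk
  rk-inj {i} {j} e with <-cmp (pos i) (pos j) | trans (sym (toℕ-rk i)) (trans (cong toℕ e) (toℕ-rk j))
  ... | tri< h _ _ | q = contradiction (rank-mono h) (<-irrefl q)
  ... | tri≈ _ h _ | q = inj h
  ... | tri> _ _ h | q = contradiction (rank-mono h) (<-irrefl (sym q))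
  π : Permutation′ n
  π = proj₁ (injective⇒permutation rk rk-inj)
  σ : Permutation′ n
  σ = permutation (π ⟨$⟩ˡ_) (π ⟨$⟩ʳ_) (λ _ → inverseˡ π) (λ _ → inverseʳ π)
  rank-σ : ∀ a → rank (σ ⟨$⟩ʳ a) ≡ toℕ a
  rank-σ a = trans (sym (toℕ-rk _)) (cong toℕ (inverseʳ π))
  mono : ∀ a b → toℕ a < toℕ b → pos (σ ⟨$⟩ʳ a) < pos (σ ⟨$⟩ʳ b)
  mono a b h with <-cmp (pos (σ ⟨$⟩ʳ a)) (pos (σ ⟨$⟩ʳ b))
  ... | tri< q _ _ = q
  ... | tri≈ _ q _ = contradiction h (<-irrefl (trans (sym (rank-σ a)) (trans (cong rank (inj q)) (rank-σ b))))
  ... | tri> _ _ q = contradiction h (<-asym (subst₂ _<_ (rank-σ b) (rank-σ a) (rank-mono q)))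

firstT : ∀ {n} (v : Fin n → Bool) →
  (∀ j → v j ≡ false) ⊎ Σ (Fin n) λ s → v s ≡ true × (∀ j → toℕ j < toℕ s → v j ≡ false)
firstT {zero} v = inj₁ λ ()
firstT {suc n} v with bool-case (v zero)
... | inj₁ t = inj₂ (zero , t , λ _ ())
... | inj₂ f with firstT (v ∘ suc)
...   | inj₁ all = inj₁ λ { zero → f ; (suc j) → all j }
...   | inj₂ (s , t , h) = inj₂ (suc s , t , λ { zero _ → f ; (suc j) (s≤s q) → h j q })

lastT : ∀ {n} (v : Fin n → Bool) →
  (∀ j → v j ≡ false) ⊎ Σ (Fin n) λ s → v s ≡ true × (∀ j → toℕ s < toℕ j → v j ≡ false)
lastT {zero} v = inj₁ λ ()
lastT {suc n} v with lastT (v ∘ suc)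
... | inj₂ (s , t , h) = inj₂ (suc s , t , λ { zero () ; (suc j) (s≤s q) → h j q })
... | inj₁ all with bool-case (v zero)
...   | inj₁ t = inj₂ (zero , t , λ { (suc j) _ → all j })
...   | inj₂ f = inj₁ λ { zero → f ; (suc j) → all j }

not-true : ∀ {b} → not b ≡ true → b ≡ false
not-true {false} _ = refl

not-false : ∀ {b} → not b ≡ false → b ≡ true
not-false {true} _ = refl

≢true : ∀ {b} → (b ≡ true → ⊥) → b ≡ false
≢true {true} h = ⊥-elim (h refl)
≢true {false} h = refl

≢false : ∀ {b} → (b ≡ false → ⊥) → b ≡ true
≢false {false} h = ⊥-elim (h refl)
≢false {true} h = refl

cdist-≤ : ∀ {n} (s j : Fin n) → toℕ s ≤ toℕ j → cdist s j ≡ toℕ j ∸ toℕ s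
cdist-≤ s j h with toℕ s ≤? toℕ j
... | yes _ = refl
... | no ¬h = contradiction h ¬h

cdist-> : ∀ {n} (s j : Fin n) → toℕ j < toℕ s → cdist s j ≡ (n + toℕ j) ∸ toℕ s
cdist-> s j h with toℕ s ≤? toℕ j
... | yes q = contradiction h (≤⇒≯ q)
... | no _ = refl

-- Measured by `cdist s`, the true columns are the nearest ones. Wherever `s` falls among w, x, y,
-- z, an alternation puts a false column nearer to `s` than a true one.
CircConsec⇒NC : ∀ {n} (v : Fin n → Bool) → CircConsec v → NC toℕ v
CircConsec⇒NC v (inj₁ h) w x y z _ _ _ _ _ = trans (h w) (sym (h x))
CircConsec⇒NC {n} v (inj₂ (s , l , h)) w x y z wx xy yz wy xz =
  cases (bool-case (v w)) (bool-case (v x)) (toℕ s ≤? toℕ w) (toℕ s ≤? toℕ x) (toℕ s ≤? toℕ y)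
  where
  down : ∀ {A : Set} a b → cdist s a < cdist s b → v b ≡ true → v a ≡ false → A
  down a b d bT aF = clash (proj₂ (h a) (<-trans d (proj₁ (h b) bT))) aF
  ge : ∀ a b → toℕ s ≤ toℕ a → toℕ a < toℕ b → cdist s a < cdist s b
  ge a b sa ab rewrite cdist-≤ s a sa | cdist-≤ s b (≤-trans sa (<⇒≤ ab)) = ∸-monoˡ-< ab sa
  lt : ∀ a b → toℕ b < toℕ s → toℕ a < toℕ b → cdist s a < cdist s b
  lt a b bs ab rewrite cdist-> s a (<-trans ab bs) | cdist-> s b bs =
    ∸-monoˡ-< (+-monoʳ-< n ab) (≤-trans (<⇒≤ (Fin.toℕ<n s)) (m≤m+n n _))
  wrap : ∀ a b → toℕ s ≤ toℕ a → toℕ b < toℕ s → cdist s a < cdist s b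
  wrap a b sa bs rewrite cdist-≤ s a sa | cdist-> s b bs =
    ∸-monoˡ-< (≤-trans (Fin.toℕ<n a) (m≤m+n n _)) sa
  cases : v w ≡ true ⊎ v w ≡ false → v x ≡ true ⊎ v x ≡ false →
    Dec (toℕ s ≤ toℕ w) → Dec (toℕ s ≤ toℕ x) → Dec (toℕ s ≤ toℕ y) → v w ≡ v x
  cases (inj₁ p) (inj₁ q) _ _ _ = trans p (sym q)
  cases (inj₂ p) (inj₂ q) _ _ _ = trans p (sym q)
  cases (inj₁ p) (inj₂ q) (yes sw) _ _ =
    down x y (ge x y (≤-trans sw (<⇒≤ wx)) xy) (trans (sym wy) p) q
  cases (inj₁ p) (inj₂ q) (no _) (yes sx) _ = down x y (ge x y sx xy) (trans (sym wy) p) q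
  cases (inj₁ p) (inj₂ q) (no ¬sw) (no _) (yes sy) =
    down z w (wrap z w (≤-trans sy (<⇒≤ yz)) (≰⇒> ¬sw)) p (trans (sym xz) q)
  cases (inj₁ p) (inj₂ q) (no _) (no _) (no ¬sy) = down x y (lt x y (≰⇒> ¬sy) xy) (trans (sym wy) p) q
  cases (inj₂ p) (inj₁ q) (yes sw) _ _ =
    down y z (ge y z (≤-trans sw (<⇒≤ (<-trans wx xy))) yz) (trans (sym xz) q) (trans (sym wy) p)
  cases (inj₂ p) (inj₁ q) (no _) (yes sx) _ =
    down y z (ge y z (≤-trans sx (<⇒≤ xy)) yz) (trans (sym xz) q) (trans (sym wy) p)
  cases (inj₂ p) (inj₁ q) (no _) (no _) (yes sy) =
    down y z (ge y z sy yz) (trans (sym xz) q) (trans (sym wy) p)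
  cases (inj₂ p) (inj₁ q) (no _) (no ¬sx) (no _) = down w x (lt w x (≰⇒> ¬sx) wx) q p

-- If column zero is false, it serves as the outer column of an alternation, so the true columns
-- fill the interval from the first to the last of them. If it is true, the same holds for the false
-- columns, and the arc starts just after them and wraps around.
NC⇒CircConsec : ∀ {n} (v : Fin n → Bool) → NC toℕ v → CircConsec v
NC⇒CircConsec {zero} v nc = inj₁ λ ()
NC⇒CircConsec {suc n} v nc with bool-case (v zero)
NC⇒CircConsec {suc n} v nc | inj₂ 0F with firstT v | lastT v
... | inj₁ all | _ = inj₁ all
... | inj₂ _ | inj₁ all = inj₁ all
... | inj₂ (s , sT , sMin) | inj₂ (e , eT , eMax) =
  inj₂ (s , suc (toℕ e) ∸ toℕ s , λ j → to j , from j)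
  where
  0<s : 0 < toℕ s
  0<s with toℕ s in eq
  ... | zero = clash sT (subst (λ t → v t ≡ false) (Fin.toℕ-injective (sym eq)) 0F)
  ... | suc _ = s≤s z≤n
  to : ∀ j → v j ≡ true → cdist s j < suc (toℕ e) ∸ toℕ s
  to j jT rewrite cdist-≤ s j (≮⇒≥ λ h → clash jT (sMin j h)) =
    ∸-monoˡ-< (s≤s (≮⇒≥ λ h → clash jT (eMax j h))) (≮⇒≥ λ h → clash jT (sMin j h))
  from : ∀ j → cdist s j < suc (toℕ e) ∸ toℕ s → v j ≡ true
  from j h with toℕ s ≤? toℕ j
  ... | no sj = contradiction h (≤⇒≯ (∸-monoˡ-≤ (toℕ s) (≤-trans (Fin.toℕ<n e) (m≤m+n (suc n) (toℕ j)))))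
  ... | yes sj with <-cmp (toℕ s) (toℕ j) | <-cmp (toℕ j) (toℕ e)
  ...   | tri≈ _ q _ | _ = subst (λ t → v t ≡ true) (Fin.toℕ-injective q) sT
  ...   | tri> _ _ q | _ = contradiction sj (<⇒≱ q)
  ...   | tri< _ _ _ | tri≈ _ q _ = subst (λ t → v t ≡ true) (Fin.toℕ-injective (sym q)) eT
  ...   | tri< _ _ _ | tri> _ _ q = contradiction h (≤⇒≯ (∸-monoˡ-≤ (toℕ s) q))
  ...   | tri< sj′ _ _ | tri< je _ _ = ≢false λ jF →
            clash (trans (nc zero s j e 0<s sj′ je (trans 0F (sym jF)) (trans sT (sym eT))) sT) 0F
NC⇒CircConsec {suc n} v nc | inj₁ 0T with firstT (not ∘ v) | lastT (not ∘ v)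
... | inj₁ all | _ = inj₂ (zero , suc n , λ j → (λ _ → Fin.toℕ<n j) , λ _ → not-false (all j))
... | inj₂ _ | inj₁ all = inj₂ (zero , suc n , λ j → (λ _ → Fin.toℕ<n j) , λ _ → not-false (all j))
... | inj₂ (f , fF , fMin) | inj₂ (g , gF , gMax) = go (suc (toℕ g) <? suc n)
  where
  0<f : 0 < toℕ f
  0<f with toℕ f in eq
  ... | zero = clash (subst (λ t → v t ≡ true) (Fin.toℕ-injective (sym eq)) 0T) (not-true fF)
  ... | suc _ = s≤s z≤n
  mid : ∀ j → toℕ f ≤ toℕ j → toℕ j ≤ toℕ g → v j ≡ false
  mid j fj jg with <-cmp (toℕ f) (toℕ j) | <-cmp (toℕ j) (toℕ g)
  ... | tri≈ _ q _ | _ = subst (λ t → v t ≡ false) (Fin.toℕ-injective q) (not-true fF)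
  ... | tri> _ _ q | _ = contradiction fj (<⇒≱ q)
  ... | tri< _ _ _ | tri≈ _ q _ = subst (λ t → v t ≡ false) (Fin.toℕ-injective (sym q)) (not-true gF)
  ... | tri< _ _ _ | tri> _ _ q = contradiction jg (<⇒≱ q)
  ... | tri< fj′ _ _ | tri< jg′ _ _ = ≢true λ jT →
          clash 0T (trans (nc zero f j g 0<f fj′ jg′ (trans 0T (sym jT)) (trans (not-true fF) (sym (not-true gF)))) (not-true fF))
  side : ∀ j → v j ≡ true → toℕ j < toℕ f ⊎ toℕ g < toℕ j
  side j jT with toℕ f ≤? toℕ j
  ... | no ¬q = inj₁ (≰⇒> ¬q)
  ... | yes q = inj₂ (≰⇒> λ r → clash jT (mid j q r))
  go : Dec (suc (toℕ g) < suc n) → CircConsec v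
  -- The false columns reach the last column, so the arc does not wrap and is an initial segment.
  go (no ¬q) = inj₂ (zero , toℕ f , λ j → to j , λ h → not-false (fMin j h))
    where
    to : ∀ j → v j ≡ true → toℕ j < toℕ f
    to j jT with side j jT
    ... | inj₁ h = h
    ... | inj₂ h = contradiction (≤-trans (s≤s h) (Fin.toℕ<n j)) ¬q
  go (yes q) = inj₂ (s , suc n + toℕ f ∸ toℕ s , λ j → to j , from j)
    where
    s : Fin (suc n)
    s = fromℕ< q
    sg : toℕ s ≡ suc (toℕ g)
    sg = Fin.toℕ-fromℕ< q
    s≤n : toℕ s ≤ suc n
    s≤n = <⇒≤ (Fin.toℕ<n s)
    fg : toℕ f ≤ toℕ g
    fg = ≮⇒≥ λ h → clash fF (gMax f h)
    fs : toℕ f < toℕ s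
    fs = subst (toℕ f <_) (sym sg) (s≤s fg)
    to : ∀ j → v j ≡ true → cdist s j < suc n + toℕ f ∸ toℕ s
    to j jT with side j jT
    ... | inj₁ h rewrite cdist-> s j (<-trans h fs) = ∸-monoˡ-< (+-monoʳ-< (suc n) h) (≤-trans s≤n (m≤m+n (suc n) _))
    ... | inj₂ h rewrite cdist-≤ s j (subst (_≤ toℕ j) (sym sg) h) =
          ∸-monoˡ-< (≤-trans (Fin.toℕ<n j) (m≤m+n (suc n) _)) (subst (_≤ toℕ j) (sym sg) h)
    from : ∀ j → cdist s j < suc n + toℕ f ∸ toℕ s → v j ≡ true
    from j h with toℕ s ≤? toℕ j
    ... | yes p = not-false (gMax j (subst (_≤ toℕ j) sg p))
    ... | no p = not-false (fMin j (+-cancelˡ-< (suc n) _ _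
          (≰⇒> λ r → contradiction h (≤⇒≯ (∸-monoˡ-≤ (toℕ s) r)))))

Arr⇒C1Rows : ∀ {m n} {M : Mat m n} → Arr M → C1Rows M
Arr⇒C1Rows (pos , inj , nc) with sort pos inj
... | σ , mono = σ , λ i → NC⇒CircConsec _ λ w x y z wx xy yz →
  nc i _ _ _ _ (mono w x wx) (mono x y xy) (mono y z yz)

C1Rows⇒Arr : ∀ {m n} {M : Mat m n} → C1Rows M → Arr M
C1Rows⇒Arr {n = n} {M} (σ , cc) = pos , inj , nc
  where
  pos : Fin n → ℕ
  pos j = toℕ (σ ⟨$⟩ˡ j)
  inj : Injective _≡_ _≡_ pos
  inj e = trans (sym (inverseʳ σ)) (trans (cong (σ ⟨$⟩ʳ_) (Fin.toℕ-injective e)) (inverseʳ σ))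
  nc : ∀ i → NC pos (M i)
  nc i w x y z wx xy yz wy xz = trans (sym (back w)) (trans
    (CircConsec⇒NC (λ j → M i (σ ⟨$⟩ʳ j)) (cc i) _ _ _ _ wx xy yz
      (trans (back w) (trans wy (sym (back y)))) (trans (back x) (trans xz (sym (back z)))))
    (back x))
    where
    back : ∀ j → M i (σ ⟨$⟩ʳ (σ ⟨$⟩ˡ j)) ≡ M i j
    back j = cong (M i) (inverseʳ σ)

-- Embeddings and complementation of rows

twist : ∀ {m n} → (Fin m → Bool) → Mat m n → Mat m n
twist a M i j = a i xor M i j

-- Injectivity is left out and recovered in `Emb⇒Contains` from the distinct rows and columns of the
-- small matrix. Composition and the finite search then need not carry it.
record Emb {m n p q} (M : Mat m n) (N : Mat p q) : Set where
  constructor emb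
  field
    rows : Fin p → Fin m
    cols : Fin q → Fin n
    entries : ∀ i j → M (rows i) (cols j) ≡ N i j

Emb-trans : ∀ {m n p q r s} {L : Mat m n} {M : Mat p q} {N : Mat r s} → Emb L M → Emb M N → Emb L N
Emb-trans (emb f g h) (emb f′ g′ h′) = emb (f ∘ f′) (g ∘ g′) λ i j → trans (h _ _) (h′ i j)

Emb-transpose : ∀ {m n p q} {M : Mat m n} {N : Mat p q} → Emb M N → Emb (transpose M) (transpose N)
Emb-transpose (emb f g h) = emb g f λ i j → h j i

xor-cancelˡ : ∀ a {b c} → a xor b ≡ a xor c → b ≡ c
xor-cancelˡ false e = e
xor-cancelˡ true {b} {c} e = trans (sym (Bool.not-involutive b)) (trans (cong not e) (Bool.not-involutive c))

xor-involutive : ∀ a b → a xor (a xor b) ≡ b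
xor-involutive false b = refl
xor-involutive true b = Bool.not-involutive b

DistinctRows : ∀ {m n} → Mat m n → Set
DistinctRows M = ∀ i i′ → (∀ j → M i j ≡ M i′ j) → i ≡ i′

Emb⇒Contains : ∀ {m n p q} {M : Mat m n} {N : Mat p q} →
  DistinctRows N → DistinctRows (transpose N) → Emb M N → Contains M N
Emb⇒Contains {M = M} dr dc (emb f g h) = f , g ,
  (λ {i} {i′} e → dr i i′ λ j → trans (sym (h i j)) (trans (cong (λ t → M t (g j)) e) (h i′ j))) ,
  (λ {j} {j′} e → dc j j′ λ i → trans (sym (h i j)) (trans (cong (M (f i)) e) (h i j′))) , h

NC-xor : ∀ {n} {pos : Fin n → ℕ} {v : Fin n → Bool} b → NC pos v → NC pos (λ j → b xor v j)
NC-xor b nc w x y z wx xy yz wy xz =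
  cong (b xor_) (nc w x y z wx xy yz (xor-cancelˡ b wy) (xor-cancelˡ b xz))

NC-resp : ∀ {n} {pos : Fin n → ℕ} {u v : Fin n → Bool} → (∀ j → u j ≡ v j) → NC pos u → NC pos v
NC-resp e nc w x y z wx xy yz wy xz = trans (sym (e w)) (trans
  (nc w x y z wx xy yz (trans (e w) (trans wy (sym (e y)))) (trans (e x) (trans xz (sym (e z))))) (e x))

Arr-twist : ∀ {m n} {M : Mat m n} a → Arr M → Arr (twist a M)
Arr-twist {M = M} a (pos , inj , nc) = pos , inj , λ i → NC-xor {v = M i} (a i) (nc i)

Arr-resp : ∀ {m n} {M N : Mat m n} → (∀ i j → M i j ≡ N i j) → Arr M → Arr N
Arr-resp e (pos , inj , nc) = pos , inj , λ i → NC-resp (e i) (nc i)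

Arr-untwist : ∀ {m n} {M : Mat m n} a → Arr (twist a M) → Arr M
Arr-untwist a A = Arr-resp (λ i j → xor-involutive (a i) _) (Arr-twist a A)

Arr-sub : ∀ {m n p q} {M : Mat m n} (f : Fin p → Fin m) (g : Fin q → Fin n) → Injective _≡_ _≡_ g →
  Arr M → Arr (λ i j → M (f i) (g j))
Arr-sub f g gi (pos , inj , nc) = pos ∘ g , (λ e → gi (inj e)) , λ i w x y z → nc (f i) (g w) (g x) (g y) (g z)

-- Exhaustive checks over bit vectors

∀Vec : ∀ n → (Vec Bool n → Bool) → Bool
∀Vec zero f = f []
∀Vec (suc n) f = ∀Vec n (λ v → f (true ∷ v)) ∧ ∀Vec n (λ v → f (false ∷ v))

∧-split : ∀ {a b} → a ∧ b ≡ true → a ≡ true × b ≡ true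
∧-split {true} {true} _ = refl , refl

∀Vec-sound : ∀ n {f} → ∀Vec n f ≡ true → ∀ v → f v ≡ true
∀Vec-sound zero h [] = h
∀Vec-sound (suc n) h (true ∷ v) = ∀Vec-sound n (proj₁ (∧-split h)) v
∀Vec-sound (suc n) h (false ∷ v) = ∀Vec-sound n (proj₂ (∧-split h)) v

eqᵇ : Bool → Bool → Bool
eqᵇ a b = not (a xor b)

eqᵇ-true : ∀ {a b} → a ≡ b → eqᵇ a b ≡ true
eqᵇ-true {true} refl = refl
eqᵇ-true {false} refl = refl

eqᵇ-sound : ∀ {a b} → eqᵇ a b ≡ true → a ≡ b
eqᵇ-sound {true} {true} _ = refl
eqᵇ-sound {false} {false} _ = refl

-- In is invariant under complementing rows.
In : ∀ {m n} → Mat m n → Fin n → Fin m → Fin n → Bool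
In M z i x = M i x xor M i z

xor-false : ∀ {a b} → a xor b ≡ false → a ≡ b
xor-false {true} {true} _ = refl
xor-false {false} {false} _ = refl

xor-true : ∀ {a b} → a xor b ≡ true → a ≡ not b
xor-true {true} {false} _ = refl
xor-true {false} {true} _ = refl

-- Circular order through the sides of two columns

module Sides {n} (pos : Fin n → ℕ) (inj : Injective _≡_ _≡_ pos) where

  lt : Fin n → Fin n → Bool
  lt x y = ⌊ pos x <? pos y ⌋

  lt-true : ∀ {x y} → lt x y ≡ true → pos x < pos y
  lt-true {x} {y} h with pos x <? pos y
  ... | yes p = p
  lt-true () | no _

  lt-false : ∀ {x y} → x ≢ y → lt x y ≡ false → pos y < pos x
  lt-false {x} {y} ne h with pos x <? pos y
  lt-false ne () | yes p
  ... | no ¬p = ≤∧≢⇒< (≮⇒≥ ¬p) (λ e → ne (sym (inj e)))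

  lt-not : ∀ {x y} → x ≢ y → lt y x ≡ not (lt x y)
  lt-not {x} {y} ne with pos x <? pos y | pos y <? pos x
  ... | yes p | yes q = contradiction q (<-asym p)
  ... | yes p | no _ = refl
  ... | no _ | yes _ = refl
  ... | no p | no q = contradiction (inj (≤-antisym (≮⇒≥ q) (≮⇒≥ p))) ne

  -- Tells which of the two open arcs between y and z contains x.
  side : Fin n → Fin n → Fin n → Bool
  side y z x = lt y x xor lt z x

  module _ {v : Fin n → Bool} (nc : NC pos v) where
    cross : ∀ {lo hi i o} → pos lo < pos i → pos i < pos hi → pos o < pos lo ⊎ pos hi < pos o →
      v i ≡ v o → v lo ≡ v hi → v lo ≡ v i
    cross li ih (inj₁ ol) io lh = trans lh (trans (sym lh) (trans (sym (nc _ _ _ _ ol li ih (sym io) lh)) (sym io)))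
    cross li ih (inj₂ ho) io lh = nc _ _ _ _ li ih ho lh io

    -- Otherwise x, y, x′, z would alternate. In the first eight cases both sides compute to the
    -- same value; in each of the others one of x and x′ lies between y and z and the other outside,
    -- which is what `cross` excludes.
    same-side : ∀ {x x′ y z} → v x ≡ v x′ → v y ≡ v z → v x ≢ v y → side y z x ≡ side y z x′
    same-side {x} {x′} {y} {z} xx yz ne
      with bool-case (lt y x) | bool-case (lt z x) | bool-case (lt y x′) | bool-case (lt z x′)
    ... | inj₁ a | inj₁ b | inj₁ c | inj₁ d rewrite a | b | c | d = refl
    ... | inj₁ a | inj₁ b | inj₂ c | inj₂ d rewrite a | b | c | d = refl
    ... | inj₂ a | inj₂ b | inj₁ c | inj₁ d rewrite a | b | c | d = refl
    ... | inj₂ a | inj₂ b | inj₂ c | inj₂ d rewrite a | b | c | d = refl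
    ... | inj₁ a | inj₂ b | inj₁ c | inj₂ d rewrite a | b | c | d = refl
    ... | inj₁ a | inj₂ b | inj₂ c | inj₁ d rewrite a | b | c | d = refl
    ... | inj₂ a | inj₁ b | inj₁ c | inj₂ d rewrite a | b | c | d = refl
    ... | inj₂ a | inj₁ b | inj₂ c | inj₁ d rewrite a | b | c | d = refl
    ... | inj₁ a | inj₁ b | inj₁ c | inj₂ d = contradiction
          (trans xx (sym (cross (lt-true c) (lt-false z≢x′ d) (inj₂ (lt-true b)) (sym xx) yz))) ne
      where z≢x′ = λ e → ne (trans xx (trans (cong v (sym e)) (sym yz)))
    ... | inj₁ a | inj₁ b | inj₂ c | inj₁ d = contradiction
          (trans xx (trans (sym (cross (lt-true d) (lt-false y≢x′ c) (inj₂ (lt-true a)) (sym xx) (sym yz))) (sym yz))) ne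
      where y≢x′ = λ e → ne (trans xx (cong v (sym e)))
    ... | inj₂ a | inj₂ b | inj₁ c | inj₂ d = contradiction
          (trans xx (sym (cross (lt-true c) (lt-false z≢x′ d) (inj₁ (lt-false y≢x a)) (sym xx) yz))) ne
      where z≢x′ = λ e → ne (trans xx (trans (cong v (sym e)) (sym yz)))
            y≢x = λ e → ne (cong v (sym e))
    ... | inj₂ a | inj₂ b | inj₂ c | inj₁ d = contradiction
          (trans xx (trans (sym (cross (lt-true d) (lt-false y≢x′ c) (inj₁ (lt-false z≢x b)) (sym xx) (sym yz))) (sym yz))) ne
      where y≢x′ = λ e → ne (trans xx (cong v (sym e)))
            z≢x = λ e → ne (trans (cong v (sym e)) (sym yz))
    ... | inj₁ a | inj₂ b | inj₁ c | inj₁ d = contradiction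
          (sym (cross (lt-true a) (lt-false z≢x b) (inj₂ (lt-true d)) xx yz)) ne
      where z≢x = λ e → ne (trans (cong v (sym e)) (sym yz))
    ... | inj₂ a | inj₁ b | inj₁ c | inj₁ d = contradiction
          (trans (sym (cross (lt-true b) (lt-false y≢x a) (inj₂ (lt-true c)) xx (sym yz))) (sym yz)) ne
      where y≢x = λ e → ne (cong v (sym e))
    ... | inj₁ a | inj₂ b | inj₂ c | inj₂ d = contradiction
          (sym (cross (lt-true a) (lt-false z≢x b) (inj₁ (lt-false y≢x′ c)) xx yz)) ne
      where z≢x = λ e → ne (trans (cong v (sym e)) (sym yz))
            y≢x′ = λ e → ne (trans xx (cong v (sym e)))
    ... | inj₂ a | inj₁ b | inj₂ c | inj₂ d = contradiction
          (trans (sym (cross (lt-true b) (lt-false y≢x a) (inj₁ (lt-false z≢x′ d)) xx (sym yz))) (sym yz)) ne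
      where y≢x = λ e → ne (cong v (sym e))
            z≢x′ = λ e → ne (trans xx (trans (cong v (sym e)) (sym yz)))

  -- The bits are the comparisons among the three columns and of `z` with each of them. In the sum
  -- of all six terms every bit occurs twice, and the three negations, which come from `lt-not`,
  -- leave 1.
  parity : ∀ v → let b₀₁ = lookup v zero; b₀₂ = lookup v (suc zero); b₁₂ = lookup v (suc (suc zero))
                     a₀ = lookup v (suc (suc (suc zero))); a₁ = lookup v (suc (suc (suc (suc zero))))
                     a₂ = lookup v (suc (suc (suc (suc (suc zero))))) in
    not (eqᵇ (b₀₁ xor a₁) (b₀₂ xor a₂) ∧
         eqᵇ (not b₀₁ xor a₀) (b₁₂ xor a₂) ∧
         eqᵇ (not b₀₂ xor a₀) (not b₁₂ xor a₁)) ≡ true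
  parity = ∀Vec-sound 6 refl

  -- Summing the three equations modulo 2 leaves 0 = 1.
  no-asteroid : ∀ {z x₀ x₁ x₂} → x₀ ≢ x₁ → x₀ ≢ x₂ → x₁ ≢ x₂ →
    side x₀ z x₁ ≡ side x₀ z x₂ → side x₁ z x₀ ≡ side x₁ z x₂ → side x₂ z x₀ ≡ side x₂ z x₁ → ⊥
  no-asteroid {z} {x₀} {x₁} {x₂} n₀₁ n₀₂ n₁₂ e₀ e₁ e₂
    rewrite lt-not n₀₁ | lt-not n₀₂ | lt-not n₁₂
    with parity (lt x₀ x₁ ∷ lt x₀ x₂ ∷ lt x₁ x₂ ∷ lt z x₀ ∷ lt z x₁ ∷ lt z x₂ ∷ [])
  ... | q rewrite eqᵇ-true e₀ | eqᵇ-true e₁ | eqᵇ-true e₂ = contradiction q λ ()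

  same-side-In : ∀ {m} {M : Mat m n} {i x x′ y z} → NC pos (M i) →
    In M z i x ≡ true → In M z i x′ ≡ true → In M z i y ≡ false → side y z x ≡ side y z x′
  same-side-In {M = M} {i} {z = z} nc x∈ x′∈ y∉ =
    same-side nc (trans (xor-true x∈) (sym (xor-true x′∈))) (xor-false y∉)
      λ e → Bool.not-¬ (sym (trans (sym (xor-false y∉)) (sym e))) (xor-true x∈)

-- Cycles

==-refl : ∀ {a b} → a ≡ b → (a == b) ≡ true
==-refl {a} {b} e with a ≟ b
... | yes _ = refl
... | no ne = contradiction e ne

==-≢ : ∀ {a b} → a ≢ b → (a == b) ≡ false
==-≢ {a} {b} ne with a ≟ b
... | yes e = contradiction e ne
... | no _ = refl

==-sound : ∀ {a b} → (a == b) ≡ true → a ≡ b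
==-sound {a} {b} h with a ≟ b
... | yes e = e
==-sound () | no _

==-suc : ∀ a b → (suc a == suc b) ≡ (a == b)
==-suc a b with a ≟ b
... | yes e = ==-refl (cong suc e)
... | no ne = ==-≢ (ne ∘ suc-injective)

∨-true : ∀ {a b} → a ∨ b ≡ true → a ≡ true ⊎ b ≡ true
∨-true {true} _ = inj₁ refl
∨-true {false} h = inj₂ h

∨-false : ∀ {a b} → a ≡ false → b ≡ false → a ∨ b ≡ false
∨-false refl refl = refl

∨-trueˡ : ∀ {a b} → a ≡ true → a ∨ b ≡ true
∨-trueˡ refl = refl

∨-trueʳ : ∀ {a b} → b ≡ true → a ∨ b ≡ true
∨-trueʳ {a} refl = ∨-zeroʳ a

search : ∀ n (P : ℕ → Bool) → (∃ λ j → j < n × P j ≡ true) ⊎ (∀ j → j < n → P j ≡ false)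
search zero P = inj₂ λ _ ()
search (suc n) P with search n P | bool-case (P n)
... | inj₁ (j , h , e) | _ = inj₁ (j , m<n⇒m<1+n h , e)
... | inj₂ _ | inj₁ e = inj₁ (n , ≤-refl , e)
... | inj₂ all | inj₂ e = inj₂ λ j h → case j h
  where
  case : ∀ j → j < suc n → P j ≡ false
  case j h with m≤n⇒m<n∨m≡n (≤-pred h)
  ... | inj₁ q = all j q
  ... | inj₂ refl = e

-- Relative to z, the rows r 0, …, r (p ∸ 1), ρ form a copy of M_I(p + 1) on x 0, …, x p.
record Cycle {m n} (M : Mat m n) : Set where
  field
    p : ℕ
    2≤p : 2 ≤ p
    x : ℕ → Fin n
    z : Fin n
    r : ℕ → Fin m
    ρ : Fin m
    path : ∀ s j → s < p → j ≤ p → In M z (r s) (x j) ≡ (j == s) ∨ (j == suc s)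
    close : ∀ j → j ≤ p → In M z ρ (x j) ≡ (j == 0) ∨ (j == p)

  pathˡ : ∀ s → s < p → In M z (r s) (x s) ≡ true
  pathˡ s h = trans (path s s h (<⇒≤ h)) (∨-trueˡ (==-refl {s} refl))
  pathʳ : ∀ s → s < p → In M z (r s) (x (suc s)) ≡ true
  pathʳ s h = trans (path s (suc s) h h) (∨-trueʳ (==-refl {suc s} refl))
  path-out : ∀ s j → s < p → j ≤ p → j ≢ s → j ≢ suc s → In M z (r s) (x j) ≡ false
  path-out s j h h′ a b = trans (path s j h h′) (∨-false (==-≢ a) (==-≢ b))
  closeˡ : In M z ρ (x 0) ≡ true
  closeˡ = close 0 z≤n
  closeʳ : In M z ρ (x p) ≡ true
  closeʳ = trans (close p ≤-refl) (∨-trueʳ (==-refl {p} refl))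
  close-out : ∀ j → j ≤ p → j ≢ 0 → j ≢ p → In M z ρ (x j) ≡ false
  close-out j h a b = trans (close j h) (∨-false (==-≢ a) (==-≢ b))

In-≢ : ∀ {m n} {M : Mat m n} {z x y} i → In M z i x ≡ true → In M z i y ≡ false → x ≢ y
In-≢ i h h′ refl = clash h h′

-- The asteroid is x 0, x 1, x 2. Row r 1 joins x 1 to x 2 without x 0, and row r 0 joins x 0 to x 1
-- without x 2. The columns x 2 and x 0 are joined without x 1 the long way round, along x 2, ..., x
-- p and then through ρ.
Cycle⇒¬Arr : ∀ {m n} {M : Mat m n} → Cycle M → ¬ Arr M
Cycle⇒¬Arr {M = M} C (pos , inj , nc) = no-asteroid
    (In-≢ {M = M} (r 1) (pathˡ 1 2≤p) (path-out 1 0 2≤p z≤n (λ ()) (λ ())) ∘ sym)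
    (In-≢ {M = M} (r 0) (pathˡ 0 0<p) (path-out 0 2 0<p 2≤p (λ ()) (λ ())))
    (In-≢ {M = M} (r 0) (pathʳ 0 0<p) (path-out 0 2 0<p 2≤p (λ ()) (λ ())))
    (along 1 (x 1) (x 2) 0 (pathˡ 1 2≤p) (pathʳ 1 2≤p) (path-out 1 0 2≤p z≤n (λ ()) (λ ())))
    (sym (trans (around p ≤-refl 2≤p)
      (same-side-In {M = M} (nc ρ) closeʳ closeˡ (close-out 1 0<p (λ ()) (λ e → <⇒≢ 2≤p e)))))
    (along 0 (x 0) (x 1) 2 (pathˡ 0 0<p) (pathʳ 0 0<p) (path-out 0 2 0<p 2≤p (λ ()) (λ ())))
  where
  open Cycle C
  open Sides pos inj
  0<p : 0 < p
  0<p = <⇒≤ 2≤p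
  along : ∀ s a b j → In M z (r s) a ≡ true → In M z (r s) b ≡ true → In M z (r s) (x j) ≡ false →
    side (x j) z a ≡ side (x j) z b
  along s a b j = same-side-In {M = M} (nc (r s))
  around : ∀ t → t ≤ p → 2 ≤ t → side (x 1) z (x 2) ≡ side (x 1) z (x t)
  around (suc t) h 2≤ with m≤n⇒m<n∨m≡n 2≤
  ... | inj₂ refl = refl
  ... | inj₁ (s≤s 2≤t) = trans (around t (<⇒≤ h) 2≤t)
    (along t (x t) (x (suc t)) 1 (pathˡ t h) (pathʳ t h)
      (path-out t 1 h 0<p (<⇒≢ 2≤t) (<⇒≢ (m<n⇒m<1+n 2≤t))))

star-inject : ∀ {m n} (M : Mat m n) i j → star M i (inject₁ j) ≡ M i j
star-inject {n = n} M i j with n ≟ toℕ (inject₁ j)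
... | yes e = contradiction (trans e (Fin.toℕ-inject₁ j)) (<⇒≢ (Fin.toℕ<n j) ∘ sym)
... | no ne = cong (M i) (Fin.lower₁-inject₁′ j ne)

star-last : ∀ {m n} (M : Mat m n) i → star M i (fromℕ n) ≡ false
star-last {n = n} M i with n ≟ toℕ (fromℕ n)
... | yes _ = refl
... | no ne = contradiction (sym (Fin.toℕ-fromℕ n)) ne

-- Paths are indexed by ℕ with bounds in their laws; indices above p are sent to p by default.
clamp : ∀ p → ℕ → Fin (suc p)
clamp p j = fromℕ< (s≤s (m⊓n≤n j p))

toℕ-clamp : ∀ {p j} → j ≤ p → toℕ (clamp p j) ≡ j
toℕ-clamp {p} {j} h = trans (Fin.toℕ-fromℕ< _) (m≤n⇒m⊓n≡m h)

xor-back : ∀ a b → a xor (b xor a) ≡ b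
xor-back a b = trans (cong (a xor_) (xor-comm b a)) (xor-involutive a b)

xor-cancel-common : ∀ a b → (a xor b) xor (a xor false) ≡ b
xor-cancel-common false b = xor-identityʳ b
xor-cancel-common true true = refl
xor-cancel-common true false = refl

-- With `z` the image of the star column, where the untwisted matrix is zero, reading entries
-- relative to `z` cancels `a`.
Emb⇒Cycle : ∀ {m n} {M : Mat m n} {p} a → 2 ≤ p → Emb M (twist a (star (MI (suc p)))) → Cycle M
Emb⇒Cycle {M = M} {p} a 2≤p (emb f g h) = record
  { p = p ; 2≤p = 2≤p ; x = λ j → g (inject₁ (clamp p j)) ; z = g (fromℕ (suc p))
  ; r = λ s → f (clamp p s) ; ρ = f (fromℕ p) ; path = path ; close = close }
  where
  entry : ∀ i j → In M (g (fromℕ (suc p))) (f i) (g (inject₁ j)) ≡ MI (suc p) i j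
  entry i j = trans (cong₂ _xor_ (trans (h i (inject₁ j)) (cong (a i xor_) (star-inject (MI (suc p)) i j)))
    (trans (h i (fromℕ (suc p))) (cong (a i xor_) (star-last (MI (suc p)) i)))) (xor-cancel-common (a i) _)
  path : ∀ s j → s < p → j ≤ p → _ ≡ (j == s) ∨ (j == suc s)
  path s j s<p j≤p = trans (entry (clamp p s) (clamp p j)) eq
    where
    eq : MI (suc p) (clamp p s) (clamp p j) ≡ (j == s) ∨ (j == suc s)
    eq rewrite toℕ-clamp (<⇒≤ s<p) | toℕ-clamp j≤p | ==-≢ (<⇒≢ s<p) = cong ((j == s) ∨_) (∨-identityʳ _)
  close : ∀ j → j ≤ p → _ ≡ (j == 0) ∨ (j == p)
  close j j≤p = trans (entry (fromℕ p) (clamp p j)) eq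
    where
    eq : MI (suc p) (fromℕ p) (clamp p j) ≡ (j == 0) ∨ (j == p)
    eq rewrite Fin.toℕ-fromℕ p | toℕ-clamp j≤p | ==-≢ (<⇒≢ (s≤s j≤p)) | ==-refl {p} refl =
      ∨-comm (j == p) (j == 0)

Cycle⇒Emb : ∀ {m n} {M : Mat m n} (C : Cycle M) →
  Σ (Fin (suc (Cycle.p C)) → Bool) λ a → Emb M (twist a (star (MI (suc (Cycle.p C)))))
Cycle⇒Emb {m} {n} {M} C = (λ i → M (f i) z) , emb f g h
  where
  open Cycle C
  f : Fin (suc p) → Fin m
  f i with toℕ i <? p
  ... | yes _ = r (toℕ i)
  ... | no _ = ρ
  g : Fin (suc (suc p)) → Fin n
  g j with suc p ≟ toℕ j
  ... | yes _ = z
  ... | no _ = x (toℕ j)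
  h : ∀ i j → M (f i) (g j) ≡ M (f i) z xor star (MI (suc p)) i j
  h i j with suc p ≟ toℕ j
  ... | yes _ = sym (xor-identityʳ _)
  ... | no ne rewrite Fin.toℕ-lower₁ j ne = trans (sym (xor-back (M (f i) z) _)) (cong (M (f i) z xor_) (row i))
    where
    j≤p : toℕ j ≤ p
    j≤p = ≤-pred (≤∧≢⇒< (≤-pred (Fin.toℕ<n j)) (ne ∘ sym))
    row : ∀ i → In M z (f i) (x (toℕ j)) ≡
      (toℕ j == toℕ i) ∨ (toℕ j == suc (toℕ i)) ∨ ((toℕ i == p) ∧ (toℕ j == 0))
    row i with toℕ i <? p
    ... | yes q rewrite ==-≢ (<⇒≢ q) = trans (path (toℕ i) (toℕ j) q j≤p) (cong ((toℕ j == toℕ i) ∨_) (sym (∨-identityʳ _)))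
    ... | no q rewrite ≤-antisym (≤-pred (Fin.toℕ<n i)) (≮⇒≥ q) | ==-refl {p} refl | ==-≢ (<⇒≢ (s≤s j≤p)) =
      trans (close (toℕ j) j≤p) (∨-comm (toℕ j == 0) (toℕ j == p))

-- Path rows may contain further columns x j; shortcuts along them end in a Cycle.
record LooseCycle {m n} (M : Mat m n) (z : Fin n) (p : ℕ) : Set where
  field
    0<p : 0 < p
    x : ℕ → Fin n
    r : ℕ → Fin m
    ρ : Fin m
    edgeˡ : ∀ s → s < p → In M z (r s) (x s) ≡ true
    edgeʳ : ∀ s → s < p → In M z (r s) (x (suc s)) ≡ true
    closeˡ : In M z ρ (x 0) ≡ true
    closeʳ : In M z ρ (x p) ≡ true
    inner : ∀ j → 0 < j → j < p → In M z ρ (x j) ≡ false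
    short : ∀ s → s < p → In M z (r s) (x 0) ≡ true → In M z (r s) (x p) ≡ true → ⊥

-- Row r t takes the place of the d + 1 edges from x a to x (a + suc d), and the d columns between
-- them are dropped. All rows of the new path occur in the old one, so `short` is inherited.
module Shortcut {m n} {M : Mat m n} {z} {a d e} (0<d : 0 < d)
  (L : LooseCycle M z (a + suc (d + e))) (t : ℕ) (t< : t < a + suc (d + e))
  (ta : In M z (LooseCycle.r L t) (LooseCycle.x L a) ≡ true)
  (tb : In M z (LooseCycle.r L t) (LooseCycle.x L (a + suc d)) ≡ true) where
  open LooseCycle L
  p′ : ℕ
  p′ = a + suc e
  p≡ : p′ + d ≡ a + suc (d + e)
  p≡ = trans (+-assoc a (suc e) d) (cong (λ q → a + suc q) (+-comm e d))
  shorter : p′ < a + suc (d + e)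
  shorter = subst (p′ <_) p≡ (m<m+n p′ 0<d)
  x′ : ℕ → Fin n
  x′ i with i ≤? a
  ... | yes _ = x i
  ... | no _ = x (i + d)
  x′-≤ : ∀ i → i ≤ a → x′ i ≡ x i
  x′-≤ i h with i ≤? a
  ... | yes _ = refl
  ... | no ¬h = contradiction h ¬h
  x′-> : ∀ i → a < i → x′ i ≡ x (i + d)
  x′-> i h with i ≤? a
  ... | yes q = contradiction q (<⇒≱ h)
  ... | no _ = refl
  index : ℕ → ℕ
  index i with <-cmp i a
  ... | tri< _ _ _ = i
  ... | tri≈ _ _ _ = t
  ... | tri> _ _ _ = i + d
  index< : ∀ s → s < p′ → index s < a + suc (d + e)
  index< s h with <-cmp s a
  ... | tri< q _ _ = ≤-trans q (m≤m+n a _)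
  ... | tri≈ _ _ _ = t<
  ... | tri> _ _ _ = subst (s + d <_) p≡ (+-monoˡ-< d h)
  0≤a : x′ 0 ≡ x 0
  0≤a = x′-≤ 0 z≤n
  end : x′ p′ ≡ x (a + suc (d + e))
  end = trans (x′-> p′ (m<m+n a (s≤s z≤n))) (cong x p≡)
  edgeˡ′ : ∀ s → s < p′ → In M z (r (index s)) (x′ s) ≡ true
  edgeˡ′ s h with <-cmp s a
  ... | tri< q _ _ rewrite x′-≤ s (<⇒≤ q) = edgeˡ s (≤-trans q (m≤m+n a _))
  ... | tri≈ _ refl _ rewrite x′-≤ s ≤-refl = ta
  ... | tri> _ _ q rewrite x′-> s q = edgeˡ (s + d) (subst (s + d <_) p≡ (+-monoˡ-< d h))
  edgeʳ′ : ∀ s → s < p′ → In M z (r (index s)) (x′ (suc s)) ≡ true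
  edgeʳ′ s h with <-cmp s a
  ... | tri< q _ _ rewrite x′-≤ (suc s) q = edgeʳ s (≤-trans q (m≤m+n a _))
  ... | tri≈ _ refl _ rewrite x′-> (suc s) ≤-refl | sym (+-suc s d) = tb
  ... | tri> _ _ q rewrite x′-> (suc s) (m<n⇒m<1+n q) = edgeʳ (s + d) (subst (s + d <_) p≡ (+-monoˡ-< d h))
  inner′ : ∀ j → 0 < j → j < p′ → In M z ρ (x′ j) ≡ false
  inner′ j 0<j h with j ≤? a
  ... | yes q = inner j 0<j (≤-<-trans q (m<m+n a (s≤s z≤n)))
  ... | no q = inner (j + d) (≤-trans 0<j (m≤m+n j d)) (subst (j + d <_) p≡ (+-monoˡ-< d h))
  result : LooseCycle M z p′
  result = record
    { 0<p = ≤-trans (s≤s z≤n) (m≤n+m (suc e) a)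
    ; x = x′ ; r = r ∘ index ; ρ = ρ ; edgeˡ = edgeˡ′ ; edgeʳ = edgeʳ′
    ; closeˡ = subst (λ t → In M z ρ t ≡ true) (sym 0≤a) closeˡ
    ; closeʳ = subst (λ t → In M z ρ t ≡ true) (sym end) closeʳ
    ; inner = inner′
    ; short = λ s h u v → short (index s) (index< s h)
        (subst (λ t → In M z (r (index s)) t ≡ true) 0≤a u)
        (subst (λ t → In M z (r (index s)) t ≡ true) end v) }

shortcut : ∀ {m n} {M : Mat m n} {z p} (L : LooseCycle M z p) a b t → suc (suc a) ≤ b → b ≤ p → t < p →
  In M z (LooseCycle.r L t) (LooseCycle.x L a) ≡ true →
  In M z (LooseCycle.r L t) (LooseCycle.x L b) ≡ true → ∃ λ p′ → p′ < p × LooseCycle M z p′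
shortcut {p = p} L a b t ab bp tp ta tb with b ∸ suc (suc a) in d≡ | p ∸ b in e≡
... | d | e with b≡ | p≡
  where
  b≡ : a + suc (suc d) ≡ b
  b≡ = trans (+-suc a (suc d)) (trans (cong suc (+-suc a d)) (trans (cong (suc (suc a) +_) (sym d≡)) (m+[n∸m]≡n ab)))
  p≡ : a + suc (suc d + e) ≡ p
  p≡ = trans (sym (+-assoc a (suc (suc d)) e)) (trans (cong₂ _+_ b≡ (sym e≡)) (m+[n∸m]≡n bp))
... | refl | refl = _ , S.shorter , S.result
  where module S = Shortcut {a = a} {d = suc d} {e = e} (s≤s z≤n) L t tp ta tb

-- If a path row contains a third column of the path, it joins this column to the farther of its own
-- two columns. These are at least two steps apart, which is enough for a shortcut.
chord : ∀ {m n} {M : Mat m n} {z p} (L : LooseCycle M z p) →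
  (∃ λ p′ → p′ < p × LooseCycle M z p′) ⊎
  (∀ s j → s < p → j ≤ p → In M z (LooseCycle.r L s) (LooseCycle.x L j) ≡ (j == s) ∨ (j == suc s))
chord {M = M} {z} {p} L = go
  where
  open LooseCycle L
  bad : ℕ → ℕ → Bool
  bad s j = In M z (r s) (x j) ∧ not ((j == s) ∨ (j == suc s))
  go : _ ⊎ _
  fine : (∀ s → s < p → ∀ j → j < suc p → bad s j ≡ false) →
    ∀ s j → s < p → j ≤ p → In M z (r s) (x j) ≡ (j == s) ∨ (j == suc s)
  fine ok s j s< j≤ with bool-case ((j == s) ∨ (j == suc s))
  ... | inj₁ t rewrite t with ∨-true {j == s} t
  ...   | inj₁ q rewrite ==-sound {j} q = edgeˡ s s<
  ...   | inj₂ q rewrite ==-sound {j} q = edgeʳ s s<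
  fine ok s j s< j≤ | inj₂ f with ok s s< j (s≤s j≤)
  ... | q rewrite f = trans (sym (Bool.∧-identityʳ _)) q
  rows : ∀ q → q ≤ p → (∃ λ p′ → p′ < p × LooseCycle M z p′) ⊎ (∀ s → s < q → ∀ j → j < suc p → bad s j ≡ false)
  rows zero _ = inj₂ λ _ ()
  rows (suc q) q≤ with rows q (<⇒≤ q≤) | search (suc p) (bad q)
  ... | inj₁ c | _ = inj₁ c
  ... | inj₂ ok | inj₂ ok′ = inj₂ λ s h → last s h
    where
    last : ∀ s → s < suc q → ∀ j → j < suc p → bad s j ≡ false
    last s h with m≤n⇒m<n∨m≡n (≤-pred h)
    ... | inj₁ h′ = ok s h′
    ... | inj₂ refl = ok′
  ... | inj₂ _ | inj₁ (j , j< , b) with ∧-split {In M z (r q) (x j)} b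
  ...   | i , o with <-cmp j q
  ...     | tri< j<q _ _ = inj₁ (shortcut L j (suc q) q (s≤s j<q) q≤ q≤ i (edgeʳ q q≤))
  ...     | tri≈ _ j≡q _ = clash (∨-trueˡ {j == q} (==-refl j≡q)) (not-true o)
  ...     | tri> _ _ q<j with m≤n⇒m<n∨m≡n q<j
  ...       | inj₁ q<<j = inj₁ (shortcut L q j q q<<j (≤-pred j<) q≤ (edgeˡ q q≤) i)
  ...       | inj₂ sq≡j = clash (∨-trueʳ {j == q} (==-refl (sym sq≡j))) (not-true o)
  go with rows p ≤-refl
  ... | inj₁ c = inj₁ c
  ... | inj₂ ok = inj₂ (fine ok)

LooseCycle⇒Cycle : ∀ {m n} {M : Mat m n} {z p} → LooseCycle M z p → Cycle M
LooseCycle⇒Cycle {M = M} {z} {p} L = go (suc p) p ≤-refl L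
  where
  go : ∀ bound p → p < bound → LooseCycle M z p → Cycle M
  go (suc bound) p (s≤s h) L with chord L
  ... | inj₁ (p′ , p′<p , L′) = go bound p′ (≤-trans p′<p h) L′
  ... | inj₂ exact = record
    { p = p ; 2≤p = 2≤p ; x = x ; z = z ; r = r ; ρ = ρ ; path = exact ; close = close }
    where
    open LooseCycle L
    2≤p : 2 ≤ p
    2≤p with m≤n⇒m<n∨m≡n 0<p
    ... | inj₁ q = q
    -- A path of one edge would have a row that contains both of its ends; `short` forbids this.
    ... | inj₂ refl = ⊥-elim (short 0 (s≤s z≤n) (edgeˡ 0 (s≤s z≤n)) (edgeʳ 0 (s≤s z≤n)))
    close : ∀ j → j ≤ p → In M z ρ (x j) ≡ (j == 0) ∨ (j == p)
    close zero _ = closeˡ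
    close (suc j) h with m≤n⇒m<n∨m≡n h
    ... | inj₁ q rewrite ==-≢ (<⇒≢ q) = inner (suc j) (s≤s z≤n) q
    ... | inj₂ refl rewrite ==-refl {suc j} refl = closeʳ

-- One step of rotation makes `r 0` the closing row and `ρ` the last row of the path. It serves to
-- bring a chosen row into the closing position, and to bring `ρ` next to a path row.
module Rotation {m n} {M : Mat m n} (C : Cycle M) where
  open Cycle C
  x′ : ℕ → Fin n
  x′ j with j <? p
  ... | yes _ = x (suc j)
  ... | no _ = x 0
  r′ : ℕ → Fin m
  r′ s with suc s <? p
  ... | yes _ = r (suc s)
  ... | no _ = ρ
  path′ : ∀ s j → s < p → j ≤ p → In M z (r′ s) (x′ j) ≡ (j == s) ∨ (j == suc s)
  path′ s j s<p j≤p with suc s <? p | j <? p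
  ... | yes q | yes q′ = trans (path (suc s) (suc j) q q′) (cong₂ _∨_ (==-suc j s) (==-suc j (suc s)))
  ... | yes q | no q′ rewrite ≤-antisym j≤p (≮⇒≥ q′) =
    trans (path-out (suc s) 0 q z≤n (λ ()) (λ ()))
      (sym (∨-false (==-≢ (<⇒≢ s<p ∘ sym)) (==-≢ (<⇒≢ q ∘ sym))))
  ... | no q | yes q′ rewrite ==-≢ {j} {suc s} (λ e → q (subst (_< p) e q′)) =
    trans (close (suc j) q′) (trans (cong (_∨ (suc j == p)) (==-≢ {suc j} {0} λ ()))
      (trans (trans (cong (suc j ==_) (≤-antisym (≮⇒≥ q) s<p)) (==-suc j s)) (sym (∨-identityʳ _))))
  ... | no q | no q′ = trans closeˡ (sym (∨-trueʳ (==-refl (trans (≤-antisym j≤p (≮⇒≥ q′)) (≤-antisym (≮⇒≥ q) s<p)))))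
  close′ : ∀ j → j ≤ p → In M z (r 0) (x′ j) ≡ (j == 0) ∨ (j == p)
  close′ j j≤p with j <? p
  ... | yes q rewrite ==-≢ (<⇒≢ q) = trans (path 0 (suc j) (<⇒≤ 2≤p) q)
    (trans (cong (_∨ (suc j == 1)) (==-≢ {suc j} {0} λ ())) (trans (==-suc j 0) (sym (∨-identityʳ _))))
  ... | no q = trans (pathˡ 0 (<⇒≤ 2≤p)) (sym (∨-trueʳ (==-refl (≤-antisym j≤p (≮⇒≥ q)))))
  result : Cycle M
  result = record { p = p ; 2≤p = 2≤p ; x = x′ ; z = z ; r = r′ ; ρ = r 0 ; path = path′ ; close = close′ }
  r′-suc : ∀ {s} → suc s < p → r′ s ≡ r (suc s)
  r′-suc {s} h with suc s <? p
  ... | yes _ = refl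
  ... | no ¬h = contradiction h ¬h
  r′-last : ∀ {s} → p ≤ suc s → r′ s ≡ ρ
  r′-last {s} h with suc s <? p
  ... | yes q = contradiction h (<⇒≱ q)
  ... | no _ = refl

rotate-to : ∀ {m n} {M : Mat m n} (C : Cycle M) s → s < Cycle.p C → Σ (Cycle M) λ C′ → Cycle.ρ C′ ≡ Cycle.r C s
rotate-to C zero h = Rotation.result C , refl
rotate-to C (suc s) h with rotate-to (Rotation.result C) s (<⇒≤ h)
... | C′ , e = C′ , trans e (Rotation.r′-suc C h)

-- Finite search

Table : ℕ → ℕ → Set
Table m n = Vec (Vec Bool n) m

mat : ∀ {m n} → Table m n → Mat m n
mat T i j = lookup (lookup T i) j

table : ∀ {m n} → Mat m n → Table m n
table M = tabulate λ i → tabulate (M i)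

mat-table : ∀ {m n} (M : Mat m n) i j → mat (table M) i j ≡ M i j
mat-table M i j = trans (cong (λ r → lookup r j) (lookup∘tabulate _ i)) (lookup∘tabulate (M i) j)

∀Fin : ∀ n → (Fin n → Bool) → Bool
∀Fin zero f = true
∀Fin (suc n) f = f zero ∧ ∀Fin n (f ∘ suc)

∀Fin-sound : ∀ n {f} → ∀Fin n f ≡ true → ∀ i → f i ≡ true
∀Fin-sound (suc n) h zero = proj₁ (∧-split h)
∀Fin-sound (suc n) h (suc i) = ∀Fin-sound n (proj₂ (∧-split h)) i

-- Embeddings are sought up to complementation of rows if cm is true.
-- The search itself is not verified, only its result is checked.
module Search (cm : Bool) where

  -- For each row of the pattern, the rows of the large matrix, with a flag for complementation,
  -- that agree with it on the columns chosen so far.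
  Candidates : ℕ → ℕ → Set
  Candidates m p = Vec (List (Fin m × Bool)) p

  -- Prunes the search as soon as a pattern row has no candidate left, and reads off the rows at its
  -- end.
  heads : ∀ {A : Set} {p} → Vec (List A) p → Maybe (Vec A p)
  heads [] = just []
  heads ([] ∷ _) = nothing
  heads ((a ∷ _) ∷ v) = Maybe.map (a ∷_) (heads v)

  keep : ∀ {m} → Vec Bool m → Bool → List (Fin m × Bool) → List (Fin m × Bool)
  keep col b [] = []
  keep col b ((f , a) ∷ l) = if eqᵇ (lookup col f) (a xor b) then (f , a) ∷ keep col b l else keep col b l

  Found : ℕ → ℕ → ℕ → ℕ → Set
  Found m n p q = Vec (Fin n) q × Vec (Fin m × Bool) p

  search-columns : ∀ {m n p q} → List (Fin n × Vec Bool m) → Vec (Vec Bool p) q → Candidates m p → Maybe (Found m n p q)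
  try-columns : ∀ {m n p q} → List (Fin n × Vec Bool m) → List (Fin n × Vec Bool m) →
    Vec Bool p → Vec (Vec Bool p) q → Candidates m p → Maybe (Found m n p (suc q))
  extend : ∀ {m n p q} → List (Fin n × Vec Bool m) → Fin n → Vec (Vec Bool p) q → Candidates m p →
    Maybe (Vec (Fin m × Bool) p) → Maybe (Found m n p (suc q))
  search-columns all [] cs = Maybe.map (λ f → [] , f) (heads cs)
  search-columns all (d ∷ ds) cs = try-columns all all d ds cs
  try-columns all [] d ds cs = nothing
  try-columns all ((y , col) ∷ ys) d ds cs with extend all y ds (Vec.zipWith (keep col) d cs) (heads (Vec.zipWith (keep col) d cs))
  ... | just r = just r
  ... | nothing = try-columns all ys d ds cs
  extend all y ds cs nothing = nothing
  extend all y ds cs (just _) = Maybe.map (λ { (g , f) → y ∷ g , f }) (search-columns all ds cs)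

  start : ∀ m → List (Fin m × Bool)
  start m = List.concatMap (λ f → if cm then (f , false) ∷ (f , true) ∷ [] else (f , false) ∷ []) (List.allFin m)

  find : ∀ {m n p q} → Table m n → Table p q → Maybe (Found m n p q)
  find {m} {n} {p} T N = search-columns
    (Vec.toList (Vec.zip (Vec.allFin n) (Vec.transpose T))) (Vec.transpose N) (Vec.replicate p (start m))

  check : ∀ {m n p q} → Table m n → Table p q → Found m n p q → Bool
  check {p = p} {q} T N (g , f) = ∀Fin p λ i → (cm ∨ not (proj₂ (lookup f i))) ∧
    ∀Fin q λ j → eqᵇ (mat T (proj₁ (lookup f i)) (lookup g j)) (proj₂ (lookup f i) xor mat N i j)

  verdict : ∀ {m n p q} → Table m n → Table p q → Maybe (Found m n p q) → Bool
  verdict T N nothing = false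
  verdict T N (just r) = check T N r

  embeds : ∀ {m n p q} → Table m n → Table p q → Bool
  embeds T N = verdict T N (find T N)

  -- The result of the search is a variable here, so the proof never unfolds the search. For
  -- `cm = false` the last component makes `b` constantly false, and the embedding is plain.
  verdict-sound : ∀ {m n p q} (T : Table m n) (N : Table p q) r → verdict T N r ≡ true →
    Σ (Fin p → Bool) λ b → Emb (mat T) (twist b (mat N)) × (∀ i → cm ∨ not (b i) ≡ true)
  verdict-sound {p = p} {q} T N (just (g , f)) h = proj₂ ∘ lookup f ,
    emb (proj₁ ∘ lookup f) (lookup g) (λ i j →
      eqᵇ-sound (∀Fin-sound q (proj₂ (∧-split {cm ∨ not (proj₂ (lookup f i))} (∀Fin-sound p h i))) j)) ,
    λ i → proj₁ (∧-split {cm ∨ not (proj₂ (lookup f i))} (∀Fin-sound p h i))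

  embeds-sound : ∀ {m n p q} (T : Table m n) (N : Table p q) → embeds T N ≡ true →
    Σ (Fin p → Bool) λ b → Emb (mat T) (twist b (mat N)) × (∀ i → cm ∨ not (b i) ≡ true)
  embeds-sound T N = verdict-sound T N (find T N)

-- Up to complementation of rows, M_IV is M_V*.
MIV : Table 4 6
MIV = (true ∷ true ∷ false ∷ false ∷ false ∷ false ∷ [])
    ∷ (false ∷ false ∷ true ∷ true ∷ false ∷ false ∷ [])
    ∷ (false ∷ false ∷ false ∷ false ∷ true ∷ true ∷ [])
    ∷ (true ∷ false ∷ true ∷ false ∷ true ∷ false ∷ []) ∷ []

-- M_I(k)* and M_IV, up to complementation of rows.
Obs : ∀ {m n} → Mat m n → Set
Obs M = Cycle M ⊎ Σ (Fin 4 → Bool) λ a → Emb M (twist a (mat MIV))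

Emb-twist-trans : ∀ {m n p q r s} {L : Mat m n} {M : Mat p q} {N : Mat r s} a b →
  Emb L (twist a M) → Emb M (twist b N) → Σ (Fin r → Bool) λ c → Emb L (twist c N)
Emb-twist-trans {N = N} a b (emb f g h) (emb f′ g′ h′) = (λ i → a (f′ i) xor b i) ,
  emb (f ∘ f′) (g ∘ g′) λ i j →
    trans (h (f′ i) (g′ j)) (trans (cong (a (f′ i) xor_) (h′ i j)) (sym (xor-assoc (a (f′ i)) (b i) (N i j))))

Obs-Emb : ∀ {m n p q} {M : Mat m n} {N : Mat p q} a → Emb M (twist a N) → Obs N → Obs M
Obs-Emb {N = N} a e (inj₁ C) with Cycle⇒Emb C
... | b , e′ with Emb-twist-trans {M = N} {N = star (MI (suc (Cycle.p C)))} a b e e′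
...   | c , e″ = inj₁ (Emb⇒Cycle c (Cycle.2≤p C) e″)
Obs-Emb {N = N} a e (inj₂ (b , e′)) = inj₂ (Emb-twist-trans {M = N} {N = mat MIV} a b e e′)

Emb-table : ∀ {m n p q} {M : Mat m n} (N : Mat p q) a →
  Emb M (twist a (mat (table N))) → Emb M (twist a N)
Emb-table N a (emb f g h) = emb f g λ i j → trans (h i j) (cong (a i xor_) (mat-table N i j))

module Obstructed where
  open Search true

  -- These three suffice for all the small tables that arise in the analysis of added rows.
  obstructed : ∀ {m n} → Table m n → Bool
  obstructed T = embeds T (table (star (MI 3))) ∨ embeds T (table (star (MI 4))) ∨ embeds T MIV

  obstructed-sound : ∀ {m n} (T : Table m n) → obstructed T ≡ true → Obs (mat T)
  obstructed-sound T h with ∨-true {embeds T (table (star (MI 3)))} h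
  ... | inj₁ q = let b , e , _ = embeds-sound T (table (star (MI 3))) q in
    inj₁ (Emb⇒Cycle b (s≤s (s≤s z≤n)) (Emb-table (star (MI 3)) b e))
  ... | inj₂ q with ∨-true {embeds T (table (star (MI 4)))} q
  ...   | inj₁ r = let b , e , _ = embeds-sound T (table (star (MI 4))) r in
    inj₁ (Emb⇒Cycle b (s≤s (s≤s z≤n)) (Emb-table (star (MI 4)) b e))
  ...   | inj₂ r = let b , e , _ = embeds-sound T MIV r in inj₂ (b , e)
open Obstructed public

-- Tables are given relative to `z`, so column `z` provides the twist that turns them into
-- submatrices of M.
obstruction : ∀ {m n p q} {M : Mat m n} z (T : Table p q) → obstructed T ≡ true →
  (f : Fin p → Fin m) (g : Fin q → Fin n) → (∀ i j → In M z (f i) (g j) ≡ mat T i j) → Obs M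
obstruction {M = M} z T o f g h = Obs-Emb {N = mat T} (λ i → M (f i) z)
  (emb f g λ i j → trans (sym (xor-back (M (f i) z) _)) (cong (M (f i) z xor_) (h i j))) (obstructed-sound T o)

-- Intersections of rows

addRow : ∀ {m n} → (Fin n → Bool) → Mat m n → Mat (suc m) n
addRow S M zero = S
addRow S M (suc i) = M i

-- The value α at the added row is a default.
oldRow : ∀ {m} → Fin m → Fin (suc m) → Fin m
oldRow α zero = α
oldRow α (suc i) = i

addRow-old : ∀ {m n} {S : Fin n → Bool} (M : Mat m n) α i → i ≢ zero → ∀ y → addRow S M i y ≡ M (oldRow α i) y
addRow-old M α zero ne y = contradiction refl ne
addRow-old M α (suc i) ne y = refl

lastBefore : ∀ (P : ℕ → Bool) m → P 0 ≡ true → P m ≡ false →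
  ∃ λ a → a < m × P a ≡ true × (∀ j → a < j → j ≤ m → P j ≡ false)
lastBefore P zero t f = clash t f
lastBefore P (suc m) t f with bool-case (P m)
... | inj₁ e = m , ≤-refl , e , λ j h h′ → subst (λ t → P t ≡ false) (≤-antisym h h′) f
... | inj₂ e with lastBefore P m t e
...   | a , a<m , Pa , none = a , m<n⇒m<1+n a<m , Pa , λ j h h′ → go j h (m≤n⇒m<n∨m≡n h′)
  where
  go : ∀ j → a < j → j < suc m ⊎ j ≡ suc m → P j ≡ false
  go j h (inj₁ q) = none j h (≤-pred q)
  go j h (inj₂ refl) = f

firstAfter : ∀ (P : ℕ → Bool) d m → P (m + d) ≡ true → P m ≡ false →
  ∃ λ b → m < b × b ≤ m + d × P b ≡ true × (∀ j → m ≤ j → j < b → P j ≡ false)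
firstAfter P zero m t f = clash (subst (λ q → P q ≡ true) (+-identityʳ m) t) f
firstAfter P (suc d) m t f with bool-case (P (suc m))
... | inj₁ e = suc m , ≤-refl , subst (suc m ≤_) (sym (+-suc m d)) (s≤s (m≤m+n m d)) , e ,
  λ j h h′ → subst (λ q → P q ≡ false) (≤-antisym h (≤-pred h′)) f
... | inj₂ e with firstAfter P d (suc m) (subst (λ q → P q ≡ true) (+-suc m d) t) e
...   | b , m<b , b≤ , Pb , none = b , <⇒≤ m<b , subst (b ≤_) (sym (+-suc m d)) b≤ , Pb , λ j h h′ → go j (m≤n⇒m<n∨m≡n h) h′
  where
  go : ∀ j → m < j ⊎ m ≡ j → j < b → P j ≡ false
  go j (inj₁ q) h′ = none j q h′
  go j (inj₂ refl) h′ = f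

∧-true : ∀ {a b} → a ≡ true → b ≡ true → a ∧ b ≡ true
∧-true refl refl = refl

-- A triangle on three columns with the second column as star column, hence M_I(3)* up to
-- permutation.
TripleOnFour : Table 3 4
TripleOnFour = (true ∷ false ∷ true ∷ false ∷ [])
             ∷ (true ∷ false ∷ false ∷ true ∷ [])
             ∷ (false ∷ false ∷ true ∷ true ∷ []) ∷ []

-- Complementing all rows clears the third column, which they share, and leaves a triangle on the
-- other three: again M_I(3)*.
StarOnFour : Table 3 4
StarOnFour = (false ∷ false ∷ true ∷ true ∷ [])
           ∷ (false ∷ true ∷ true ∷ false ∷ [])
           ∷ (true ∷ false ∷ true ∷ false ∷ []) ∷ []

ShortI : Bool → Bool → Table 4 5
ShortI s t = (true ∷ true ∷ false ∷ false ∷ s ∷ [])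
           ∷ (false ∷ true ∷ true ∷ false ∷ t ∷ [])
           ∷ (false ∷ true ∷ false ∷ false ∷ true ∷ [])
           ∷ (true ∷ true ∷ true ∷ false ∷ false ∷ []) ∷ []

ShortII : Table 4 5
ShortII = (true ∷ true ∷ false ∷ false ∷ true ∷ [])
        ∷ (false ∷ true ∷ true ∷ false ∷ true ∷ [])
        ∷ (false ∷ false ∷ true ∷ false ∷ true ∷ [])
        ∷ (true ∷ false ∷ false ∷ false ∷ true ∷ []) ∷ []

LongI : Table 4 6
LongI = (true ∷ true ∷ false ∷ false ∷ false ∷ false ∷ [])
      ∷ (false ∷ false ∷ true ∷ true ∷ false ∷ false ∷ [])
      ∷ (false ∷ true ∷ true ∷ false ∷ false ∷ true ∷ [])
      ∷ (true ∷ true ∷ true ∷ true ∷ false ∷ false ∷ []) ∷ []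

ShortI-obstructed : ∀ s t → obstructed (ShortI s t) ≡ true
ShortI-obstructed true true = refl
ShortI-obstructed true false = refl
ShortI-obstructed false true = refl
ShortI-obstructed false false = refl

pattern 0F = zero
pattern 1F = suc zero
pattern 2F = suc (suc zero)
pattern 3F = suc (suc (suc zero))
pattern 4F = suc (suc (suc (suc zero)))
pattern 5F = suc (suc (suc (suc (suc zero))))

module Path {m n} (M : Mat m n) (z : Fin n) (p : ℕ) (2≤p : 2 ≤ p) (x : ℕ → Fin n) (r : ℕ → Fin m)
  (path : ∀ s j → s < p → j ≤ p → In M z (r s) (x j) ≡ (j == s) ∨ (j == suc s)) where

  0<p : 0 < p
  0<p = <⇒≤ 2≤p

  pathˡ : ∀ s → s < p → In M z (r s) (x s) ≡ true
  pathˡ s h = trans (path s s h (<⇒≤ h)) (∨-trueˡ (==-refl {s} refl))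
  pathʳ : ∀ s → s < p → In M z (r s) (x (suc s)) ≡ true
  pathʳ s h = trans (path s (suc s) h h) (∨-trueʳ (==-refl {suc s} refl))
  path-out : ∀ s j → s < p → j ≤ p → j ≢ s → j ≢ suc s → In M z (r s) (x j) ≡ false
  path-out s j h h′ a b = trans (path s j h h′) (∨-false (==-≢ a) (==-≢ b))
  only : ∀ s j → s < p → j ≤ p → In M z (r s) (x j) ≡ true → j ≡ s ⊎ j ≡ suc s
  only s j h h′ e with ∨-true {j == s} (trans (sym (path s j h h′)) e)
  ... | inj₁ q = inj₁ (==-sound q)
  ... | inj₂ q = inj₂ (==-sound q)

  In-self : ∀ i → In M z i z ≡ false
  In-self i = Bool.xor-same (M i z)

  segment : ∀ a q → 2 ≤ q → a + q ≤ p → ∀ ρ → In M z ρ (x a) ≡ true → In M z ρ (x (a + q)) ≡ true →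
    (∀ j → a < j → j < a + q → In M z ρ (x j) ≡ false) → Cycle M
  segment a q 2≤q aq≤p ρ ρa ρb inside = LooseCycle⇒Cycle {z = z} {p = q} record
    { 0<p = <⇒≤ 2≤q ; x = λ j → x (a + j) ; r = λ s → r (a + s) ; ρ = ρ
    ; edgeˡ = λ s h → pathˡ (a + s) (bound s h)
    ; edgeʳ = λ s h → subst (λ t → In M z (r (a + s)) (x t) ≡ true) (sym (+-suc a s)) (pathʳ (a + s) (bound s h))
    ; closeˡ = subst (λ t → In M z ρ (x t) ≡ true) (sym (+-identityʳ a)) ρa
    ; closeʳ = ρb
    ; inner = λ j 0<j h → inside (a + j) (m<m+n a 0<j) (+-monoʳ-< a h)
    ; short = short }
    where
    bound : ∀ s → s < q → a + s < p
    bound s h = ≤-trans (+-monoʳ-< a h) aq≤p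
    short : ∀ s → s < q → In M z (r (a + s)) (x (a + 0)) ≡ true → In M z (r (a + s)) (x (a + q)) ≡ true → ⊥
    short s h u v with only (a + s) (a + q) (bound s h) aq≤p v
    ... | inj₁ e = <⇒≢ h (sym (+-cancelˡ-≡ a q s e))
    ... | inj₂ e with only (a + s) (a + 0) (bound s h) (≤-trans (+-monoʳ-≤ a z≤n) aq≤p) u
    ...   | inj₁ e′ with +-cancelˡ-≡ a 0 s e′
    ...     | refl = <⇒≢ 2≤q (sym (+-cancelˡ-≡ a q 1 (trans e (sym (+-suc a 0)))))
    short s h u v | inj₂ e | inj₂ e′ = m≢1+m+n (a + 0) {s} (trans e′ (cong (λ t → suc (t + s)) (sym (+-identityʳ a))))

  -- The nearest columns of ρ on either side of the missed column x j bound a segment of the path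
  -- that ρ closes.
  trim : ∀ ρ → In M z ρ (x 0) ≡ true → In M z ρ (x p) ≡ true → ∀ j → j < p → In M z ρ (x j) ≡ false → Cycle M
  trim ρ ρ0 ρp j j<p ρj
    with lastBefore (λ t → In M z ρ (x t)) j ρ0 ρj
       | firstAfter (λ t → In M z ρ (x t)) (p ∸ j) j (subst (λ t → In M z ρ (x t) ≡ true) (sym (m+[n∸m]≡n (<⇒≤ j<p))) ρp) ρj
  ... | a , a<j , ρa , nonea | b , j<b , b≤ , ρb , noneb = segment a (b ∸ a)
    (subst (_≤ b ∸ a) (trans (cong (_∸ a) (+-comm 2 a)) (m+n∸m≡n a 2)) (∸-monoˡ-≤ a (≤-trans (s≤s a<j) j<b)))
    (subst (_≤ p) (sym ab) (subst (b ≤_) (m+[n∸m]≡n (<⇒≤ j<p)) b≤)) ρ ρa (subst (λ t → In M z ρ (x t) ≡ true) (sym ab) ρb)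
    λ i a<i i<b → between i a<i (subst (i <_) ab i<b)
    where
    ab : a + (b ∸ a) ≡ b
    ab = m+[n∸m]≡n (<⇒≤ (<-trans a<j j<b))
    between : ∀ i → a < i → i < b → In M z ρ (x i) ≡ false
    between i a<i i<b with i ≤? j
    ... | yes q = nonea i a<i q
    ... | no q = noneb i (<⇒≤ (≰⇒> q)) i<b

  closed : ∀ ρ → (∀ j → j ≤ p → In M z ρ (x j) ≡ (j == 0) ∨ (j == p)) → Cycle M
  closed ρ close = record { p = p ; 2≤p = 2≤p ; x = x ; z = z ; r = r ; ρ = ρ ; path = path ; close = close }

  module WithRows (c : Fin n) (α β : Fin m) (αc : M α c ≡ false) (βc : M β c ≡ false) where

    p∸1 : ℕ
    p∸1 = p ∸ 1
    p∸1< : p∸1 < p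
    p∸1< = ≤-reflexive (m+[n∸m]≡n 0<p)
    suc-p∸1 : suc p∸1 ≡ p
    suc-p∸1 = m+[n∸m]≡n 0<p

    endʳ : In M z (r p∸1) (x p) ≡ true
    endʳ = subst (λ t → In M z (r p∸1) (x t) ≡ true) suc-p∸1 (pathʳ p∸1 p∸1<)
    end-out : ∀ j → j < p∸1 → In M z (r p∸1) (x j) ≡ false
    end-out j h = path-out p∸1 j p∸1< (<⇒≤ (<-trans h p∸1<)) (<⇒≢ h) (<⇒≢ (m<n⇒m<1+n h))

    -- The case z ∉ α ∩ β, with z ∉ β.
    module I (βz : M β z ≡ false)
      (S : ∀ j → j ≤ p → M α (x j) ∧ M β (x j) ≡ (j == 0) ∨ (j == p)) where

      inβ : ∀ {y} → In M z β y ≡ M β y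
      inβ {y} = trans (cong (M β y xor_) βz) (xor-identityʳ _)

      S0 : M α (x 0) ≡ true × M β (x 0) ≡ true
      S0 = ∧-split (S 0 z≤n)
      Sp : M α (x p) ≡ true × M β (x p) ≡ true
      Sp = ∧-split (trans (S p ≤-refl) (∨-trueʳ (==-refl {p} refl)))

      -- Relative to z, β contains the whole path but not c, and α contains c and the inner columns
      -- but not the ends. If p ≥ 3 and r 0 contains c, then r 0, β, α form a triangle on x 0, c, x
      -- (p - 1); the other end is symmetric. If neither end row contains c, or if p = 2, a fixed
      -- table is obstructed.
      new : (∀ j → j ≤ p → M β (x j) ≡ true) → M α z ≡ true → Obs M
      new all αz = go (m≤n⇒m<n∨m≡n 2≤p) (bool-case (In M z (r 0) c)) (bool-case (In M z (r p∸1) c))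
        where
        α0 : In M z α (x 0) ≡ false
        α0 = cong₂ _xor_ (proj₁ S0) αz
        αp : In M z α (x p) ≡ false
        αp = cong₂ _xor_ (proj₁ Sp) αz
        αi : ∀ j → 0 < j → j < p → In M z α (x j) ≡ true
        αi j 0<j j<p = cong₂ _xor_ (trans (sym (∧-identityʳ _)) (trans (cong (M α (x j) ∧_) (sym (all j (<⇒≤ j<p))))
          (trans (S j (<⇒≤ j<p)) (∨-false (==-≢ (<⇒≢ 0<j ∘ sym)) (==-≢ (<⇒≢ j<p)))))) αz
        αc′ : In M z α c ≡ true
        αc′ = cong₂ _xor_ αc αz
        βi : ∀ j → j ≤ p → In M z β (x j) ≡ true
        βi j h = trans inβ (all j h)
        βc′ : In M z β c ≡ false
        βc′ = trans inβ βc
        go : 2 < p ⊎ 2 ≡ p → In M z (r 0) c ≡ true ⊎ In M z (r 0) c ≡ false →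
          In M z (r p∸1) c ≡ true ⊎ In M z (r p∸1) c ≡ false → Obs M
        go (inj₂ refl) _ _ = obstruction z (ShortI (In M z (r 0) c) (In M z (r 1) c)) (ShortI-obstructed (In M z (r 0) c) (In M z (r 1) c))
          (λ { 0F → r 0 ; 1F → r 1 ; 2F → α ; 3F → β }) (λ { 0F → x 0 ; 1F → x 1 ; 2F → x 2 ; 3F → z ; 4F → c })
          λ { 0F 0F → pathˡ 0 0<p ; 0F 1F → pathʳ 0 0<p ; 0F 2F → path-out 0 2 0<p ≤-refl (λ ()) (λ ()) ; 0F 3F → In-self _ ; 0F 4F → refl
            ; 1F 0F → path-out 1 0 2≤p z≤n (λ ()) (λ ()) ; 1F 1F → pathˡ 1 2≤p ; 1F 2F → pathʳ 1 2≤p ; 1F 3F → In-self _ ; 1F 4F → refl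
            ; 2F 0F → α0 ; 2F 1F → αi 1 (s≤s z≤n) 2≤p ; 2F 2F → αp ; 2F 3F → In-self _ ; 2F 4F → αc′
            ; 3F 0F → βi 0 z≤n ; 3F 1F → βi 1 0<p ; 3F 2F → βi 2 ≤-refl ; 3F 3F → In-self _ ; 3F 4F → βc′ }
        go (inj₁ 3≤p) (inj₁ t) _ = obstruction z TripleOnFour refl
          (λ { 0F → r 0 ; 1F → β ; 2F → α }) (λ { 0F → x 0 ; 1F → z ; 2F → c ; 3F → x p∸1 })
          λ { 0F 0F → pathˡ 0 0<p ; 0F 1F → In-self _ ; 0F 2F → t
            ; 0F 3F → path-out 0 p∸1 0<p (<⇒≤ p∸1<) (<⇒≢ (<⇒≤ 1<p∸1) ∘ sym) (<⇒≢ 1<p∸1 ∘ sym)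
            ; 1F 0F → βi 0 z≤n ; 1F 1F → In-self _ ; 1F 2F → βc′ ; 1F 3F → βi p∸1 (<⇒≤ p∸1<)
            ; 2F 0F → α0 ; 2F 1F → In-self _ ; 2F 2F → αc′ ; 2F 3F → αi p∸1 (<⇒≤ 1<p∸1) p∸1< }
          where
          1<p∸1 : 1 < p∸1
          1<p∸1 = ∸-monoˡ-≤ 1 3≤p
        go (inj₁ 3≤p) (inj₂ _) (inj₁ t) = obstruction z TripleOnFour refl
          (λ { 0F → r p∸1 ; 1F → β ; 2F → α }) (λ { 0F → x p ; 1F → z ; 2F → c ; 3F → x 1 })
          λ { 0F 0F → endʳ ; 0F 1F → In-self _ ; 0F 2F → t
            ; 0F 3F → end-out 1 (∸-monoˡ-≤ 1 3≤p)
            ; 1F 0F → βi p ≤-refl ; 1F 1F → In-self _ ; 1F 2F → βc′ ; 1F 3F → βi 1 0<p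
            ; 2F 0F → αp ; 2F 1F → In-self _ ; 2F 2F → αc′ ; 2F 3F → αi 1 (s≤s z≤n) 2≤p }
        go (inj₁ 3≤p) (inj₂ s) (inj₂ t) = obstruction z LongI refl
          (λ { 0F → r 0 ; 1F → r p∸1 ; 2F → α ; 3F → β })
          (λ { 0F → x 0 ; 1F → x 1 ; 2F → x p∸1 ; 3F → x p ; 4F → z ; 5F → c })
          λ { 0F 0F → pathˡ 0 0<p ; 0F 1F → pathʳ 0 0<p
            ; 0F 2F → path-out 0 p∸1 0<p (<⇒≤ p∸1<) (<⇒≢ (<⇒≤ 1<p∸1) ∘ sym) (<⇒≢ 1<p∸1 ∘ sym)
            ; 0F 3F → path-out 0 p 0<p ≤-refl (<⇒≢ 0<p ∘ sym) (<⇒≢ 2≤p ∘ sym) ; 0F 4F → In-self _ ; 0F 5F → s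
            ; 1F 0F → end-out 0 (<⇒≤ 1<p∸1) ; 1F 1F → end-out 1 1<p∸1
            ; 1F 2F → pathˡ p∸1 p∸1< ; 1F 3F → endʳ ; 1F 4F → In-self _ ; 1F 5F → t
            ; 2F 0F → α0 ; 2F 1F → αi 1 (s≤s z≤n) 2≤p ; 2F 2F → αi p∸1 (<⇒≤ 1<p∸1) p∸1< ; 2F 3F → αp ; 2F 4F → In-self _ ; 2F 5F → αc′
            ; 3F 0F → βi 0 z≤n ; 3F 1F → βi 1 0<p ; 3F 2F → βi p∸1 (<⇒≤ p∸1<) ; 3F 3F → βi p ≤-refl ; 3F 4F → In-self _ ; 3F 5F → βc′ }
          where
          1<p∸1 : 1 < p∸1
          1<p∸1 = ∸-monoˡ-≤ 1 3≤p

      result : Obs M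
      result with search p (λ j → not (M β (x j)))
      ... | inj₁ (j , j<p , e) = inj₁ (trim β (trans inβ (proj₂ S0)) (trans inβ (proj₂ Sp)) j j<p (trans inβ (not-true e)))
      ... | inj₂ none = covered all (bool-case (M α z))
        where
        all : ∀ j → j ≤ p → M β (x j) ≡ true
        all j h with m≤n⇒m<n∨m≡n h
        ... | inj₁ q = not-false (none j q)
        ... | inj₂ refl = proj₂ Sp
        covered : (∀ j → j ≤ p → M β (x j) ≡ true) → M α z ≡ true ⊎ M α z ≡ false → Obs M
        covered all (inj₁ αz) = new all αz
        covered all (inj₂ αz) = inj₁ (closed α λ j h → trans (cong₂ _xor_ (trans (sym (∧-identityʳ _))
          (cong (M α (x j) ∧_) (sym (all j h)))) αz) (trans (xor-identityʳ _) (S j h)))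

    -- The case z ∈ α ∩ β with x 0 ∈ α and x p ∈ β.
    module II (αz : M α z ≡ true) (βz : M β z ≡ true)
      (α0 : M α (x 0) ≡ true) (αp : M α (x p) ≡ false) (β0 : M β (x 0) ≡ false) (βp : M β (x p) ≡ true)
      (αi : ∀ j → 0 < j → j < p → M α (x j) ≡ true) (βi : ∀ j → 0 < j → j < p → M β (x j) ≡ true) where

      a0 : In M z α (x 0) ≡ false
      a0 = cong₂ _xor_ α0 αz
      ap : In M z α (x p) ≡ true
      ap = cong₂ _xor_ αp αz
      ai : ∀ j → 0 < j → j < p → In M z α (x j) ≡ false
      ai j h h′ = cong₂ _xor_ (αi j h h′) αz
      ac : In M z α c ≡ true
      ac = cong₂ _xor_ αc αz
      b0 : In M z β (x 0) ≡ true
      b0 = cong₂ _xor_ β0 βz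
      bp : In M z β (x p) ≡ false
      bp = cong₂ _xor_ βp βz
      bi : ∀ j → 0 < j → j < p → In M z β (x j) ≡ false
      bi j h h′ = cong₂ _xor_ (βi j h h′) βz
      bc : In M z β c ≡ true
      bc = cong₂ _xor_ βc βz

      -- x 0, …, x q, c
      module Append (q : ℕ) where
        x′ : ℕ → Fin n
        x′ j with j ≤? q
        ... | yes _ = x j
        ... | no _ = c
        x′-≤ : ∀ j → j ≤ q → x′ j ≡ x j
        x′-≤ j h with j ≤? q
        ... | yes _ = refl
        ... | no ¬h = contradiction h ¬h
        x′-c : x′ (suc q) ≡ c
        x′-c with suc q ≤? q
        ... | yes h = contradiction h 1+n≰n
        ... | no _ = refl

      r′ : ℕ → Fin m
      r′ s with s <? p
      ... | yes _ = r s
      ... | no _ = α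

      -- Relative to z, α joins x p to c and β joins c to x 0, so the path closes through c. Other
      -- path rows may contain c; only r 0 could contain both ends, x 0 and c.
      startFree : In M z (r 0) c ≡ false → Cycle M
      startFree t = LooseCycle⇒Cycle {z = z} {p = suc p} record
        { 0<p = s≤s z≤n ; x = x′ ; r = r′ ; ρ = β ; edgeˡ = edgeˡ ; edgeʳ = edgeʳ
        ; closeˡ = trans (cong (In M z β) (x′-≤ 0 z≤n)) b0
        ; closeʳ = trans (cong (In M z β) x′-c) bc
        ; inner = inner ; short = short }
        where
        open Append p
        edgeˡ : ∀ s → s < suc p → In M z (r′ s) (x′ s) ≡ true
        edgeˡ s (s≤s h) rewrite x′-≤ s h with s <? p
        ... | yes q = pathˡ s q
        ... | no q rewrite ≤-antisym h (≮⇒≥ q) = ap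
        edgeʳ : ∀ s → s < suc p → In M z (r′ s) (x′ (suc s)) ≡ true
        edgeʳ s (s≤s h) with s <? p
        ... | yes q = pathʳ s q
        ... | no _ = ac
        inner : ∀ j → 0 < j → j < suc p → In M z β (x′ j) ≡ false
        inner j 0<j (s≤s h) rewrite x′-≤ j h with m≤n⇒m<n∨m≡n h
        ... | inj₁ q = bi j 0<j q
        ... | inj₂ refl = bp
        short : ∀ s → s < suc p → In M z (r′ s) (x′ 0) ≡ true → In M z (r′ s) (x′ (suc p)) ≡ true → ⊥
        short s h u v rewrite x′-≤ 0 z≤n | x′-c with s <? p
        ... | no _ = clash u a0
        ... | yes q with only s 0 q z≤n u
        ...   | inj₁ refl = clash v t

      r″ : ℕ → Fin m
      r″ zero = β
      r″ (suc s) = r s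
      x″ : ℕ → Fin n
      x″ zero = c
      x″ (suc j) = x j

      -- The same closed walk cut open at α instead of β: the ends are c and x p, and only r (p - 1)
      -- could contain both.
      endFree : In M z (r p∸1) c ≡ false → Cycle M
      endFree t = LooseCycle⇒Cycle {z = z} {p = suc p} record
        { 0<p = s≤s z≤n ; x = x″ ; r = r″ ; ρ = α
        ; edgeˡ = λ { zero _ → bc ; (suc s) (s≤s h) → pathˡ s h }
        ; edgeʳ = λ { zero _ → b0 ; (suc s) (s≤s h) → pathʳ s h }
        ; closeˡ = ac ; closeʳ = ap
        ; inner = λ { (suc zero) _ _ → a0 ; (suc (suc j)) _ (s≤s h) → ai (suc j) (s≤s z≤n) h }
        ; short = short }
        where
        short : ∀ s → s < suc p → In M z (r″ s) c ≡ true → In M z (r″ s) (x p) ≡ true → ⊥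
        short zero _ u v = clash v bp
        short (suc s) (s≤s h) u v with only s p h ≤-refl v
        ... | inj₁ e = <⇒≢ h (sym e)
        ... | inj₂ refl = clash u t

      -- When both end rows contain c, they take over the roles of α and β: x 1, ..., x (p - 1), c
      -- is a path with last row r (p - 1), and r 0 closes it.
      innerFree : 2 < p → In M z (r 0) c ≡ true → In M z (r p∸1) c ≡ true → In M z (r 1) c ≡ false → Cycle M
      innerFree 3≤p s t u = LooseCycle⇒Cycle {z = z} {p = suc q} record
        { 0<p = s≤s z≤n ; x = λ j → x′ (suc j) ; r = λ s → r (suc s) ; ρ = r 0 ; edgeˡ = edgeˡ ; edgeʳ = edgeʳ
        ; closeˡ = trans (cong (In M z (r 0)) (x′-≤ 1 (s≤s z≤n))) (pathʳ 0 0<p)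
        ; closeʳ = trans (cong (In M z (r 0)) x′-c) s
        ; inner = inner ; short = short }
        where
        q = p ∸ 2
        q< : suc q < p
        q< = ≤-reflexive (m+[n∸m]≡n 2≤p)
        last : p∸1 ≡ suc q
        last = suc-injective (trans suc-p∸1 (sym (m+[n∸m]≡n 2≤p)))
        open Append (suc q)
        edgeˡ : ∀ s → s < suc q → In M z (r (suc s)) (x′ (suc s)) ≡ true
        edgeˡ s h rewrite x′-≤ (suc s) h = pathˡ (suc s) (≤-trans (s≤s h) q<)
        edgeʳ : ∀ s → s < suc q → In M z (r (suc s)) (x′ (suc (suc s))) ≡ true
        edgeʳ s (s≤s h) with m≤n⇒m<n∨m≡n h
        ... | inj₁ k rewrite x′-≤ (suc (suc s)) (s≤s k) = pathʳ (suc s) (≤-trans (s≤s (s≤s h)) q<)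
        ... | inj₂ refl rewrite x′-c = subst (λ i → In M z (r i) c ≡ true) last t
        inner : ∀ j → 0 < j → j < suc q → In M z (r 0) (x′ (suc j)) ≡ false
        inner j 0<j h rewrite x′-≤ (suc j) h =
          path-out 0 (suc j) 0<p (≤-trans h (<⇒≤ q<)) (λ ()) (λ e → <⇒≢ 0<j (sym (suc-injective e)))
        short : ∀ s → s < suc q → In M z (r (suc s)) (x′ 1) ≡ true → In M z (r (suc s)) (x′ (suc (suc q))) ≡ true → ⊥
        short s h v w rewrite x′-≤ 1 (s≤s z≤n) | x′-c with only (suc s) 1 (≤-trans (s≤s h) q<) 0<p v
        ... | inj₁ refl = clash w u

      result : Obs M
      result with bool-case (In M z (r 0) c) | bool-case (In M z (r p∸1) c)
      ... | inj₂ s | _ = inj₁ (startFree s)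
      ... | inj₁ _ | inj₂ t = inj₁ (endFree t)
      ... | inj₁ s | inj₁ t with m≤n⇒m<n∨m≡n 2≤p | bool-case (In M z (r 1) c)
      ...   | inj₁ 3≤p | inj₂ u = inj₁ (innerFree 3≤p s t u)
      ...   | inj₁ 3≤p | inj₁ u = obstruction z StarOnFour refl
          (λ { 0F → r 1 ; 1F → α ; 2F → β }) (λ { 0F → x 0 ; 1F → x p ; 2F → c ; 3F → x 1 })
          λ { 0F 0F → path-out 1 0 2≤p z≤n (λ ()) (λ ()) ; 0F 1F → path-out 1 p 2≤p ≤-refl (<⇒≢ 2≤p ∘ sym) (<⇒≢ 3≤p ∘ sym)
            ; 0F 2F → u ; 0F 3F → pathˡ 1 2≤p
            ; 1F 0F → a0 ; 1F 1F → ap ; 1F 2F → ac ; 1F 3F → ai 1 (s≤s z≤n) 2≤p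
            ; 2F 0F → b0 ; 2F 1F → bp ; 2F 2F → bc ; 2F 3F → bi 1 (s≤s z≤n) 2≤p }
      ...   | inj₂ refl | _ = obstruction z ShortII refl
          (λ { 0F → r 0 ; 1F → r 1 ; 2F → α ; 3F → β }) (λ { 0F → x 0 ; 1F → x 1 ; 2F → x 2 ; 3F → z ; 4F → c })
          λ { 0F 0F → pathˡ 0 0<p ; 0F 1F → pathʳ 0 0<p ; 0F 2F → path-out 0 2 0<p ≤-refl (λ ()) (λ ()) ; 0F 3F → In-self _ ; 0F 4F → s
            ; 1F 0F → path-out 1 0 2≤p z≤n (λ ()) (λ ()) ; 1F 1F → pathˡ 1 2≤p ; 1F 2F → pathʳ 1 2≤p ; 1F 3F → In-self _ ; 1F 4F → t
            ; 2F 0F → a0 ; 2F 1F → ai 1 (s≤s z≤n) 2≤p ; 2F 2F → ap ; 2F 3F → In-self _ ; 2F 4F → ac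
            ; 3F 0F → b0 ; 3F 1F → bi 1 (s≤s z≤n) 2≤p ; 3F 2F → bp ; 3F 3F → In-self _ ; 3F 4F → bc }

  module Meet (c : Fin n) (α β : Fin m) (αc : M α c ≡ false) (βc : M β c ≡ false)
    (close : ∀ j → j ≤ p → (M α (x j) ∧ M β (x j)) xor (M α z ∧ M β z) ≡ (j == 0) ∨ (j == p)) where

    closeII : ∀ {a b} → a ≡ true → b ≡ true → ∀ u {w} → u xor (a ∧ b) ≡ w → not u ≡ w
    closeII refl refl u e = trans (Bool.xor-comm true u) e

    -- If z lies outside one of the two rows, case I applies. If z lies in both, relative to z the
    -- added row is the union of the complements of α and β, so the inner columns lie in both rows
    -- and each end is missed by one. A row that misses both ends closes the path by itself;
    -- otherwise each row misses one end, which is case II.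
    meet : Obs M
    meet with bool-case (M α z) | bool-case (M β z)
    ... | _ | inj₂ βz = WithRows.I.result c α β αc βc βz λ j h →
      trans (sym (trans (cong ((M α (x j) ∧ M β (x j)) xor_) (trans (cong (M α z ∧_) βz) (∧-zeroʳ _))) (xor-identityʳ _))) (close j h)
    ... | inj₂ αz | inj₁ _ = WithRows.I.result c β α βc αc αz λ j h →
      trans (∧-comm (M β (x j)) _) (trans (sym (trans (cong (λ t → (M α (x j) ∧ M β (x j)) xor (t ∧ M β z)) αz) (xor-identityʳ _))) (close j h))
    ... | inj₁ αz | inj₁ βz = ends (bool-case (M α (x 0))) (bool-case (M α (x p))) (bool-case (M β (x 0))) (bool-case (M β (x p)))
      where
      C : ∀ j → j ≤ p → not (M α (x j) ∧ M β (x j)) ≡ (j == 0) ∨ (j == p)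
      C j h = closeII αz βz (M α (x j) ∧ M β (x j)) (close j h)
      mid : ∀ j → 0 < j → j < p → M α (x j) ≡ true × M β (x j) ≡ true
      mid j h h′ = ∧-split (not-false (trans (C j (<⇒≤ h′)) (∨-false (==-≢ (<⇒≢ h ∘ sym)) (==-≢ (<⇒≢ h′)))))
      C0 : M α (x 0) ∧ M β (x 0) ≡ false
      C0 = not-true (C 0 z≤n)
      Cp : M α (x p) ∧ M β (x p) ≡ false
      Cp = not-true (trans (C p ≤-refl) (∨-trueʳ (==-refl {p} refl)))
      single : ∀ γ → M γ z ≡ true → M γ (x 0) ≡ false → M γ (x p) ≡ false →
        (∀ j → 0 < j → j < p → M γ (x j) ≡ true) → Obs M
      single γ γz γ0 γp γi = inj₁ (closed γ λ j h → trans (Bool.xor-comm (M γ (x j)) (M γ z)) (trans (cong (_xor M γ (x j)) γz) (go j h)))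
        where
        go : ∀ j → j ≤ p → not (M γ (x j)) ≡ (j == 0) ∨ (j == p)
        go zero _ = cong not γ0
        go (suc j) h with m≤n⇒m<n∨m≡n h
        ... | inj₁ q rewrite ==-≢ (<⇒≢ q) = cong not (γi (suc j) (s≤s z≤n) q)
        ... | inj₂ refl rewrite ==-refl {suc j} refl = cong not γp
      ends : M α (x 0) ≡ true ⊎ M α (x 0) ≡ false → M α (x p) ≡ true ⊎ M α (x p) ≡ false →
        M β (x 0) ≡ true ⊎ M β (x 0) ≡ false → M β (x p) ≡ true ⊎ M β (x p) ≡ false → Obs M
      ends (inj₁ a) _ (inj₁ b) _ = clash (∧-true a b) C0
      ends _ (inj₁ a) _ (inj₁ b) = clash (∧-true a b) Cp
      ends (inj₂ a) (inj₂ a′) _ _ = single α αz a a′ λ j h h′ → proj₁ (mid j h h′)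
      ends _ _ (inj₂ b) (inj₂ b′) = single β βz b b′ λ j h h′ → proj₂ (mid j h h′)
      ends (inj₁ a) (inj₂ a′) (inj₂ b) (inj₁ b′) = WithRows.II.result c α β αc βc αz βz a a′ b b′
        (λ j h h′ → proj₁ (mid j h h′)) (λ j h h′ → proj₂ (mid j h h′))
      ends (inj₂ a) (inj₁ a′) (inj₁ b) (inj₂ b′) = WithRows.II.result c β α βc αc βz αz b b′ a a′
        (λ j h h′ → proj₂ (mid j h h′)) (λ j h h′ → proj₁ (mid j h h′))

-- A path row never equals the closing row. After rotating an occurrence of the added row into the
-- closing position, the path therefore consists of old rows, and `Path` applies.
pullback-Cycle : ∀ {m n} (M : Mat m n) c α β → M α c ≡ false → M β c ≡ false →
  Cycle (addRow (λ y → M α y ∧ M β y) M) → Obs M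
pullback-Cycle {m} M c α β αc βc C = go (search p λ s → isNew (r s)) (isNew ρ) refl
  where
  open Cycle C
  M⁺ = addRow (λ y → M α y ∧ M β y) M
  isNew : Fin (suc m) → Bool
  isNew zero = true
  isNew (suc _) = false
  old : Fin (suc m) → Fin m
  old = oldRow α
  In-old : ∀ i {y w} → isNew i ≡ false → In M w (old i) y ≡ In M⁺ w i y
  In-old (suc i) _ = refl
  final : (C : Cycle M⁺) → (∀ s → s < Cycle.p C → isNew (Cycle.r C s) ≡ false) → isNew (Cycle.ρ C) ≡ true → Obs M
  final C olds new with Cycle.ρ C | Cycle.close C
  ... | zero | close′ = Path.Meet.meet M (Cycle.z C) (Cycle.p C) (Cycle.2≤p C) (Cycle.x C) (λ s → old (Cycle.r C s))
    (λ s j h h′ → trans (In-old (Cycle.r C s) (olds s h)) (Cycle.path C s j h h′)) c α β αc βc close′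
  rotated : (C : Cycle M⁺) → isNew (Cycle.ρ C) ≡ true → Obs M
  rotated C new = final C (λ s h → ≢true (λ e → conflict s h (equal e new))) new
    where
    module C = Cycle C
    equal : ∀ {i j : Fin (suc m)} → isNew i ≡ true → isNew j ≡ true → i ≡ j
    equal {zero} {zero} _ _ = refl
    conflict : ∀ s → s < C.p → C.r s ≢ C.ρ
    conflict zero h e = clash (trans (cong (λ i → In M⁺ C.z i (C.x 1)) (sym e)) (C.pathʳ 0 h))
      (C.close-out 1 h (λ ()) (<⇒≢ C.2≤p))
    conflict (suc s) h e = clash (trans (cong (λ i → In M⁺ C.z i (C.x (suc s))) (sym e)) (C.pathˡ (suc s) h))
      (C.close-out (suc s) (<⇒≤ h) (λ ()) (<⇒≢ h))
  go : _ ⊎ _ → ∀ b → isNew ρ ≡ b → Obs M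
  go _ true e = rotated C e
  go (inj₁ (s , h , e)) false _ with rotate-to C s h
  ... | C′ , e′ = rotated C′ (trans (cong isNew e′) e)
  go (inj₂ olds) false e = inj₁ record
    { p = p ; 2≤p = 2≤p ; x = x ; z = z ; r = old ∘ r ; ρ = old ρ
    ; path = λ s j h h′ → trans (In-old (r s) (olds s h)) (path s j h h′)
    ; close = λ j h → trans (In-old ρ e) (close j h) }

∀Fin-complete : ∀ n {f} → (∀ i → f i ≡ true) → ∀Fin n f ≡ true
∀Fin-complete zero h = refl
∀Fin-complete (suc n) h = ∧-true (h zero) (∀Fin-complete n (h ∘ suc))

-- All pairs of rows A, B with A ∧ B = S that cover every column not marked in N.
∀Pairs : ∀ {q} → Vec Bool q → Vec Bool q → (Vec Bool q → Vec Bool q → Bool) → Bool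
∀Pairs [] [] f = f [] []
∀Pairs (true ∷ S) (_ ∷ N) f = ∀Pairs S N λ A B → f (true ∷ A) (true ∷ B)
∀Pairs (false ∷ S) (n ∷ N) f =
  ∀Pairs S N (λ A B → f (true ∷ A) (false ∷ B)) ∧ ∀Pairs S N (λ A B → f (false ∷ A) (true ∷ B)) ∧
  (not n ∨ ∀Pairs S N (λ A B → f (false ∷ A) (false ∷ B)))

∀Pairs-sound : ∀ {q} (S N : Vec Bool q) {f} → ∀Pairs S N f ≡ true → ∀ A B →
  (∀ j → lookup A j ∧ lookup B j ≡ lookup S j) → (∀ j → (lookup A j ∨ lookup B j) ∨ lookup N j ≡ true) → f A B ≡ true
∀Pairs-sound [] [] h [] [] _ _ = h
∀Pairs-sound (true ∷ S) (_ ∷ N) h (a ∷ A) (b ∷ B) meet cover with ∧-split {a} (meet zero)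
... | refl , refl = ∀Pairs-sound S N h A B (meet ∘ suc) (cover ∘ suc)
∀Pairs-sound (false ∷ S) (n ∷ N) h (true ∷ A) (false ∷ B) meet cover =
  ∀Pairs-sound S N (proj₁ (∧-split h)) A B (meet ∘ suc) (cover ∘ suc)
∀Pairs-sound (false ∷ S) (n ∷ N) {f} h (false ∷ A) (true ∷ B) meet cover =
  ∀Pairs-sound S N (proj₁ (∧-split (proj₂ (∧-split {∀Pairs S N (λ A B → f (true ∷ A) (false ∷ B))} h)))) A B (meet ∘ suc) (cover ∘ suc)
∀Pairs-sound (false ∷ S) (true ∷ N) {f} h (false ∷ A) (false ∷ B) meet cover =
  ∀Pairs-sound S N (proj₂ (∧-split {∀Pairs S N (λ A B → f (false ∷ A) (true ∷ B))}
    (proj₂ (∧-split {∀Pairs S N (λ A B → f (true ∷ A) (false ∷ B))} h)))) A B (meet ∘ suc) (cover ∘ suc)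
∀Pairs-sound (false ∷ S) (false ∷ N) h (false ∷ A) (false ∷ B) meet cover = contradiction (cover zero) λ ()
∀Pairs-sound (false ∷ S) (n ∷ N) h (true ∷ A) (true ∷ B) meet cover = contradiction (meet zero) λ ()

twistedMIV : Vec Bool 4 → Fin 4 → Vec Bool 6
twistedMIV a i = Vec.map (lookup a i xor_) (lookup MIV i)

-- A twisted M_IV with its row i replaced by A and B, and a further column c that is zero.
split : Fin 4 → Vec Bool 4 → Vec Bool 6 → Vec Bool 6 → Table 5 7
split i a A B = Vec.map (false ∷_) (B ∷ tabulate λ i′ → if does (i′ Fin.≟ i) then A else twistedMIV a i′)

-- The columns that may coincide with c.
zeroColumns : Fin 4 → Vec Bool 4 → Vec Bool 6
zeroColumns i a = tabulate λ j → ∀Fin 4 λ i′ → does (i′ Fin.≟ i) ∨ not (lookup (twistedMIV a i′) j)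

split-test : Fin 4 → Vec Bool 4 → Bool
split-test i a = ∀Pairs (twistedMIV a i) (zeroColumns i a) λ A B → obstructed (split i a A B)

split-tests : ∀Fin 4 (λ i → ∀Vec 4 (split-test i)) ≡ true
split-tests = refl

split-obstructed : ∀ i a A B → (∀ j → lookup A j ∧ lookup B j ≡ lookup (twistedMIV a i) j) →
  (∀ j → (lookup A j ∨ lookup B j) ∨ lookup (zeroColumns i a) j ≡ true) → obstructed (split i a A B) ≡ true
split-obstructed i a A B = ∀Pairs-sound (twistedMIV a i) (zeroColumns i a) {λ A B → obstructed (split i a A B)}
  (∀Vec-sound 4 {split-test i} (∀Fin-sound 4 {λ i → ∀Vec 4 (split-test i)} split-tests i) a) A B

differ : Bool → Fin 4 → Fin 4 → Bool
differ b i i′ = does (i Fin.≟ i′) ∨ not (∀Fin 6 λ j → eqᵇ (mat MIV i j) (b xor mat MIV i′ j))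

MIV-rows : ∀ b → ∀Fin 4 (λ i → ∀Fin 4 (differ b i)) ≡ true
MIV-rows true = refl
MIV-rows false = refl

does-≢ : ∀ {n} {i j : Fin n} → i ≢ j → does (i Fin.≟ j) ≡ false
does-≢ {i = i} {j} ne with i Fin.≟ j
... | yes e = contradiction e ne
... | no _ = refl

MIV-distinct : ∀ (a : Fin 4 → Bool) i i′ → i ≢ i′ → ¬ (∀ j → twist a (mat MIV) i j ≡ twist a (mat MIV) i′ j)
MIV-distinct a i i′ ne e
  with ∀Fin-sound 4 {differ (a i xor a i′) i} (∀Fin-sound 4 {λ k → ∀Fin 4 (differ (a i xor a i′) k)} (MIV-rows (a i xor a i′)) i) i′
... | q rewrite does-≢ ne = clash
  (∀Fin-complete 6 {λ j → eqᵇ (mat MIV i j) ((a i xor a i′) xor mat MIV i′ j)} λ j → eqᵇ-true (solve (a i) (a i′) _ _ (e j)))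
  (not-true q)
  where
  solve : ∀ a a′ b b′ → a xor b ≡ a′ xor b′ → b ≡ (a xor a′) xor b′
  solve false false b b′ h = h
  solve false true b b′ h = h
  solve true false false false ()
  solve true false true true ()
  solve true false true false h = refl
  solve true false false true h = refl
  solve true true b b′ h = xor-cancelˡ true h

-- No two rows of M_IV are equal or complementary, so at most one row of the copy is the added one.
-- With α and β in its place and c as a further column there are finitely many 5 × 7 tables, all
-- checked. A column of the copy may be c itself, where the covering hypothesis says nothing; the
-- other rows of the copy are then zero in it, which is what `zeroColumns` allows for.
pullback-MIV : ∀ {m n} (M : Mat m n) c → (∀ i → M i c ≡ false) → ∀ α β →
  (∀ y → y ≢ c → M α y ∨ M β y ≡ true) → ∀ a →
  Emb (addRow (λ y → M α y ∧ M β y) M) (twist a (mat MIV)) → Obs M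
pullback-MIV {m} {n} M c Mc α β cover a (emb f g h) with Fin.any? (λ i → f i Fin.≟ zero)
... | no olds = inj₂ (a , emb (λ i → oldRow α (f i)) g λ i j → trans (sym (addRow-old M α (f i) (λ e → olds (i , e)) (g j))) (h i j))
... | yes (i , fi) = Obs-Emb {N = mat T} (λ _ → false) (emb rows cols entries)
    (obstructed-sound T (split-obstructed i av A B meet covered))
  where
  av : Vec Bool 4
  av = tabulate a
  A B : Vec Bool 6
  A = tabulate (λ j → M α (g j))
  B = tabulate (λ j → M β (g j))
  lookup-A : ∀ j → lookup A j ≡ M α (g j)
  lookup-A j = lookup∘tabulate (λ j → M α (g j)) j
  lookup-B : ∀ j → lookup B j ≡ M β (g j)
  lookup-B j = lookup∘tabulate (λ j → M β (g j)) j
  T : Table 5 7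
  T = split i av A B
  S : Fin n → Bool
  S y = M α y ∧ M β y
  old : Fin (suc m) → Fin m
  old = oldRow α
  twisted : ∀ i′ j → lookup (twistedMIV av i′) j ≡ twist a (mat MIV) i′ j
  twisted i′ j = trans (lookup-map j _ (lookup MIV i′)) (cong (_xor mat MIV i′ j) (lookup∘tabulate a i′))
  others : ∀ i′ → i′ ≢ i → f i′ ≢ zero
  others i′ ne e = MIV-distinct a i′ i ne λ j →
    trans (sym (h i′ j)) (trans (cong (λ t → addRow S M t (g j)) (trans e (sym fi))) (h i j))
  other : ∀ i′ → i′ ≢ i → ∀ j → M (old (f i′)) (g j) ≡ lookup (twistedMIV av i′) j
  other i′ ne j = trans (sym (addRow-old M α (f i′) (others i′ ne) (g j))) (trans (h i′ j) (sym (twisted i′ j)))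
  meet : ∀ j → lookup A j ∧ lookup B j ≡ lookup (twistedMIV av i) j
  meet j = trans (cong₂ _∧_ (lookup-A j) (lookup-B j))
    (trans (trans (sym (cong (λ t → addRow S M t (g j)) fi)) (h i j)) (sym (twisted i j)))
  covered : ∀ j → (lookup A j ∨ lookup B j) ∨ lookup (zeroColumns i av) j ≡ true
  covered j with g j Fin.≟ c
  ... | no ne = ∨-trueˡ (trans (cong₂ _∨_ (lookup-A j) (lookup-B j)) (cover (g j) ne))
  ... | yes e = ∨-trueʳ (trans (lookup∘tabulate marked j) (∀Fin-complete 4 {λ i′ → does (i′ Fin.≟ i) ∨ not (lookup (twistedMIV av i′) j)} column))
    where
    marked : Fin 6 → Bool
    marked j = ∀Fin 4 λ i′ → does (i′ Fin.≟ i) ∨ not (lookup (twistedMIV av i′) j)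
    column : ∀ i′ → does (i′ Fin.≟ i) ∨ not (lookup (twistedMIV av i′) j) ≡ true
    column i′ with i′ Fin.≟ i
    ... | yes _ = refl
    ... | no ne = cong not (trans (sym (other i′ ne j)) (trans (cong (M (old (f i′))) e) (Mc _)))
  rows : Fin 5 → Fin m
  rows zero = β
  rows (suc i′) = if does (i′ Fin.≟ i) then α else old (f i′)
  cols : Fin 7 → Fin n
  cols zero = c
  cols (suc j) = g j
  lookup-false : ∀ (r : Vec (Vec Bool 6) 5) k → lookup (Vec.map (false ∷_) r) k ≡ false ∷ lookup r k
  lookup-false r k = lookup-map k _ r
  newRow : ∀ i′ → Vec Bool 6
  newRow i′ = if does (i′ Fin.≟ i) then A else twistedMIV av i′
  row : ∀ k → lookup T (suc k) ≡ false ∷ newRow k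
  row k = trans (lookup-false (B ∷ tabulate newRow) (suc k)) (cong (false ∷_) (lookup∘tabulate newRow k))
  entries : ∀ k j → M (rows k) (cols j) ≡ mat T k j
  entries zero zero = Mc β
  entries zero (suc j) = sym (lookup-B j)
  entries (suc k) zero = trans (Mc _) (sym (cong (λ v → lookup v zero) (row k)))
  entries (suc k) (suc j) = trans (entry k) (sym (cong (λ v → lookup v (suc j)) (row k)))
    where
    entry : ∀ k → M (if does (k Fin.≟ i) then α else old (f k)) (g j) ≡ lookup (newRow k) j
    entry k with k Fin.≟ i
    ... | yes _ = sym (lookup-A j)
    ... | no ne = other k ne j

pullback : ∀ {m n} (M : Mat m n) c → (∀ i → M i c ≡ false) → ∀ α β →
  (∀ y → y ≢ c → M α y ∨ M β y ≡ true) → Obs (addRow (λ y → M α y ∧ M β y) M) → Obs M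
pullback M c Mc α β cover (inj₁ C) = pullback-Cycle M c α β (Mc α) (Mc β) C
pullback M c Mc α β cover (inj₂ (a , e)) = pullback-MIV M c Mc α β cover a e

-- Tucker's theorem for circular ones

choose : ∀ m {A B : Fin m → Set} → (∀ i → A i ⊎ B i) → (∃ A) ⊎ (∀ i → B i)
choose zero f = inj₂ λ ()
choose (suc m) {A} {B} f with f zero | choose m (f ∘ suc)
... | inj₁ a | _ = inj₁ (zero , a)
... | inj₂ _ | inj₁ (i , a) = inj₁ (suc i , a)
... | inj₂ b | inj₂ bs = inj₂ λ { zero → b ; (suc i) → bs i }

choose< : ∀ n {A B : ℕ → Set} → (∀ i → A i ⊎ B i) → (∃ λ i → i < n × A i) ⊎ (∀ i → i < n → B i)
choose< zero f = inj₂ λ _ ()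
choose< (suc n) {A} {B} f with choose< n f | f n
... | inj₁ (i , h , a) | _ = inj₁ (i , m<n⇒m<1+n h , a)
... | inj₂ _ | inj₁ a = inj₁ (n , ≤-refl , a)
... | inj₂ bs | inj₂ b = inj₂ λ i h → last i (m≤n⇒m<n∨m≡n (≤-pred h))
  where
  last : ∀ i → i < n ⊎ i ≡ n → B i
  last i (inj₁ h) = bs i h
  last i (inj₂ refl) = b

-- Column zero, false in all rows, is inserted into a circular arrangement of the others.
module Insert {m L : ℕ} (R : Fin m → Fin (suc L) → Bool) (nc : ∀ i → NC toℕ (R i))
  (meets : ∀ α β → (∀ y → R α y ∨ R β y ≡ true) → NC toℕ (λ y → R α y ∧ R β y)) where

  K : Mat m (suc (suc L))
  K i zero = false
  K i (suc y) = R i y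

  val : Fin m → ℕ → Bool
  val i p = R i (clamp L p)

  val-toℕ : ∀ i y → val i (toℕ y) ≡ R i y
  val-toℕ i y = cong (R i) (Fin.toℕ-injective (toℕ-clamp (≤-pred (Fin.toℕ<n y))))

  ncℕ : (v : Fin (suc L) → Bool) → NC toℕ v → ∀ w x y z → w < x → x < y → y < z → z ≤ L →
    v (clamp L w) ≡ v (clamp L y) → v (clamp L x) ≡ v (clamp L z) → v (clamp L w) ≡ v (clamp L x)
  ncℕ v h w x y z wx xy yz zL = h (clamp L w) (clamp L x) (clamp L y) (clamp L z)
    (subst₂ _<_ (sym (toℕ-clamp wL)) (sym (toℕ-clamp xL)) wx)
    (subst₂ _<_ (sym (toℕ-clamp xL)) (sym (toℕ-clamp yL)) xy)
    (subst₂ _<_ (sym (toℕ-clamp yL)) (sym (toℕ-clamp zL)) yz)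
    where
    yL = ≤-trans (<⇒≤ yz) zL
    xL = ≤-trans (<⇒≤ xy) yL
    wL = ≤-trans (<⇒≤ wx) xL

  alternating : ∀ {A : Set} (v : Fin (suc L) → Bool) → NC toℕ v → ∀ w x y z → w < x → x < y → y < z → z ≤ L → ∀ {b c} →
    v (clamp L w) ≡ b → v (clamp L x) ≡ c → v (clamp L y) ≡ b → v (clamp L z) ≡ c → b ≢ c → A
  alternating v h w x y z wx xy yz zL ew ex ey ez ne =
    contradiction (trans (sym ew) (trans (ncℕ v h w x y z wx xy yz zL (trans ew (sym ey)) (trans ex (sym ez))) ex)) ne

  -- Gap g lies just before column g; gap 0 lies between the last column and the first.
  prev : ℕ → ℕ
  prev zero = L
  prev (suc g) = g

  -- A row that is true throughout tolerates the new false column anywhere, so it never spans a gap.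
  Bad Good : ℕ → Fin m → Set
  Bad g i = val i (prev g) ≡ true × val i g ≡ true × ∃ λ f → f ≤ L × val i f ≡ false
  Good g i = val i (prev g) ≡ false ⊎ val i g ≡ false ⊎ (∀ f → f ≤ L → val i f ≡ true)

  judge : ∀ g i → Bad g i ⊎ Good g i
  judge g i with bool-case (val i (prev g)) | bool-case (val i g) | search (suc L) (not ∘ val i)
  ... | inj₂ a | _ | _ = inj₂ (inj₁ a)
  ... | inj₁ _ | inj₂ b | _ = inj₂ (inj₂ (inj₁ b))
  ... | inj₁ a | inj₁ b | inj₁ (f , f≤ , e) = inj₁ (a , b , f , ≤-pred f≤ , not-true e)
  ... | inj₁ a | inj₁ b | inj₂ all = inj₂ (inj₂ (inj₂ λ f h → not-false (all f (s≤s h))))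

  module _ (i : Fin m) where
    alt : ∀ w x y z → w < x → x < y → y < z → z ≤ L → ∀ {b c} →
      val i w ≡ b → val i x ≡ c → val i y ≡ b → val i z ≡ c → b ≢ c → ⊥
    alt = alternating (R i) (nc i)
    strict : ∀ {p q} → p ≤ q → val i p ≡ false → val i q ≡ true → p < q
    strict h a b = ≤∧≢⇒< h λ { refl → clash b a }
    strict′ : ∀ {p q} → p ≤ q → val i p ≡ true → val i q ≡ false → p < q
    strict′ h a b = ≤∧≢⇒< h λ { refl → clash a b }
    -- The new column plays the part of w here, and those of x, y, z in the next three. Unless the
    -- row is full, a good gap has a false old column beside it, which replaces the new one in the
    -- alternation.
    caseW : ∀ g x y z → g ≤ x → x < y → y < z → z ≤ L → Good g i →
      val i x ≡ true → val i y ≡ false → val i z ≡ true → ⊥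
    caseW g x y z gx xy yz zL (inj₂ (inj₁ e)) a b c = alt g x y z (strict gx e a) xy yz zL e a b c (true≢false ∘ sym)
    caseW g x y z gx xy yz zL (inj₂ (inj₂ all)) a b c = clash (all y (≤-trans (<⇒≤ yz) zL)) b
    caseW zero x y z gx xy yz zL (inj₁ e) a b c = alt x y z L xy yz (strict′ zL c e) ≤-refl a b c e true≢false
    caseW (suc g) x y z gx xy yz zL (inj₁ e) a b c = alt g x y z gx xy yz zL e a b c (true≢false ∘ sym)
    caseX : ∀ g w y z → w < g → g ≤ y → y < z → z ≤ L → Good g i →
      val i w ≡ true → val i y ≡ true → val i z ≡ false → ⊥
    caseX g w y z wg gy yz zL (inj₂ (inj₁ e)) a b c = alt w g y z wg (strict gy e b) yz zL a e b c true≢false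
    caseX g w y z wg gy yz zL (inj₂ (inj₂ all)) a b c = clash (all z zL) c
    caseX (suc g) w y z wg gy yz zL (inj₁ e) a b c = alt w g y z (strict′ (≤-pred wg) a e) gy yz zL a e b c true≢false
    caseY : ∀ g w x z → w < x → x < g → g ≤ z → z ≤ L → Good g i →
      val i w ≡ false → val i x ≡ true → val i z ≡ true → ⊥
    caseY g w x z wx xg gz zL (inj₂ (inj₁ e)) a b c = alt w x g z wx xg (strict gz e c) zL a b e c (true≢false ∘ sym)
    caseY g w x z wx xg gz zL (inj₂ (inj₂ all)) a b c = clash (all w (≤-trans (<⇒≤ wx) (≤-trans (<⇒≤ xg) (≤-trans gz zL)))) a
    caseY (suc g) w x z wx xg gz zL (inj₁ e) a b c = alt w x g z wx (strict′ (≤-pred xg) b e) gz zL a b e c (true≢false ∘ sym)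
    caseZ : ∀ g → g ≤ L → ∀ w x y → w < x → x < y → y < g → Good g i →
      val i w ≡ true → val i x ≡ false → val i y ≡ true → ⊥
    caseZ g g≤L w x y wx xy yg (inj₂ (inj₁ e)) a b c = alt w x y g wx xy yg g≤L a b c e true≢false
    caseZ g g≤L w x y wx xy yg (inj₂ (inj₂ all)) a b c = clash (all x (≤-trans (<⇒≤ xy) (≤-trans (<⇒≤ yg) g≤L))) b
    caseZ (suc g) g≤L w x y wx xy yg (inj₁ e) a b c = alt w x y g wx xy (strict′ (≤-pred yg) c e) (≤-trans (n≤1+n g) g≤L) a b c e true≢false

  -- A good gap is one that no row spans.
  module At (g : ℕ) (g≤L : g ≤ L) (good : ∀ i → Good g i) where
    -- Old columns take the odd positions, so 2 * g is free and lies just before column g.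
    pos : Fin (suc (suc L)) → ℕ
    pos zero = 2 * g
    pos (suc y) = suc (2 * toℕ y)
    pos-injective : Injective _≡_ _≡_ pos
    pos-injective {zero} {zero} _ = refl
    pos-injective {zero} {suc y} e = contradiction e (even≢odd g (toℕ y))
    pos-injective {suc y} {zero} e = contradiction (sym e) (even≢odd g (toℕ y))
    pos-injective {suc y} {suc y′} e = cong suc (Fin.toℕ-injective (*-cancelˡ-≡ _ _ 2 (suc-injective e)))
    ss : ∀ {y y′} → pos (suc y) < pos (suc y′) → toℕ y < toℕ y′
    ss h = *-cancelˡ-< 2 _ _ (≤-pred h)
    zs : ∀ {y} → pos zero < pos (suc y) → g ≤ toℕ y
    zs h = *-cancelˡ-≤ 2 (≤-pred h)
    sz : ∀ {y} → pos (suc y) < pos zero → toℕ y < g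
    sz h = *-cancelˡ-< 2 _ _ (<⇒≤ h)
    module _ (i : Fin m) where
      bound : ∀ (y : Fin (suc L)) → toℕ y ≤ L
      bound y = ≤-pred (Fin.toℕ<n y)
      v : ∀ y {b} → R i y ≡ b → val i (toℕ y) ≡ b
      v y e = trans (val-toℕ i y) e
      row : NC pos (K i)
      row (suc w) (suc x) (suc y) (suc z) wx xy yz = nc i w x y z (ss wx) (ss xy) (ss yz)
      row zero (suc x) (suc y) (suc z) wx xy yz wy xz with bool-case (R i x)
      ... | inj₂ f = sym f
      ... | inj₁ t = ⊥-elim (caseW i g (toℕ x) (toℕ y) (toℕ z) (zs {x} wx) (ss xy) (ss yz) (bound z) (good i)
              (v x t) (v y (sym wy)) (v z (trans (sym xz) t)))
      row (suc w) zero (suc y) (suc z) wx xy yz wy xz with bool-case (R i w)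
      ... | inj₂ f = f
      ... | inj₁ t = ⊥-elim (caseX i g (toℕ w) (toℕ y) (toℕ z) (sz {w} wx) (zs {y} xy) (ss yz) (bound z) (good i)
              (v w t) (v y (trans (sym wy) t)) (v z (sym xz)))
      row (suc w) (suc x) zero (suc z) wx xy yz wy xz with bool-case (R i x)
      ... | inj₂ f = trans wy (sym f)
      ... | inj₁ t = ⊥-elim (caseY i g (toℕ w) (toℕ x) (toℕ z) (ss wx) (sz {x} xy) (zs {z} yz) (bound z) (good i)
              (v w wy) (v x t) (v z (trans (sym xz) t)))
      row (suc w) (suc x) (suc y) zero wx xy yz wy xz with bool-case (R i w)
      ... | inj₂ f = trans f (sym xz)
      ... | inj₁ t = ⊥-elim (caseZ i g g≤L (toℕ w) (toℕ x) (toℕ y) (ss wx) (ss xy) (sz {y} yz) (good i)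
              (v w t) (v x xz) (v y (trans (sym wy) t)))
      row zero zero _ _ wx _ _ = contradiction wx (<-irrefl refl)
      row zero (suc _) zero _ wx xy _ = contradiction xy (<-asym wx)
      row zero (suc x) (suc y) zero wx xy yz = contradiction (<-trans xy yz) (<-asym wx)
      row (suc _) zero zero _ _ xy _ = contradiction xy (<-irrefl refl)
      row (suc _) zero (suc _) zero _ xy yz = contradiction yz (<-asym xy)
      row (suc _) (suc _) zero zero _ _ yz = contradiction yz (<-irrefl refl)
    arranged : Arr K
    arranged = pos , pos-injective , row

  -- If every gap is spanned, a maximal spanning row and the rows spanning the gaps
  -- outside it form a cycle.
  module Spanned (spans : ∀ g → g < suc L → ∃ λ i → Bad g i) where
    record Arc (a b : ℕ) : Set where
      field
        i : Fin m
        at0 : val i 0 ≡ true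
        atL : val i L ≡ true
        gap : suc a < b
        b≤L : b ≤ L
        ata : val i a ≡ true
        atb : val i b ≡ true
        inside : ∀ j → a < j → j < b → val i j ≡ false

    arc : ∀ i f → f ≤ L → val i 0 ≡ true → val i L ≡ true → val i f ≡ false →
      ∃ λ a → ∃ λ b → a < f × f < b × Σ (Arc a b) λ A → Arc.i A ≡ i
    arc i f f≤L t0 tL ef with lastBefore (val i) f t0 ef
      | firstAfter (val i) (L ∸ f) f (subst (λ q → val i q ≡ true) (sym (m+[n∸m]≡n f≤L)) tL) ef
    ... | a , a<f , ta , na | b , f<b , b≤ , tb , nb = a , b , a<f , f<b , record
      { i = i ; at0 = t0 ; atL = tL ; gap = ≤-trans (s≤s a<f) f<b ; b≤L = subst (b ≤_) (m+[n∸m]≡n f≤L) b≤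
      ; ata = ta ; atb = tb ; inside = inside } , refl
      where
      inside : ∀ j → a < j → j < b → val i j ≡ false
      inside j aj jb with j ≤? f
      ... | yes q = na j aj q
      ... | no q = nb j (<⇒≤ (≰⇒> q)) jb

    In-K : ∀ i p {b} → val i p ≡ b → In K zero i (suc (clamp L p)) ≡ b
    In-K i p e = trans (xor-identityʳ _) e

    In-K⁻ : ∀ i p {b} → In K zero i (suc (clamp L p)) ≡ b → val i p ≡ b
    In-K⁻ i p e = trans (sym (xor-identityʳ _)) e

    row-of : ℕ → Fin m
    row-of g with g <? suc L
    ... | yes h = proj₁ (spans g h)
    ... | no _ = proj₁ (spans 0 (s≤s z≤n))

    row-of-bad : ∀ g → g ≤ L → Bad g (row-of g)
    row-of-bad g h with g <? suc L
    ... | yes q = proj₂ (spans g q)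
    ... | no q = contradiction (s≤s h) q

    -- The rows that span the gaps from a to b form a path from column a to column b, closed by the
    -- row of the arc. The only thing that can go wrong is a spanning row that contains both a and
    -- b; it yields a shorter arc or a contradiction with `meets`. Shorter arcs of missed columns
    -- mean larger rows.
    loop : ∀ bound a b → b ∸ a < bound → Arc a b → Cycle K
    loop (suc bound) a b (s≤s measure) A
      with search (b ∸ a) (λ s → val (row-of (suc a + s)) a ∧ val (row-of (suc a + s)) b)
    ... | inj₂ none = LooseCycle⇒Cycle {z = zero} {p = b ∸ a} record
      { 0<p = m<n⇒0<n∸m a<b ; x = λ j → suc (clamp L (a + j)) ; r = λ s → row-of (suc a + s) ; ρ = i
      ; edgeˡ = λ s h → In-K _ (a + s) (proj₁ (row-of-bad (suc a + s) (gap≤ s h)))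
      ; edgeʳ = λ s h → In-K _ (a + suc s) (subst (λ q → val (row-of (suc a + s)) q ≡ true) (sym (+-suc a s))
                  (proj₁ (proj₂ (row-of-bad (suc a + s) (gap≤ s h)))))
      ; closeˡ = In-K i (a + 0) (subst (λ q → val i q ≡ true) (sym (+-identityʳ a)) ata)
      ; closeʳ = In-K i (a + (b ∸ a)) (subst (λ q → val i q ≡ true) (sym ab) atb)
      ; inner = λ j 0<j h → In-K i (a + j) (inside (a + j) (m<m+n a 0<j) (subst (a + j <_) ab (+-monoʳ-< a h)))
      ; short = λ s h u v → clash (∧-true
          (subst (λ q → val (row-of (suc a + s)) q ≡ true) (+-identityʳ a) (In-K⁻ _ (a + 0) u))
          (subst (λ q → val (row-of (suc a + s)) q ≡ true) ab (In-K⁻ _ (a + (b ∸ a)) v))) (none s h) }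
      where
      open Arc A
      a<b : a < b
      a<b = <⇒≤ gap
      ab : a + (b ∸ a) ≡ b
      ab = m+[n∸m]≡n (<⇒≤ a<b)
      gap≤ : ∀ s → s < b ∸ a → suc a + s ≤ L
      gap≤ s h = ≤-trans (subst (suc (a + s) ≤_) ab (+-monoʳ-< a h)) b≤L
    ... | inj₁ (s , s< , e) = bigger (search (b ∸ suc a) (λ j → not (val i′ (suc a + j))))
      where
      open Arc A
      a<b : a < b
      a<b = <⇒≤ gap
      ab : a + (b ∸ a) ≡ b
      ab = m+[n∸m]≡n (<⇒≤ a<b)
      ab′ : suc a + (b ∸ suc a) ≡ b
      ab′ = m+[n∸m]≡n a<b
      g = suc a + s
      g≤b : g ≤ b
      g≤b = subst (suc (a + s) ≤_) ab (+-monoʳ-< a s<)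
      i′ = row-of g
      bad′ : Bad g i′
      bad′ = row-of-bad g (≤-trans g≤b b≤L)
      ta : val i′ a ≡ true
      ta = proj₁ (∧-split e)
      tb : val i′ b ≡ true
      tb = proj₂ (∧-split {val i′ a} e)
      f′ = proj₁ (proj₂ (proj₂ bad′))
      f′≤L : f′ ≤ L
      f′≤L = proj₁ (proj₂ (proj₂ (proj₂ bad′)))
      f′F : val i′ f′ ≡ false
      f′F = proj₂ (proj₂ (proj₂ (proj₂ bad′)))
      inner : ∀ f → a < f → f < b → val i′ f ≡ false → Cycle K
      inner f af fb ff with arc i′ f (≤-trans (<⇒≤ fb) b≤L) t0 tL ff
        where
        t0 : val i′ 0 ≡ true
        t0 = ≢false λ h → alternating (R i′) (nc i′) 0 a f b (≤∧≢⇒< z≤n λ { refl → clash ta h }) af fb b≤L h ta ff tb (true≢false ∘ sym)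
        tL : val i′ L ≡ true
        tL = ≢false λ h → alternating (R i′) (nc i′) a f b L af fb (≤∧≢⇒< b≤L λ { refl → clash tb h }) ≤-refl ta ff tb h true≢false
      ... | a′ , b′ , a′f , fb′ , A′ , refl = loop bound a′ b′ (≤-trans smaller measure) A′
        where
        module A′ = Arc A′
        a≤a′ : a ≤ a′
        a≤a′ = ≮⇒≥ λ h → clash ta (A′.inside a h (<-trans af fb′))
        b′≤b : b′ ≤ b
        b′≤b = ≮⇒≥ λ h → clash tb (A′.inside b (<-trans a′f fb) h)
        -- Row i′ is true on both sides of gap g, and one of these columns lies strictly between a
        -- and b.
        same : a ≡ a′ → b′ ≡ b → s ≡ 0 ⊎ 0 < s → ⊥
        same refl refl (inj₁ refl) = clash (proj₁ (proj₂ bad′)) (A′.inside g (s≤s (m≤m+n a 0))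
          (subst (λ t → suc t < b) (sym (+-identityʳ a)) gap))
        same refl refl (inj₂ 0<s) = clash (proj₁ bad′) (A′.inside (a + s) (m<m+n a 0<s) g≤b)
        zero? : ∀ s → s ≡ 0 ⊎ 0 < s
        zero? zero = inj₁ refl
        zero? (suc s) = inj₂ (s≤s z≤n)
        smaller : b′ ∸ a′ < b ∸ a
        smaller with m≤n⇒m<n∨m≡n a≤a′ | m≤n⇒m<n∨m≡n b′≤b
        ... | inj₁ p | _ = ≤-<-trans (∸-monoˡ-≤ a′ b′≤b) (∸-monoʳ-< p (≤-trans (<⇒≤ (<-trans a′f fb′)) b′≤b))
        ... | inj₂ p | inj₁ q = subst (λ t → b′ ∸ t < b ∸ a) p (∸-monoˡ-< q (<⇒≤ (<-trans af fb′)))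
        ... | inj₂ p | inj₂ q = ⊥-elim (same p q (zero? s))
      -- Now the two rows cover every column, so their intersection is circular. But it is true at a
      -- and b, false at suc a between them, and false at f′, which must lie outside.
      outer : (∀ j → a < j → j < b → val i′ j ≡ true) → ⊥
      outer all = meet (<-cmp f′ a) (<-cmp f′ b)
        where
        full : ∀ p → p ≤ L → val i p ∨ val i′ p ≡ true
        full p p≤L with <-cmp p a | <-cmp p b
        ... | tri≈ _ refl _ | _ = ∨-trueˡ ata
        ... | _ | tri≈ _ refl _ = ∨-trueˡ atb
        ... | tri> _ _ q | tri< q′ _ _ = ∨-trueʳ (all p q q′)
        ... | tri< q _ _ | _ = ∨-trueˡ (≢false λ h → alternating (R i) (nc i) 0 p a (suc a)
                (≤∧≢⇒< z≤n λ { refl → clash at0 h }) q ≤-refl (≤-trans a<b b≤L) at0 h ata (inside (suc a) ≤-refl gap) true≢false)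
        ... | tri> _ _ _ | tri> _ _ q = ∨-trueˡ (≢false λ h → alternating (R i) (nc i) (suc a) b p L
                gap q (≤∧≢⇒< p≤L λ { refl → clash atL h }) ≤-refl (inside (suc a) ≤-refl gap) atb h atL (true≢false ∘ sym))
        both : NC toℕ (λ y → R i y ∧ R i′ y)
        both = meets i i′ λ y → subst (λ q → q ≡ true) (cong₂ _∨_ (val-toℕ i y) (val-toℕ i′ y)) (full (toℕ y) (≤-pred (Fin.toℕ<n y)))
        ∧-falseʳ : ∀ b {c} → c ≡ false → b ∧ c ≡ false
        ∧-falseʳ true e = e
        ∧-falseʳ false e = refl
        sa : val i (suc a) ∧ val i′ (suc a) ≡ false
        sa = cong (_∧ val i′ (suc a)) (inside (suc a) ≤-refl gap)
        meet : _ → _ → ⊥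
        meet (tri≈ _ q _) _ = clash (subst (λ t → val i′ t ≡ true) (sym q) ta) f′F
        meet _ (tri≈ _ q _) = clash (subst (λ t → val i′ t ≡ true) (sym q) tb) f′F
        meet (tri> _ _ q) (tri< q′ _ _) = clash (all f′ q q′) f′F
        meet (tri< q _ _) _ = alternating _ both f′ a (suc a) b q ≤-refl gap b≤L
          (∧-falseʳ (val i f′) f′F) (∧-true ata ta) sa (∧-true atb tb) (true≢false ∘ sym)
        meet (tri> _ _ _) (tri> _ _ q) = alternating _ both a (suc a) b f′ ≤-refl gap q f′≤L
          (∧-true ata ta) sa (∧-true atb tb) (∧-falseʳ (val i f′) f′F) true≢false
      bigger : _ ⊎ _ → Cycle K
      bigger (inj₁ (j , j< , ej)) = inner (suc a + j) (s≤s (m≤m+n a j)) (subst (suc a + j <_) ab′ (+-monoʳ-< (suc a) j<)) (not-true ej)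
      bigger (inj₂ none) = ⊥-elim (outer λ j aj jb → not-false (subst (λ q → not (val i′ q) ≡ false) (m+[n∸m]≡n aj)
        (none (j ∸ suc a) (∸-monoˡ-< jb aj))))

    cycle : Cycle K
    cycle with spans 0 (s≤s z≤n)
    ... | i , tL , t0 , f , f≤L , ff with arc i f f≤L t0 tL ff
    ...   | a , b , _ , _ , A , _ = loop (suc (b ∸ a)) a b ≤-refl A

  insert : Arr K ⊎ Cycle K
  insert with choose< (suc L) (λ g → swap (choose m (judge g)))
  ... | inj₁ (g , g≤ , good) = inj₁ (At.arranged g (≤-pred g≤) good)
  ... | inj₂ spans = inj₂ (Spanned.cycle spans)

-- Without the rows α ∧ β, the others could be arranged so that α ∩ β falls into two parts,
-- although column zero forces it to be connected.
record Saturation {m n} (N : Mat m (suc n)) (ps : List (Fin m × Fin m)) : Set where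
  field
    size : ℕ
    rows : Mat size (suc n)
    zeros : ∀ i → rows i zero ≡ false
    sound : Obs rows → Obs N
    old : Fin m → Fin size
    old-row : ∀ i y → rows (old i) y ≡ N i y
    meet : ∀ {α β} → (α , β) ∈ ps → (∀ y → N α (suc y) ∨ N β (suc y) ≡ true) →
      ∃ λ i → ∀ y → rows i y ≡ N α y ∧ N β y

-- Only intersections of original rows are added. The column is later reinserted into N alone, and
-- there the extra rows have served to constrain the arrangement of the other columns.
saturate : ∀ {m n} (N : Mat m (suc n)) → (∀ i → N i zero ≡ false) → ∀ ps → Saturation N ps
saturate N Nz [] = record { rows = N ; zeros = Nz ; sound = id ; old = id ; old-row = λ _ _ → refl ; meet = λ () }
saturate {m} {n} N Nz ((α , β) ∷ ps) with saturate N Nz ps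
... | S with choose n (λ y → swap (bool-case (N α (suc y) ∨ N β (suc y))))
... | inj₁ (y , e) = record
  { rows = rows ; zeros = zeros ; sound = sound ; old = old ; old-row = old-row
  ; meet = λ { (here refl) cover → clash (cover y) e ; (there q) cover → meet q cover } }
  where open Saturation S
... | inj₂ cover = record
  { rows = addRow new rows
  ; zeros = λ { zero → trans (cong (_∧ rows (old β) zero) (trans (old-row α zero) (Nz α))) refl ; (suc i) → zeros i }
  ; sound = λ o → sound (pullback rows zero zeros (old α) (old β) covered o)
  ; old = suc ∘ old ; old-row = old-row
  ; meet = λ { (here refl) _ → zero , λ y → cong₂ _∧_ (old-row α y) (old-row β y)
             ; (there q) c → suc (proj₁ (meet q c)) , proj₂ (meet q c) } }
  where
  open Saturation S
  new : Fin (suc n) → Bool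
  new y = rows (old α) y ∧ rows (old β) y
  covered : ∀ y → y ≢ zero → rows (old α) y ∨ rows (old β) y ≡ true
  covered zero ne = contradiction refl ne
  covered (suc y) _ = trans (cong₂ _∨_ (old-row α (suc y)) (old-row β (suc y))) (cover y)

suc-σ : ∀ {n} → (Fin n → Fin n) → Fin (suc n) → Fin (suc n)
suc-σ σ zero = zero
suc-σ σ (suc y) = suc (σ y)

module Arrange {m L} (N : Mat m (suc (suc L))) (Nz : ∀ i → N i zero ≡ false) {ps}
  (all : ∀ α β → (α , β) ∈ ps) (S : Saturation N ps) where
  open Saturation S

  module _ (A : Arr (λ i y → rows i (suc y))) where
    pos : Fin (suc L) → ℕ
    pos = proj₁ A
    nc : ∀ i → NC pos (λ y → rows i (suc y))
    nc = proj₂ (proj₂ A)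
    order : Σ (Permutation′ (suc L)) λ σ → ∀ a b → toℕ a < toℕ b → pos (σ ⟨$⟩ʳ a) < pos (σ ⟨$⟩ʳ b)
    order = sort pos (proj₁ (proj₂ A))
    σ : Permutation′ (suc L)
    σ = proj₁ order
    sorted : ∀ {v : Fin (suc L) → Bool} → NC pos v → NC toℕ (λ y → v (σ ⟨$⟩ʳ y))
    sorted h w x y z wx xy yz = h _ _ _ _ (proj₂ order w x wx) (proj₂ order x y xy) (proj₂ order y z yz)
    R : Fin m → Fin (suc L) → Bool
    R i y = N i (suc (σ ⟨$⟩ʳ y))
    ncR : ∀ i → NC toℕ (R i)
    ncR i = sorted {λ y → N i (suc y)} (NC-resp (λ y → old-row i (suc y)) (nc (old i)))
    meets : ∀ α β → (∀ y → R α y ∨ R β y ≡ true) → NC toℕ (λ y → R α y ∧ R β y)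
    meets α β cover = sorted {λ y → N α (suc y) ∧ N β (suc y)} (NC-resp (λ y → proj₂ k (suc y)) (nc (proj₁ k)))
      where
      k : ∃ λ i → ∀ y → rows i y ≡ N α y ∧ N β y
      k = meet (all α β) λ y → subst (λ t → N α (suc t) ∨ N β (suc t) ≡ true) (inverseʳ σ) (cover (σ ⟨$⟩ˡ y))
    open Insert R ncR meets using (K; insert)
    to from : Fin (suc (suc L)) → Fin (suc (suc L))
    to = suc-σ (σ ⟨$⟩ʳ_)
    from = suc-σ (σ ⟨$⟩ˡ_)
    to-from : ∀ y → to (from y) ≡ y
    to-from zero = refl
    to-from (suc y) = cong suc (inverseʳ σ)
    from-injective : Injective _≡_ _≡_ from
    from-injective e = trans (sym (to-from _)) (trans (cong to e) (to-from _))
    K-to : ∀ i y → N i (to y) ≡ K i y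
    K-to i zero = Nz i
    K-to i (suc y) = refl
    finish : Arr K ⊎ Cycle K → Arr N ⊎ Obs N
    finish (inj₁ B) = inj₁ (Arr-resp (λ i y → trans (sym (K-to i (from y))) (cong (N i) (to-from y)))
      (Arr-sub {M = K} id from from-injective B))
    finish (inj₂ C) = inj₂ (Obs-Emb {N = K} (λ _ → false) (emb id to K-to) (inj₁ C))
    arranged : Arr N ⊎ Obs N
    arranged = finish insert

  arrange : Arr (λ i y → rows i (suc y)) ⊎ Obs (λ i y → rows i (suc y)) → Arr N ⊎ Obs N
  arrange (inj₁ A) = arranged A
  arrange (inj₂ o) = inj₂ (sound (Obs-Emb (λ _ → false) (emb id suc λ _ _ → refl) o))

normalise : ∀ {m n} (M : Mat m (suc n)) → let N = twist (λ i → M i zero) M in Arr N ⊎ Obs N → Arr M ⊎ Obs M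
normalise M (inj₁ A) = inj₁ (Arr-untwist (λ i → M i zero) A)
normalise M (inj₂ o) = inj₂ (Obs-Emb {N = twist (λ i → M i zero) M} (λ i → M i zero)
  (emb id id λ i j → sym (xor-involutive (M i zero) (M i j))) o)

-- The number of rows varies in the induction, because saturation adds rows while a column is
-- removed.
tucker : ∀ n {m} (M : Mat m n) → Arr M ⊎ Obs M
tucker zero M = inj₁ ((λ ()) , (λ {}) , λ _ ())
tucker (suc zero) M = inj₁ ((λ _ → 0) , (λ { {zero} {zero} _ → refl }) , λ i w x y z ())
tucker (suc (suc L)) {m} M = normalise M (Arrange.arrange N Nz (λ α β → ∈-cartesianProduct⁺ (∈-allFin α) (∈-allFin β)) S
  (tucker (suc L) λ i y → Saturation.rows S i (suc y)))
  where
  N : Mat m (suc (suc L))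
  N = twist (λ i → M i zero) M
  Nz : ∀ i → N i zero ≡ false
  Nz i = xor-same (M i zero)
  S : Saturation N (cartesianProduct (allFin m) (allFin m))
  S = saturate N Nz (cartesianProduct (allFin m) (allFin m))

open Search false using (embeds; embeds-sound)

-- Reduction to the family

hits : ∀ {m n} → Table m n → List FIdx → Bool
hits T [] = false
hits T (x ∷ xs) = embeds T (table (fMat x)) ∨ hits T xs

hits-sound : ∀ {m n} (T : Table m n) xs → hits T xs ≡ true → ∃ λ x → Emb (mat T) (fMat x)
hits-sound T (x ∷ xs) h with ∨-true {embeds T (table (fMat x))} h
... | inj₂ q = hits-sound T xs q
... | inj₁ q with embeds-sound T (table (fMat x)) q
...   | b , emb f g e , plain = x , emb f g λ i j → trans (e i j)
  (trans (cong (_xor mat (table (fMat x)) i j) (not-true (plain i))) (mat-table (fMat x) i j))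

Reduced : ∀ {m n} → Mat m n → Set
Reduced M = ∃ λ x → Emb M (fMat x)

twisted : ∀ {p q} → Mat p q → Vec Bool p → Table p q
twisted N v = table (twist (lookup v) N)

reduce-finite : ∀ {m n p q} {M : Mat m n} (N : Mat p q) xs → (∀ a → hits (twisted N a) xs ≡ true) →
  ∀ a → Emb M (twist a N) → Reduced M
reduce-finite N xs h a (emb f g e) with hits-sound (twisted N (tabulate a)) xs (h (tabulate a))
... | x , e′ = x , Emb-trans (emb f g λ i j → trans (e i j) (trans (cong (_xor N i j) (sym (lookup∘tabulate a i)))
    (sym (mat-table (twist (lookup (tabulate a)) N) i j)))) e′

3≤ : ∀ k → 3 ≤ suc (suc (suc k))
3≤ k = s≤s (s≤s (s≤s z≤n))

spiders cycles : List FIdx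
spiders = (gMI 3 (3≤ 0) , true) ∷ (gMIbar 3 (3≤ 0) , true) ∷ []
cycles = (gMI 3 (3≤ 0) , false) ∷ (gMIbar 3 (3≤ 0) , false) ∷ []

hits-MIV : ∀Vec 4 (λ a → hits (twisted (mat MIV) a) ((gMV , false) ∷ (gMVbar , false) ∷ spiders)) ≡ true
hits-MIV = refl

-- Rows of M_I(3)* are pairs out of four columns, and so are their complements. One pair from each
-- of the three complementary couples gives a triangle, which is M_I(3)*, or three pairs through one
-- column, which is its complement.
hits-3 : ∀Vec 3 (λ a → hits (twisted (star (MI 3)) a) cycles) ≡ true
hits-3 = refl

a0001 a0011 a0111 a00001 a00011 a00111 a01111 a000111 : FIdx
a0001 = gOdot _ (here refl) , false
a0011 = gOdot _ (there (here refl)) , false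
a0111 = gOdot _ (there (there (here refl))) , false
a00001 = gOdot _ (there (there (there (here refl)))) , false
a00011 = gOdot _ (there (there (there (there (here refl))))) , false
a00111 = gOdot _ (there (there (there (there (there (here refl)))))) , false
a01111 = gOdot _ (there (there (there (there (there (there (here refl))))))) , false
a000111 = gOdot _ (there (there (there (there (there (there (there (here refl)))))))) , false

-- The members of F of size k × (k + 1), and small transposes. A copy of the full size is the matrix
-- itself up to permutations, so every remaining twist contains one of the small ones.
targets-4 targets-5 targets-6 targets-7 : List FIdx
targets-4 = (gMI 3 (3≤ 0) , true) ∷ (gMI 4 (3≤ 1) , false) ∷ (gMIbar 4 (3≤ 1) , false) ∷ a0001 ∷ a0011 ∷ a0111 ∷ []
targets-5 = (gMI 3 (3≤ 0) , true) ∷ (gMI 5 (3≤ 2) , false) ∷ (gMIbar 5 (3≤ 2) , false) ∷ a00001 ∷ a00011 ∷ a00111 ∷ a01111 ∷ []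
targets-6 = (gMI 3 (3≤ 0) , true) ∷ (gMIbar 3 (3≤ 0) , true) ∷ (gMI 6 (3≤ 3) , false) ∷ (gMIbar 6 (3≤ 3) , false) ∷ a000111 ∷ []
targets-7 = (gMI 3 (3≤ 0) , true) ∷ (gMIbar 3 (3≤ 0) , true) ∷ (gMI 7 (3≤ 4) , false) ∷ (gMIbar 7 (3≤ 4) , false) ∷ []

hits-4 : ∀Vec 4 (λ a → hits (twisted (star (MI 4)) a) targets-4) ≡ true
hits-4 = refl

hits-5 : ∀Vec 5 (λ a → hits (twisted (star (MI 5)) a) targets-5) ≡ true
hits-5 = refl

hits-6 : ∀Vec 6 (λ a → hits (twisted (star (MI 6)) a) targets-6) ≡ true
hits-6 = refl

hits-7 : ∀Vec 7 (λ a → hits (twisted (star (MI 7)) a) targets-7) ≡ true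
hits-7 = refl

-- Seven consecutive path rows of a long cycle; column zero is the star column.
window : Mat 7 9
window i zero = false
window i (suc j) = (toℕ j == toℕ i) ∨ (toℕ j == suc (toℕ i))

constant : Vec Bool 7 → Bool
constant v = ∀Fin 7 λ i → eqᵇ (lookup v i) (lookup v zero)

window-test : Vec Bool 7 → Bool
window-test v = constant v ∨ hits (twisted window v) spiders

window-tests : ∀Vec 7 window-test ≡ true
window-tests = refl

reduce-window : ∀ {m n} {M : Mat m n} a → Emb M (twist a window) → ∀ i j → a i ≢ a j → Reduced M
reduce-window {M = M} a (emb f g e) i j ne with ∨-true {constant (tabulate a)} (∀Vec-sound 7 {window-test} window-tests (tabulate a))
... | inj₁ c = contradiction (trans (value i) (sym (value j))) ne
  where
  value : ∀ i → a i ≡ a zero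
  value i = trans (sym (lookup∘tabulate a i)) (eqᵇ-sound (∀Fin-sound 7 {λ i → eqᵇ (lookup (tabulate a) i) (lookup (tabulate a) zero)} c i))
... | inj₂ h with hits-sound (twisted window (tabulate a)) spiders h
...   | x , e′ = x , Emb-trans (emb f g λ i j → trans (e i j) (trans (cong (_xor window i j) (sym (lookup∘tabulate a i)))
        (sym (mat-table (twist (lookup (tabulate a)) window) i j)))) e′

module Long {m n} {M : Mat m n} (C : Cycle M) (7≤p : 7 ≤ Cycle.p C) where
  open Cycle C

  at : ∀ w → w + 7 ≤ p → ∀ d → d < 6 → M (r (w + d)) z ≢ M (r (w + suc d)) z → Reduced M
  at w w≤ d d<6 ne = reduce-window (λ i → M (rows i) z) (emb rows cols entries)
    (fromℕ< (m<n⇒m<1+n d<6)) (fromℕ< (s≤s d<6))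
    λ e → ne (subst₂ (λ s t → M (r (w + s)) z ≡ M (r (w + t)) z) (Fin.toℕ-fromℕ< (m<n⇒m<1+n d<6)) (Fin.toℕ-fromℕ< (s≤s d<6)) e)
    where
    rows : Fin 7 → Fin m
    rows i = r (w + toℕ i)
    cols : Fin 9 → Fin n
    cols zero = z
    cols (suc j) = x (w + toℕ j)
    ==-shift : ∀ a b → ((w + a) == (w + b)) ≡ (a == b)
    ==-shift a b with a ≟ b
    ... | yes e = ==-refl (cong (w +_) e)
    ... | no ne = ==-≢ (ne ∘ +-cancelˡ-≡ w a b)
    entries : ∀ i j → M (rows i) (cols j) ≡ M (rows i) z xor window i j
    entries i zero = sym (xor-identityʳ _)
    entries i (suc j) = trans (sym (xor-back (M (rows i) z) _)) (cong (M (rows i) z xor_)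
      (trans (path (w + toℕ i) (w + toℕ j) (≤-trans (+-monoʳ-< w (Fin.toℕ<n i)) w≤)
          (≤-trans (+-monoʳ-≤ w (≤-pred (Fin.toℕ<n j))) w≤))
        (cong₂ _∨_ (==-shift (toℕ j) (toℕ i)) (trans (cong ((w + toℕ j) ==_) (sym (+-suc w (toℕ i)))) (==-shift (toℕ j) (suc (toℕ i)))))))

  -- The window starts at s if there is room for it, and otherwise ends with the path; rows s and
  -- suc s lie in it in either case.
  change : ∀ s → suc s < p → M (r s) z ≢ M (r (suc s)) z → Reduced M
  change s h ne with s + 7 ≤? p
  ... | yes q = at s q 0 (s≤s z≤n) (subst₂ (λ a b → M (r a) z ≢ M (r b) z) (sym (+-identityʳ s)) (trans (cong suc (sym (+-identityʳ s))) (sym (+-suc s 0))) ne)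
  ... | no q = at w (≤-reflexive w7) (s ∸ w) d<6
    (subst₂ (λ a b → M (r a) z ≢ M (r b) z) (sym ws) (trans (cong suc (sym ws)) (sym (+-suc w (s ∸ w)))) ne)
    where
    w = p ∸ 7
    w7 : w + 7 ≡ p
    w7 = m∸n+n≡m 7≤p
    w≤s : w ≤ s
    w≤s = +-cancelʳ-≤ 7 w s (subst (_≤ s + 7) (sym w7) (<⇒≤ (≰⇒> q)))
    ws : w + (s ∸ w) ≡ s
    ws = m+[n∸m]≡n w≤s
    d<6 : s ∸ w < 6
    d<6 = +-cancelˡ-< (suc w) _ _ (subst₂ _<_ (cong suc (sym ws)) (trans (sym w7) (+-suc w 6)) h)

Cycle⇒Emb-constant : ∀ {m n} {M : Mat m n} (C : Cycle M) b → (∀ s → s < Cycle.p C → M (Cycle.r C s) (Cycle.z C) ≡ b) →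
  M (Cycle.ρ C) (Cycle.z C) ≡ b → ∀ i → proj₁ (Cycle⇒Emb C) i ≡ b
Cycle⇒Emb-constant C b h h′ i with toℕ i <? Cycle.p C
... | yes q = h (toℕ i) q
... | no _ = h′

constant-twist : ∀ {m n k} {M : Mat m n} b a → 3 ≤ k → (∀ i → a i ≡ b) → Emb M (twist a (star (MI k))) → Reduced M
constant-twist {k = k} false a h all (emb f g e) = (gMI k h , false) , emb f g λ i j →
  trans (e i j) (cong (_xor star (MI k) i j) (all i))
constant-twist {k = k} true a h all (emb f g e) = (gMIbar k h , false) , emb f g λ i j →
  trans (e i j) (cong (_xor star (MI k) i j) (all i))

reduce-constant : ∀ {m n} {M : Mat m n} (C : Cycle M) b → (∀ s → s < Cycle.p C → M (Cycle.r C s) (Cycle.z C) ≡ b) →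
  M (Cycle.ρ C) (Cycle.z C) ≡ b → Reduced M
reduce-constant C b h h′ =
  constant-twist b (proj₁ (Cycle⇒Emb C)) (s≤s (Cycle.2≤p C)) (Cycle⇒Emb-constant C b h h′) (proj₂ (Cycle⇒Emb C))

-- A nonconstant twist changes between two consecutive rows of the path, or only at ρ. In the latter
-- case one rotation puts ρ right after r (p - 1) on the path.
reduce-long : ∀ {m n} {M : Mat m n} (C : Cycle M) → 7 ≤ Cycle.p C → Reduced M
reduce-long {M = M} C 7≤p = go (search p λ s → value s xor value 0) (bool-case (M ρ z xor value 0))
  where
  open Cycle C
  value : ℕ → Bool
  value s = M (r s) z
  change : ∀ s → s < p → value s xor value 0 ≡ true → Reduced M
  change zero _ e = clash e (xor-same (value 0))
  change (suc s) h e with bool-case (value s xor value 0)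
  ... | inj₁ t = change s (<⇒≤ h) t
  ... | inj₂ f = Long.change C 7≤p s h λ q → clash e (trans (cong (_xor value 0) (sym q)) f)
  last : p ≡ suc (suc (p ∸ 2))
  last = sym (m+[n∸m]≡n 2≤p)
  go : _ → _ → Reduced M
  go (inj₁ (s , h , e)) _ = change s h e
  go (inj₂ same) (inj₂ f) = reduce-constant C (value 0) (λ s h → xor-false (same s h)) (xor-false f)
  go (inj₂ same) (inj₁ t) = Long.change (Rotation.result C) 7≤p (p ∸ 2) (≤-reflexive (sym last)) λ q →
    clash t (trans (cong (_xor value 0) (trans (sym (cong (λ i → M i z) ρ≡)) (trans (sym q) (cong (λ i → M i z) before))))
      (same (suc (p ∸ 2)) (≤-reflexive (sym last))))
    where
    ρ≡ : Rotation.r′ C (suc (p ∸ 2)) ≡ ρ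
    ρ≡ = Rotation.r′-last C (≤-reflexive last)
    before : Rotation.r′ C (p ∸ 2) ≡ r (suc (p ∸ 2))
    before = Rotation.r′-suc C (≤-reflexive (sym last))

reduce-Cycle : ∀ {m n} {M : Mat m n} → Cycle M → Reduced M
reduce-Cycle C with 7 ≤? Cycle.p C
... | yes h = reduce-long C h
... | no h with Cycle.p C | Cycle.2≤p C | Cycle⇒Emb C
...   | 2 | _ | a , e = reduce-finite (star (MI 3)) cycles (∀Vec-sound 3 {λ a → hits (twisted (star (MI 3)) a) cycles} hits-3) a e
...   | 3 | _ | a , e = reduce-finite (star (MI 4)) targets-4 (∀Vec-sound 4 {λ a → hits (twisted (star (MI 4)) a) targets-4} hits-4) a e
...   | 4 | _ | a , e = reduce-finite (star (MI 5)) targets-5 (∀Vec-sound 5 {λ a → hits (twisted (star (MI 5)) a) targets-5} hits-5) a e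
...   | 5 | _ | a , e = reduce-finite (star (MI 6)) targets-6 (∀Vec-sound 6 {λ a → hits (twisted (star (MI 6)) a) targets-6} hits-6) a e
...   | 6 | _ | a , e = reduce-finite (star (MI 7)) targets-7 (∀Vec-sound 7 {λ a → hits (twisted (star (MI 7)) a) targets-7} hits-7) a e
...   | suc (suc (suc (suc (suc (suc (suc _)))))) | _ | _ = contradiction (s≤s (s≤s (s≤s (s≤s (s≤s (s≤s (s≤s z≤n))))))) h
...   | 1 | s≤s () | _

reduce : ∀ {m n} {M : Mat m n} → Obs M → Reduced M
reduce (inj₁ C) = reduce-Cycle C
reduce (inj₂ (a , e)) = reduce-finite (mat MIV) ((gMV , false) ∷ (gMVbar , false) ∷ spiders)
  (∀Vec-sound 4 {λ a → hits (twisted (mat MIV) a) ((gMV , false) ∷ (gMVbar , false) ∷ spiders)} hits-MIV) a e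

-- Minimality

A-length : ∀ {a} → a ∈ A-RowCol → 3 ≤ length a
A-length = All.lookup (toWitness {a? = All.all? (λ a → 3 ≤? length a) A-RowCol} _)

MI-true : ∀ k (i j : Fin k) → MI k i j ≡ true →
  toℕ j ≡ toℕ i ⊎ toℕ j ≡ suc (toℕ i) ⊎ (toℕ i ≡ k ∸ 1 × toℕ j ≡ 0)
MI-true k i j h with ∨-true {toℕ j == toℕ i} h
... | inj₁ e = inj₁ (==-sound e)
... | inj₂ h′ with ∨-true {toℕ j == suc (toℕ i)} h′
...   | inj₁ e = inj₂ (inj₁ (==-sound e))
...   | inj₂ h″ with ∧-split h″
...     | e , e′ = inj₂ (inj₂ (==-sound e , ==-sound e′))

MI-diagonal : ∀ k (i : Fin k) → MI k i i ≡ true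
MI-diagonal k i = ∨-trueˡ (==-refl {toℕ i} refl)

MI-next : ∀ k (i j : Fin k) → toℕ j ≡ suc (toℕ i) → MI k i j ≡ true
MI-next k i j e = ∨-trueʳ {toℕ j == toℕ i} (∨-trueˡ (==-refl e))

distinct-by-order : ∀ {n} {P : Fin n → Fin n → Set} → (∀ i j → P i j → P j i) →
  (∀ i j → toℕ i < toℕ j → ¬ P i j) → ∀ i j → P i j → i ≡ j
distinct-by-order sym-P separate i j h with <-cmp (toℕ i) (toℕ j)
... | tri≈ _ e _ = Fin.toℕ-injective e
... | tri< q _ _ = contradiction h (separate i j q)
... | tri> _ _ q = contradiction (sym-P i j h) (separate j i q)

-- The diagonal entry of the earlier row separates two rows, except the first from the last; those
-- are separated by column 1, since 2 ≤ p.
MI-rows : ∀ p → 2 ≤ p → DistinctRows (MI (suc p))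
MI-rows p 2≤p = distinct-by-order (λ _ _ same j → sym (same j)) separate
  where
  separate : ∀ i i′ → toℕ i < toℕ i′ → ¬ (∀ j → MI (suc p) i j ≡ MI (suc p) i′ j)
  separate i i′ h same with MI-true (suc p) i′ i (trans (sym (same i)) (MI-diagonal (suc p) i))
  ... | inj₁ e = <⇒≢ h e
  ... | inj₂ (inj₁ e) = <⇒≢ (m<n⇒m<1+n h) e
  ... | inj₂ (inj₂ (e , e′))
    with MI-true (suc p) i′ (clamp p 1) (trans (sym (same (clamp p 1))) (MI-next (suc p) i (clamp p 1) (trans (toℕ-clamp (<⇒≤ 2≤p)) (cong suc (sym e′)))))
  ...   | inj₁ q = <⇒≢ 2≤p (trans (sym (toℕ-clamp (<⇒≤ 2≤p))) (trans q e))
  ...   | inj₂ (inj₁ q) = <⇒≢ (m<n⇒m<1+n 2≤p) (trans (sym (toℕ-clamp (<⇒≤ 2≤p))) (trans q (cong suc e)))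
  ...   | inj₂ (inj₂ (_ , q)) = contradiction (trans (sym (toℕ-clamp {p} (<⇒≤ 2≤p))) q) λ ()

MI-columns : ∀ p → 2 ≤ p → DistinctRows (transpose (MI (suc p)))
MI-columns p 2≤p = distinct-by-order (λ _ _ same i → sym (same i)) separate
  where
  separate : ∀ j j′ → toℕ j < toℕ j′ → ¬ (∀ i → MI (suc p) i j ≡ MI (suc p) i j′)
  separate j j′ h same with MI-true (suc p) j j′ (trans (sym (same j)) (MI-diagonal (suc p) j))
  ... | inj₁ e = <⇒≢ h (sym e)
  ... | inj₂ (inj₂ (_ , e)) = contradiction (subst (toℕ j <_) e h) λ ()
  ... | inj₂ (inj₁ e) with MI-true (suc p) j′ j (trans (same j′) (MI-diagonal (suc p) j′))
  ...   | inj₁ q = <⇒≢ h q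
  ...   | inj₂ (inj₁ q) = <⇒≢ (m<n⇒m<1+n h) q
  ...   | inj₂ (inj₂ (q , q′)) = <⇒≢ 2≤p (trans (cong suc (sym q′)) (trans (sym e) q))

-- In the star column the rows read `a i` and `a i′`, so equal rows are twisted alike and the twist
-- cancels.
twist-rows : ∀ {k} (a : Fin k → Bool) → 3 ≤ k → DistinctRows (twist a (star (MI k)))
twist-rows {k} a (s≤s {n = p} 2≤p) i i′ same = MI-rows p 2≤p i i′ λ j → trans (sym (star-inject (MI k) i j))
  (trans (xor-cancelˡ (a i) (trans (same (inject₁ j)) (cong (_xor star (MI k) i′ (inject₁ j)) (sym equal))))
    (star-inject (MI k) i′ j))
  where
  equal : a i ≡ a i′
  equal = trans (sym (trans (cong (a i xor_) (star-last (MI k) i)) (xor-identityʳ _)))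
    (trans (same (fromℕ k)) (trans (cong (a i′ xor_) (star-last (MI k) i′)) (xor-identityʳ _)))

star-columns : ∀ {k} → 3 ≤ k → DistinctRows (transpose (star (MI k)))
star-columns {k} (s≤s {n = p} 2≤p) j j′ same with view j | view j′
... | ‵fromℕ | ‵fromℕ = refl
... | ‵inject₁ j | ‵inject₁ j′ = cong inject₁ (MI-columns p 2≤p j j′ λ i →
        trans (sym (star-inject (MI k) i j)) (trans (same i) (star-inject (MI k) i j′)))
... | ‵fromℕ | ‵inject₁ j′ = clash (trans (same j′) (trans (star-inject (MI k) j′ j′) (MI-diagonal k j′))) (star-last (MI k) j′)
... | ‵inject₁ j | ‵fromℕ = clash (trans (sym (same j)) (trans (star-inject (MI k) j j) (MI-diagonal k j))) (star-last (MI k) j)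

twist-columns : ∀ {k} (a : Fin k → Bool) → 3 ≤ k → DistinctRows (transpose (twist a (star (MI k))))
twist-columns a 3≤k j j′ same = star-columns 3≤k j j′ λ i → xor-cancelˡ (a i) (same i)

distinctᵇ : ∀ {m n} → Mat m n → Bool
distinctᵇ {m} {n} M = ∀Fin m λ i → ∀Fin m λ i′ → ⌊ i Fin.≟ i′ ⌋ ∨ not (∀Fin n λ j → eqᵇ (M i j) (M i′ j))

distinct-sound : ∀ {m n} (M : Mat m n) → distinctᵇ M ≡ true → DistinctRows M
distinct-sound {m} {n} M h i i′ same with i Fin.≟ i′ | ∀Fin-sound m (∀Fin-sound m h i) i′
... | yes e | _ = e
... | no _ | q = clash (∀Fin-complete n {λ j → eqᵇ (M i j) (M i′ j)} λ j → eqᵇ-true (same j)) (not-true q)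

-- All members built from M_I(k) unfold to twists of `star (MI k)`, with constant words for `gMI`
-- and `gMIbar`.
genMat-rows : ∀ g → DistinctRows (genMat g)
genMat-rows (gMI k h) = twist-rows (λ _ → false) h
genMat-rows (gMIbar k h) = twist-rows (λ _ → true) h
genMat-rows (gOdot a a∈) = twist-rows (List.lookup a) (A-length a∈)
genMat-rows gMV = distinct-sound (genMat gMV) refl
genMat-rows gMVbar = distinct-sound (genMat gMVbar) refl

genMat-columns : ∀ g → DistinctRows (transpose (genMat g))
genMat-columns (gMI k h) = twist-columns (λ _ → false) h
genMat-columns (gMIbar k h) = twist-columns (λ _ → true) h
genMat-columns (gOdot a a∈) = twist-columns (List.lookup a) (A-length a∈)
genMat-columns gMV = distinct-sound (transpose (genMat gMV)) refl
genMat-columns gMVbar = distinct-sound (transpose (genMat gMVbar)) refl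

Reduced⇒Contains : ∀ {m n} {M : Mat m n} → Reduced M → ∃ λ x → Contains M (fMat x)
Reduced⇒Contains ((g , false) , e) = (g , false) , Emb⇒Contains (genMat-rows g) (genMat-columns g) e
Reduced⇒Contains ((g , true) , e) = (g , true) , Emb⇒Contains (genMat-columns g) (genMat-rows g) e

-- The asteroid is formed by columns 4, 1, 2, counted from 0. Row 1 joins 1 and 2 without 4; rows 3
-- and 2 join 4 to 2 through column 3 without 1; rows 3 and 0 join 4 to 1 through column 0 without
-- 2.
MV-star-obstructed : ¬ Arr (star MV)
MV-star-obstructed (pos , inj , nc) = no-asteroid {z = c5} {c4} {c1} {c2} (λ ()) (λ ()) (λ ())
  (same-side-In {M = star MV} (nc (suc zero)) refl refl refl)
  (trans (same-side-In {M = star MV} {i = r3} {x′ = c3} (nc r3) refl refl refl) (same-side-In {M = star MV} (nc (suc (suc zero))) refl refl refl))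
  (trans (same-side-In {M = star MV} {i = r3} {x′ = zero} (nc r3) refl refl refl) (same-side-In {M = star MV} (nc zero) refl refl refl))
  where
  open Sides pos inj
  r3 : Fin 4
  r3 = suc (suc (suc zero))
  c1 c2 c3 c4 c5 : Fin 6
  c1 = suc zero
  c2 = suc (suc zero)
  c3 = suc (suc (suc zero))
  c4 = suc (suc (suc (suc zero)))
  c5 = suc (suc (suc (suc (suc zero))))

twist-not-Arr : ∀ {k} a → 3 ≤ k → ¬ Arr (twist a (star (MI k)))
twist-not-Arr a (s≤s 2≤p) = Cycle⇒¬Arr (Emb⇒Cycle a 2≤p (emb id id λ _ _ → refl))

genMat-not-Arr : ∀ g → ¬ Arr (genMat g)
genMat-not-Arr (gMI k h) = twist-not-Arr (λ _ → false) h
genMat-not-Arr (gMIbar k h) = twist-not-Arr (λ _ → true) h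
genMat-not-Arr (gOdot a a∈) = twist-not-Arr (List.lookup a) (A-length a∈)
genMat-not-Arr gMV = MV-star-obstructed
genMat-not-Arr gMVbar A = MV-star-obstructed (Arr-untwist (λ _ → true) A)

-- Arrangements of proper submatrices

ncᵇ : ∀ {n} → (Fin n → ℕ) → (Fin n → Bool) → (Fin n → Bool) → Bool
ncᵇ {n} pos skip v =
  ∀Fin n λ w → skip w ∨ (∀Fin n λ x → skip x ∨ not (pos w <ᵇ pos x) ∨ (∀Fin n λ y → skip y ∨ not (pos x <ᵇ pos y) ∨
  (∀Fin n λ z → skip z ∨ not (pos y <ᵇ pos z) ∨ not (eqᵇ (v w) (v y)) ∨ not (eqᵇ (v x) (v z)) ∨ eqᵇ (v w) (v x))))

<ᵇ-true : ∀ {a b} → a < b → (a <ᵇ b) ≡ true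
<ᵇ-true {zero} (s≤s _) = refl
<ᵇ-true {suc a} (s≤s h) = <ᵇ-true h

∨-elim : ∀ {a b} → a ∨ b ≡ true → a ≡ false → b ≡ true
∨-elim {false} h _ = h

ncᵇ-sound : ∀ {n} (pos : Fin n → ℕ) skip v → ncᵇ pos skip v ≡ true →
  ∀ w x y z → skip w ≡ false → skip x ≡ false → skip y ≡ false → skip z ≡ false →
  pos w < pos x → pos x < pos y → pos y < pos z → v w ≡ v y → v x ≡ v z → v w ≡ v x
ncᵇ-sound {n} pos skip v h w x y z sw sx sy sz wx xy yz wy xz = eqᵇ-sound
  (∨-elim (∨-elim (∨-elim (∨-elim (∀Fin-sound n
    (∨-elim (∨-elim (∀Fin-sound n (∨-elim (∨-elim (∀Fin-sound n (∨-elim (∀Fin-sound n h w) sw) x) sx) (cong not (<ᵇ-true wx))) y) sy)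
      (cong not (<ᵇ-true xy))) z) sz) (cong not (<ᵇ-true yz))) (cong not (eqᵇ-true wy))) (cong not (eqᵇ-true xz)))

injectiveᵇ : ∀ {n} → (Fin n → ℕ) → Bool
injectiveᵇ {n} pos = ∀Fin n λ i → ∀Fin n λ j → ⌊ i Fin.≟ j ⌋ ∨ not (pos i == pos j)

injectiveᵇ-sound : ∀ {n} (pos : Fin n → ℕ) → injectiveᵇ pos ≡ true → Injective _≡_ _≡_ pos
injectiveᵇ-sound {n} pos h {i} {j} e with i Fin.≟ j | ∀Fin-sound n (∀Fin-sound n h i) j
... | yes q | _ = q
... | no _ | q = clash (==-refl e) (not-true q)

-- Skipped rows and columns are exempt from the test, so one position vector per deleted row or
-- column handles all submatrices that avoid it.
arrangedᵇ : ∀ {m n} → Table m n → Vec ℕ n → (Fin m → Bool) → (Fin n → Bool) → Bool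
arrangedᵇ {m} T pos skipRow skip = injectiveᵇ (lookup pos) ∧ ∀Fin m λ i → skipRow i ∨ ncᵇ (lookup pos) skip (lookup (lookup T i))

none : ∀ {n} → Fin n → Bool
none _ = false

is : ∀ {n} → Fin n → Fin n → Bool
is i j = ⌊ i Fin.≟ j ⌋

is-false : ∀ {n} {i j : Fin n} → j ≢ i → is i j ≡ false
is-false {i = i} {j} ne with i Fin.≟ j
... | yes e = contradiction (sym e) ne
... | no _ = refl

arranged-sub : ∀ {m n p q} (M : Mat m n) pos skipRow skip → arrangedᵇ (table M) pos skipRow skip ≡ true →
  (f : Fin p → Fin m) (g : Fin q → Fin n) → Injective _≡_ _≡_ g → (∀ i → skipRow (f i) ≡ false) → (∀ j → skip (g j) ≡ false) →
  Arr (λ i j → M (f i) (g j))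
arranged-sub {m} M pos skipRow skip h f g g-inj hf hg = lookup pos ∘ g ,
  (λ e → g-inj (injectiveᵇ-sound (lookup pos) (proj₁ parts) e)) ,
  λ i → NC-resp {pos = lookup pos ∘ g} (λ j → mat-table M (f i) (g j)) λ w x y z →
    ncᵇ-sound (lookup pos) skip (lookup (lookup (table M) (f i)))
      (∨-elim (∀Fin-sound m (proj₂ parts) (f i)) (hf i)) (g w) (g x) (g y) (g z) (hg w) (hg x) (hg y) (hg z)
  where parts = ∧-split {injectiveᵇ (lookup pos)} h

arranged : ∀ {m n} (M : Mat m n) pos → arrangedᵇ (table M) pos none none ≡ true → Arr M
arranged M pos h = arranged-sub M pos none none h id id id (λ _ → refl) (λ _ → refl)

-- Each vector gives positions to the rows of a ⊙ M_I(k)*, chosen word by word. A twist that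
-- contains a transposed M_I(3)* has no such order.
odot-columns : ∀ {a} → a ∈ A-RowCol → Arr (transpose (odot a (star (MI (length a)))))
odot-columns = All.lookup {P = λ a → Arr (transpose (odot a (star (MI (length a)))))}
  ( arranged _ (0 ∷ 1 ∷ 2 ∷ 3 ∷ []) refl
  ∷ arranged _ (0 ∷ 1 ∷ 3 ∷ 2 ∷ []) refl
  ∷ arranged _ (0 ∷ 1 ∷ 2 ∷ 3 ∷ []) refl
  ∷ arranged _ (0 ∷ 1 ∷ 3 ∷ 4 ∷ 2 ∷ []) refl
  ∷ arranged _ (0 ∷ 1 ∷ 2 ∷ 4 ∷ 3 ∷ []) refl
  ∷ arranged _ (0 ∷ 1 ∷ 4 ∷ 3 ∷ 2 ∷ []) refl
  ∷ arranged _ (0 ∷ 2 ∷ 1 ∷ 4 ∷ 3 ∷ []) refl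
  ∷ arranged _ (0 ∷ 1 ∷ 2 ∷ 5 ∷ 4 ∷ 3 ∷ []) refl
  ∷ [])

module Alternation {n} (pos : Fin n → ℕ) (v : Fin n → Bool) where
  -- The values at e and o are left open. Rows and columns of M_I(k)* have at most two ones, so it
  -- is enough that two ones are always neighbours on the circle.
  record Alt : Set where
    constructor alt
    field
      α β e o : Fin n
      α-true : v α ≡ true
      β-true : v β ≡ true
      αe : pos α < pos e
      eβ : pos e < pos β
      outside : pos o < pos α ⊎ pos β < pos o

  NC-from : ¬ Alt → NC pos v
  NC-from ¬alt w x y z wx xy yz wy xz with bool-case (v w) | bool-case (v x)
  ... | inj₁ p | inj₁ q = trans p (sym q)
  ... | inj₂ p | inj₂ q = trans p (sym q)
  ... | inj₁ p | inj₂ q = ⊥-elim (¬alt (alt w y x z p (trans (sym wy) p) wx xy (inj₂ yz)))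
  ... | inj₂ p | inj₁ q = ⊥-elim (¬alt (alt x z y w q (trans (sym xz) q) xy yz (inj₁ wx)))

open Alternation using (Alt; NC-from)

star-true : ∀ {k} i j → star (MI k) i j ≡ true →
  toℕ j ≢ k × (toℕ j ≡ toℕ i ⊎ toℕ j ≡ suc (toℕ i) ⊎ (toℕ i ≡ k ∸ 1 × toℕ j ≡ 0))
star-true {k} i j h with k ≟ toℕ j
star-true i j () | yes _
... | no ne = (λ e → ne (sym e)) ,
  subst (λ t → t ≡ toℕ i ⊎ t ≡ suc (toℕ i) ⊎ (toℕ i ≡ k ∸ 1 × t ≡ 0)) (Fin.toℕ-lower₁ j ne) (MI-true k i _ h)

-- With the star column right after column c, only row c of M_I(k)* is not circular.
module StarAfter {k} (c : ℕ) (c<k : c < k) where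
  pos : Fin (suc k) → ℕ
  pos j with k ≟ toℕ j
  ... | yes _ = suc (2 * c)
  ... | no _ = 2 * toℕ j

  star-pos : ∀ {j} → toℕ j ≡ k → pos j ≡ suc (2 * c)
  star-pos {j} e with k ≟ toℕ j
  ... | yes _ = refl
  ... | no ne = contradiction (sym e) ne

  cycle-pos : ∀ {j} → toℕ j ≢ k → pos j ≡ 2 * toℕ j
  cycle-pos {j} ne with k ≟ toℕ j
  ... | yes e = contradiction (sym e) ne
  ... | no _ = refl

  pos-injective : Injective _≡_ _≡_ pos
  pos-injective {i} {j} e with k ≟ toℕ i | k ≟ toℕ j
  ... | yes p | yes q = Fin.toℕ-injective (trans (sym p) q)
  ... | yes _ | no _ = contradiction (sym e) (even≢odd (toℕ j) c)
  ... | no _ | yes _ = contradiction e (even≢odd (toℕ i) c)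
  ... | no _ | no _ = Fin.toℕ-injective (*-cancelˡ-≡ _ _ 2 e)

  -- Without the star column the two ones of a row are neighbours on the circle. So the star column
  -- has to separate them, from inside or, in the row that closes the cycle, from outside; it does
  -- so only next to column c.
  only-c : ∀ i → (A : Alt pos (star (MI k) i)) → let open Alt A in
    toℕ i ≡ c × (toℕ α ≡ c ⊎ toℕ β ≡ c) × (toℕ e ≡ k ⊎ toℕ o ≡ k)
  only-c i A with star-true i (Alt.α A) (Alt.α-true A) | star-true i (Alt.β A) (Alt.β-true A)
  ... | α≢k , inα | β≢k , inβ = go inα inβ
    where
    open Alt A
    αβ : toℕ α < toℕ β
    αβ = *-cancelˡ-< 2 _ _ (subst₂ _<_ (cycle-pos α≢k) (cycle-pos β≢k) (<-trans αe eβ))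
    go : (toℕ α ≡ toℕ i ⊎ toℕ α ≡ suc (toℕ i) ⊎ (toℕ i ≡ k ∸ 1 × toℕ α ≡ 0)) →
      (toℕ β ≡ toℕ i ⊎ toℕ β ≡ suc (toℕ i) ⊎ (toℕ i ≡ k ∸ 1 × toℕ β ≡ 0)) →
      toℕ i ≡ c × (toℕ α ≡ c ⊎ toℕ β ≡ c) × (toℕ e ≡ k ⊎ toℕ o ≡ k)
    go (inj₁ a) (inj₁ b) = contradiction αβ (<-irrefl (trans a (sym b)))
    go _ (inj₂ (inj₂ (_ , b))) = contradiction (subst (toℕ α <_) b αβ) λ ()
    go (inj₂ (inj₁ a)) (inj₁ b) = contradiction αβ (<⇒≯ (subst₂ _<_ (sym b) (sym a) ≤-refl))
    go (inj₂ (inj₁ a)) (inj₂ (inj₁ b)) = contradiction αβ (<-irrefl (trans a (sym b)))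
    go (inj₁ a) (inj₂ (inj₁ b)) with toℕ e ≟ k
    ... | no e≢k = contradiction
      (subst (toℕ e <_) b (*-cancelˡ-< 2 _ _ (subst₂ _<_ (cycle-pos e≢k) (cycle-pos β≢k) eβ)))
      (≤⇒≯ (subst (λ t → suc t ≤ toℕ e) a (*-cancelˡ-< 2 _ _ (subst₂ _<_ (cycle-pos α≢k) (cycle-pos e≢k) αe))))
    ... | yes e≡k = i≡c , inj₁ (trans a i≡c) , inj₁ e≡k
      where
      i≤c : toℕ i ≤ c
      i≤c = subst (_≤ c) a (*-cancelˡ-≤ 2 (≤-pred (subst₂ _<_ (cycle-pos α≢k) (star-pos e≡k) αe)))
      c<suc-i : c < suc (toℕ i)
      c<suc-i = subst (c <_) b (*-cancelˡ-< 2 _ _ (<⇒≤ (subst₂ _<_ (star-pos e≡k) (cycle-pos β≢k) eβ)))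
      i≡c : toℕ i ≡ c
      i≡c = ≤-antisym i≤c (≤-pred c<suc-i)
    go (inj₂ (inj₂ (l , a))) (inj₂ (inj₁ b)) = contradiction (trans b (trans (cong suc l) (m+[n∸m]≡n (≤-trans (s≤s z≤n) c<k)))) β≢k
    go (inj₂ (inj₂ (l , a))) (inj₁ b) with outside | toℕ o ≟ k
    ... | inj₁ oα | _ = contradiction (subst (pos o <_) (trans (cycle-pos α≢k) (cong (2 *_) a)) oα) λ ()
    ... | inj₂ βo | yes o≡k = i≡c , inj₂ (trans b i≡c) , inj₂ o≡k
      where
      i≡c : toℕ i ≡ c
      i≡c = ≤-antisym (subst (_≤ c) b (*-cancelˡ-≤ 2 (≤-pred (subst₂ _<_ (cycle-pos β≢k) (star-pos o≡k) βo))))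
        (subst (c ≤_) (sym l) (∸-monoˡ-≤ 1 c<k))
    ... | inj₂ βo | no o≢k = contradiction (Fin.toℕ<n o) (≤⇒≯ (≤∧≢⇒< k≤o (o≢k ∘ sym)))
      where
      k≤o : k ≤ toℕ o
      k≤o = subst (_≤ toℕ o) (trans (cong suc (trans b l)) (m+[n∸m]≡n (≤-trans (s≤s z≤n) c<k)))
        (*-cancelˡ-< 2 _ _ (subst₂ _<_ (cycle-pos β≢k) (cycle-pos o≢k) βo))

  sub : ∀ {p q} (a : Fin k → Bool) (f : Fin p → Fin k) (g : Fin q → Fin (suc k)) → Injective _≡_ _≡_ g →
    (∀ i → ¬ Alt (pos ∘ g) (λ j → star (MI k) (f i) (g j))) → Arr (λ i j → twist a (star (MI k)) (f i) (g j))
  sub a f g g-inj ¬alt = pos ∘ g , (λ e → g-inj (pos-injective e)) , λ i → NC-xor (a (f i)) (NC-from _ _ (¬alt i))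

  push : ∀ {q} (g : Fin q → Fin (suc k)) {v} → Alt (pos ∘ g) (v ∘ g) → Alt pos v
  push g (Alternation.alt α β e o a b h h′ out) = Alternation.alt (g α) (g β) (g e) (g o) a b h h′ out

-- The star column is moved next to the deleted line, so that the one remaining alternation would
-- need that line. If the star column itself is deleted, any c will do, and 0 is taken.
twist-sub : ∀ {k p q} (a : Fin k → Bool) → 3 ≤ k → (f : Fin p → Fin k) (g : Fin q → Fin (suc k)) → Injective _≡_ _≡_ g →
  (∃ λ i₀ → ∀ i → f i ≢ i₀) ⊎ (∃ λ j₀ → ∀ j → g j ≢ j₀) → Arr (λ i j → twist a (star (MI k)) (f i) (g j))
twist-sub {k} a 3≤k f g g-inj (inj₁ (i₀ , miss)) = S.sub a f g g-inj λ i A →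
  miss i (Fin.toℕ-injective (proj₁ (S.only-c (f i) (S.push g A))))
  where module S = StarAfter {k} (toℕ i₀) (Fin.toℕ<n i₀)
twist-sub {k} a 3≤k f g g-inj (inj₂ (j₀ , miss)) with toℕ j₀ ≟ k
... | yes j₀≡k = S.sub a f g g-inj λ i A → case (proj₂ (proj₂ (S.only-c (f i) (S.push g A))))
  where
  module S = StarAfter {k} 0 (≤-trans (s≤s z≤n) 3≤k)
  case : ∀ {e o} → toℕ (g e) ≡ k ⊎ toℕ (g o) ≡ k → ⊥
  case {e} (inj₁ q) = miss e (Fin.toℕ-injective (trans q (sym j₀≡k)))
  case {e} {o} (inj₂ q) = miss o (Fin.toℕ-injective (trans q (sym j₀≡k)))
... | no j₀≢k = S.sub a f g g-inj λ i A → case (proj₁ (proj₂ (S.only-c (f i) (S.push g A))))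
  where
  module S = StarAfter {k} (toℕ j₀) (≤∧≢⇒< (≤-pred (Fin.toℕ<n j₀)) j₀≢k)
  case : ∀ {e o} → toℕ (g e) ≡ toℕ j₀ ⊎ toℕ (g o) ≡ toℕ j₀ → ⊥
  case {e} (inj₁ q) = miss e (Fin.toℕ-injective q)
  case {e} {o} (inj₂ q) = miss o (Fin.toℕ-injective q)

MV-sub : ∀ {p q} (f : Fin p → Fin 4) (g : Fin q → Fin 6) → Injective _≡_ _≡_ g →
  (∃ λ i₀ → ∀ i → f i ≢ i₀) ⊎ (∃ λ j₀ → ∀ j → g j ≢ j₀) → Arr (λ i j → star MV (f i) (g j))
MV-sub f g g-inj (inj₁ (i₀ , miss)) = arranged-sub (star MV) (lookup orders i₀) (is i₀) none
  (∀Fin-sound 4 {λ i → arrangedᵇ (table (star MV)) (lookup orders i) (is i) none} refl i₀)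
  f g g-inj (λ i → is-false (miss i)) (λ _ → refl)
  where
  orders : Vec (Vec ℕ 6) 4
  orders = (0 ∷ 3 ∷ 2 ∷ 1 ∷ 5 ∷ 4 ∷ []) ∷ (0 ∷ 1 ∷ 3 ∷ 4 ∷ 5 ∷ 2 ∷ [])
         ∷ (0 ∷ 1 ∷ 2 ∷ 5 ∷ 4 ∷ 3 ∷ []) ∷ (0 ∷ 1 ∷ 2 ∷ 3 ∷ 4 ∷ 5 ∷ []) ∷ []
MV-sub f g g-inj (inj₂ (j₀ , miss)) = arranged-sub (star MV) (lookup orders j₀) none (is j₀)
  (∀Fin-sound 6 {λ j → arrangedᵇ (table (star MV)) (lookup orders j) none (is j)} refl j₀)
  f g g-inj (λ _ → refl) (λ j → is-false (miss j))
  where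
  orders : Vec (Vec ℕ 6) 6
  orders = (5 ∷ 0 ∷ 1 ∷ 2 ∷ 3 ∷ 4 ∷ []) ∷ (0 ∷ 5 ∷ 2 ∷ 1 ∷ 4 ∷ 3 ∷ []) ∷ (0 ∷ 1 ∷ 5 ∷ 4 ∷ 3 ∷ 2 ∷ [])
         ∷ (0 ∷ 1 ∷ 2 ∷ 5 ∷ 4 ∷ 3 ∷ []) ∷ (0 ∷ 1 ∷ 3 ∷ 4 ∷ 5 ∷ 2 ∷ []) ∷ (0 ∷ 1 ∷ 2 ∷ 3 ∷ 4 ∷ 5 ∷ []) ∷ []

genMat-sub : ∀ g {p q} (f : Fin p → Fin (genRows g)) (h : Fin q → Fin (genCols g)) → Injective _≡_ _≡_ h →
  (∃ λ i₀ → ∀ i → f i ≢ i₀) ⊎ (∃ λ j₀ → ∀ j → h j ≢ j₀) → Arr (λ i j → genMat g (f i) (h j))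
genMat-sub (gMI k 3≤k) = twist-sub (λ _ → false) 3≤k
genMat-sub (gMIbar k 3≤k) = twist-sub (λ _ → true) 3≤k
genMat-sub (gOdot a a∈) = twist-sub (List.lookup a) (A-length a∈)
genMat-sub gMV = MV-sub
genMat-sub gMVbar f h h-inj miss = Arr-twist (λ _ → true) (MV-sub f h h-inj miss)

-- The natural order of the rows works: column j has its ones in rows j - 1 and j, column 0 in the
-- first and last rows, and the star column has none.
MI-column : ∀ k j → NC toℕ (λ i → star (MI k) i j)
MI-column k j = NC-from _ _ λ A → go A (proj₂ (star-true (Alt.α A) j (Alt.α-true A))) (proj₂ (star-true (Alt.β A) j (Alt.β-true A)))
  where
  go : (A : Alt toℕ (λ i → star (MI k) i j)) → let open Alt A in
    (toℕ j ≡ toℕ α ⊎ toℕ j ≡ suc (toℕ α) ⊎ (toℕ α ≡ k ∸ 1 × toℕ j ≡ 0)) →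
    (toℕ j ≡ toℕ β ⊎ toℕ j ≡ suc (toℕ β) ⊎ (toℕ β ≡ k ∸ 1 × toℕ j ≡ 0)) → ⊥
  go A = cases
    where
    open Alt A
    αβ : toℕ α < toℕ β
    αβ = <-trans αe eβ
    ≤k∸1 : ∀ (i : Fin k) → toℕ i ≤ k ∸ 1
    ≤k∸1 i = ∸-monoˡ-≤ 1 (Fin.toℕ<n i)
    cases : _ → _ → ⊥
    cases (inj₁ a) (inj₁ b) = <⇒≢ αβ (trans (sym a) b)
    cases (inj₁ a) (inj₂ (inj₁ b)) = <⇒≯ αβ (≤-reflexive (trans (sym b) a))
    cases (inj₁ a) (inj₂ (inj₂ (l , b))) with outside
    ... | inj₁ oα = contradiction (subst (toℕ o <_) (trans (sym a) b) oα) λ ()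
    ... | inj₂ βo = <⇒≱ βo (subst (toℕ o ≤_) (sym l) (≤k∸1 o))
    cases (inj₂ (inj₁ a)) (inj₁ b) = <⇒≱ eβ (subst (_≤ toℕ e) (trans (sym a) b) αe)
    cases (inj₂ (inj₁ a)) (inj₂ (inj₁ b)) = <⇒≢ αβ (suc-injective (trans (sym a) b))
    cases (inj₂ (inj₁ a)) (inj₂ (inj₂ (_ , b))) = contradiction (trans (sym a) b) λ ()
    cases (inj₂ (inj₂ (l , _))) _ = <⇒≱ αβ (subst (toℕ β ≤_) (sym l) (≤k∸1 β))

genMat-column : ∀ g → Arr (transpose (genMat g))
genMat-column (gMI k _) = toℕ , Fin.toℕ-injective , MI-column k
genMat-column (gMIbar k _) = toℕ , Fin.toℕ-injective , λ j → NC-xor true (MI-column k j)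
genMat-column (gOdot a a∈) = odot-columns a∈
genMat-column gMV = arranged (transpose (star MV)) (0 ∷ 1 ∷ 2 ∷ 3 ∷ []) refl
genMat-column gMVbar = arranged (transpose (compl (star MV))) (0 ∷ 1 ∷ 2 ∷ 3 ∷ []) refl

missed : ∀ {p m} (f : Fin p → Fin m) → p < m → ∃ λ i₀ → ∀ i → f i ≢ i₀
missed {p} {m} f p<m with choose m hit
  where
  hit : ∀ i₀ → (∀ i → f i ≢ i₀) ⊎ (∃ λ i → f i ≡ i₀)
  hit i₀ with Fin.any? (λ i → f i Fin.≟ i₀)
  ... | yes h = inj₂ h
  ... | no ¬h = inj₁ λ i e → ¬h (i , e)
... | inj₁ r = r
... | inj₂ onto = contradiction (Fin.injective⇒≤ {f = proj₁ ∘ onto}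
  (λ {i} {j} e → trans (sym (proj₂ (onto i))) (trans (cong f e) (proj₂ (onto j))))) (<⇒≱ p<m)

Missing : ∀ {p q m n} → (Fin p → Fin m) → (Fin q → Fin n) → Set
Missing f g = (∃ λ i₀ → ∀ i → f i ≢ i₀) ⊎ (∃ λ j₀ → ∀ j → g j ≢ j₀)

missing : ∀ {p q m n} (f : Fin p → Fin m) (g : Fin q → Fin n) → p < m ⊎ q < n → Missing f g
missing f g (inj₁ h) = inj₁ (missed f h)
missing f g (inj₂ h) = inj₂ (missed g h)

fMat-sub : ∀ x {p q} (f : Fin p → Fin (fRows x)) (g : Fin q → Fin (fCols x)) →
  Injective _≡_ _≡_ f → Injective _≡_ _≡_ g → p < fRows x ⊎ q < fCols x → C1RowCol (λ i j → fMat x (f i) (g j))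
fMat-sub (k , false) f g f-inj g-inj small =
  Arr⇒C1Rows (genMat-sub k f g g-inj (missing f g small)) , Arr⇒C1Rows (Arr-sub {M = transpose (genMat k)} g f f-inj (genMat-column k))
fMat-sub (k , true) f g f-inj g-inj small =
  Arr⇒C1Rows (Arr-sub {M = transpose (genMat k)} f g g-inj (genMat-column k)) , Arr⇒C1Rows (genMat-sub k g f f-inj (swap (missing f g small)))

fMat-not-C1 : ∀ x → ¬ C1RowCol (fMat x)
fMat-not-C1 (k , false) (rows , _) = genMat-not-Arr k (C1Rows⇒Arr rows)
fMat-not-C1 (k , true) (_ , cols) = genMat-not-Arr k (C1Rows⇒Arr cols)

increasing⇒injective : ∀ {p m} {f : Fin p → Fin m} → StrictlyIncreasing f → Injective _≡_ _≡_ f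
increasing⇒injective inc {i} {j} e with <-cmp (toℕ i) (toℕ j)
... | tri≈ _ q _ = Fin.toℕ-injective q
... | tri< q _ _ = contradiction (cong toℕ e) (<⇒≢ (inc i j q))
... | tri> _ _ q = contradiction (cong toℕ (sym e)) (<⇒≢ (inc j i q))

C1RowCol-Contains : ∀ {m n p q} (M : Mat m n) (N : Mat p q) → Contains M N → C1RowCol M → C1RowCol N
C1RowCol-Contains M N (f , g , f-inj , g-inj , h) (rows , cols) =
  Arr⇒C1Rows (Arr-resp h (Arr-sub {M = M} f g g-inj (C1Rows⇒Arr rows))) ,
  Arr⇒C1Rows (Arr-resp (λ j i → h i j) (Arr-sub {M = transpose M} g f f-inj (C1Rows⇒Arr cols)))

C1RowCol-or-Contains : ∀ {m n} (M : Mat m n) → C1RowCol M ⊎ ∃ λ x → Contains M (fMat x)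
C1RowCol-or-Contains {m} {n} M with tucker n M | tucker m (transpose M)
... | inj₁ A | inj₁ B = inj₁ (Arr⇒C1Rows A , Arr⇒C1Rows B)
... | inj₂ o | _ = inj₂ (Reduced⇒Contains (reduce o))
... | inj₁ _ | inj₂ o = inj₂ (Reduced⇒Contains (flipped (reduce o)))
  where
  flipped : Reduced (transpose M) → Reduced M
  flipped ((g , false) , e) = (g , true) , Emb-transpose e
  flipped ((g , true) , e) = (g , false) , Emb-transpose e

-- No member of the family contains another

total : ∀ {m n} → Mat m n → ℕ
total M = sum λ i → sum λ j → bit (M i j)

-- At equal sizes a configuration is a permutation of rows and columns, so the number of ones is an
-- invariant that tells members apart.
total-Contains : ∀ {m n p q} (M : Mat m n) (N : Mat p q) → p ≡ m → q ≡ n → Contains M N → total N ≡ total M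
total-Contains M N refl refl (f , g , f-inj , g-inj , h) = trans
  (sum-cong-≗ λ i → trans (sum-cong-≗ λ j → cong bit (trans (sym (h i j)) (cong (M (f i)) (sym (proj₂ G j)))))
    (sym (sum-permute (λ j → bit (M (f i) j)) (proj₁ G))))
  (trans (sum-cong-≗ λ i → cong (λ t → sum λ j → bit (M t j)) (sym (proj₂ F i)))
    (sym (sum-permute (λ i → sum λ j → bit (M i j)) (proj₁ F))))
  where
  F = injective⇒permutation f f-inj
  G = injective⇒permutation g g-inj

star-hole : ∀ {k} → 3 ≤ k → ∀ y → ∃ λ i → star (MI k) i y ≡ false
star-hole {k} (s≤s {n = p} 2≤p) y = go (toℕ y) refl
  where
  avoid : ∀ i → toℕ y ≢ toℕ i → toℕ y ≢ suc (toℕ i) → ¬ (toℕ i ≡ p × toℕ y ≡ 0) → ∃ λ i → star (MI k) i y ≡ false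
  avoid i a b c = i , ≢true λ h → neither (proj₂ (star-true i y h))
    where
    neither : toℕ y ≡ toℕ i ⊎ toℕ y ≡ suc (toℕ i) ⊎ (toℕ i ≡ p × toℕ y ≡ 0) → ⊥
    neither (inj₁ e) = a e
    neither (inj₂ (inj₁ e)) = b e
    neither (inj₂ (inj₂ e)) = c e
  1≡ : toℕ (clamp p 1) ≡ 1
  1≡ = toℕ-clamp (<⇒≤ 2≤p)
  2≡ : toℕ (clamp p 2) ≡ 2
  2≡ = toℕ-clamp 2≤p
  go : ∀ t → toℕ y ≡ t → ∃ λ i → star (MI k) i y ≡ false
  go 0 e = avoid (clamp p 1) (λ q → contradiction (trans (sym e) (trans q 1≡)) λ ())
    (λ q → contradiction (trans (sym e) q) λ ()) (λ { (q , _) → <⇒≢ 2≤p (trans (sym 1≡) q) })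
  go 1 e = avoid (clamp p 2) (λ q → contradiction (trans (sym e) (trans q 2≡)) λ ())
    (λ q → contradiction (trans (sym e) (trans q (cong suc 2≡))) λ ()) (λ { (_ , q) → contradiction (trans (sym e) q) λ () })
  go (suc (suc t)) e = avoid zero (λ q → contradiction (trans (sym e) q) λ ())
    (λ q → contradiction (trans (sym e) q) λ ()) (λ { (_ , q) → contradiction (trans (sym e) q) λ () })

-- Counting ones fails here, since M_I(3)* and its complement both have six. Instead, the star
-- column of one would be a constant column of the other with the opposite value, which `star-hole`
-- excludes.
MI-complement : ∀ {k} b → 3 ≤ k → ¬ Contains (twist (λ _ → b) (star (MI k))) (twist (λ _ → not b) (star (MI k)))
MI-complement {k} b 3≤k (f , g , f-inj , _ , h) with star-hole 3≤k (g (fromℕ k))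
... | i₀ , hole with injective⇒surjective f f-inj i₀
...   | i , refl = flipped b (trans (sym (trans (cong (b xor_) hole) (xor-identityʳ b)))
  (trans (h i (fromℕ k)) (trans (cong (not b xor_) (star-last (MI k) i)) (xor-identityʳ _))))
  where
  flipped : ∀ b → b ≢ not b
  flipped true ()
  flipped false ()

odot-total : List Bool → ℕ
odot-total a = total (odot a (star (MI (length a))))

odot-total-MI : ∀ {a} → a ∈ A-RowCol → odot-total a ≢ total (star (MI (length a))) × odot-total a ≢ total (compl (star (MI (length a))))
odot-total-MI = All.lookup (toWitness {a? = All.all? (λ a →
  ¬? (odot-total a ≟ total (star (MI (length a)))) ×-dec ¬? (odot-total a ≟ total (compl (star (MI (length a)))))) A-RowCol} _)

-- For k ≥ 4, complementing a row of M_I(k)* turns two ones into k - 1 > 2 ones, so the count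
-- determines the weight of the word; listed words of equal length have different weights.
odot-total-injective : ∀ {a b} → a ∈ A-RowCol → b ∈ A-RowCol → length a ≡ length b → odot-total a ≡ odot-total b → a ≡ b
odot-total-injective a∈ b∈ = All.lookup (All.lookup (toWitness {a? = All.all? (λ a → All.all? (λ b →
  (length a ≟ length b) →-dec ((odot-total a ≟ odot-total b) →-dec List.≡-dec Bool._≟_ a b)) A-RowCol) A-RowCol} _) a∈) b∈

MatEq-refl : ∀ {m n} (A : Mat m n) → MatEq A A
MatEq-refl A = refl , refl , λ i j → sym (cong₂ A (Fin.cast-is-id refl i) (Fin.cast-is-id refl j))

MatEq-transpose : ∀ {m n p q} (A : Mat m n) (B : Mat p q) → MatEq A B → MatEq (transpose A) (transpose B)
MatEq-transpose A B (e , e′ , h) = e′ , e , λ j i → h i j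

-- The conclusion is about matrices because an index also carries a proof, of 3 ≤ k or of
-- membership.
genMat-MatEq : ∀ g h → genRows h ≡ genRows g → genCols h ≡ genCols g → Contains (genMat g) (genMat h) → MatEq (genMat h) (genMat g)
genMat-MatEq (gMI k _) (gMI _ _) refl _ _ = MatEq-refl (star (MI k))
genMat-MatEq (gMIbar k _) (gMIbar _ _) refl _ _ = MatEq-refl (compl (star (MI k)))
genMat-MatEq gMV gMV _ _ _ = MatEq-refl (star MV)
genMat-MatEq gMVbar gMVbar _ _ _ = MatEq-refl (compl (star MV))
genMat-MatEq g@(gOdot a a∈) h@(gOdot b b∈) e e′ c with odot-total-injective a∈ b∈ (sym e) (sym (total-Contains (genMat g) (genMat h) e e′ c))
... | refl = MatEq-refl (odot a (star (MI (length a))))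
genMat-MatEq (gMI k 3≤k) (gMIbar _ _) refl _ c = ⊥-elim (MI-complement false 3≤k c)
genMat-MatEq (gMIbar k 3≤k) (gMI _ _) refl _ c = ⊥-elim (MI-complement true 3≤k c)
genMat-MatEq g@(gMI k u1) h@(gOdot b b∈) refl e′ c = contradiction (total-Contains (genMat g) (genMat h) refl e′ c) (proj₁ (odot-total-MI b∈))
genMat-MatEq g@(gMIbar k u1) h@(gOdot b b∈) refl e′ c = contradiction (total-Contains (genMat g) (genMat h) refl e′ c) (proj₂ (odot-total-MI b∈))
genMat-MatEq g@(gOdot a a∈) h@(gMI v1 v2) refl e′ c = contradiction (sym (total-Contains (genMat g) (genMat h) refl e′ c)) (proj₁ (odot-total-MI a∈))
genMat-MatEq g@(gOdot a a∈) h@(gMIbar v1 v2) refl e′ c = contradiction (sym (total-Contains (genMat g) (genMat h) refl e′ c)) (proj₂ (odot-total-MI a∈))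
genMat-MatEq g@gMV h@gMVbar _ _ c = contradiction (total-Contains (genMat g) (genMat h) refl refl c) λ ()
genMat-MatEq g@gMVbar h@gMV _ _ c = contradiction (total-Contains (genMat g) (genMat h) refl refl c) λ ()
genMat-MatEq (gMI _ _) gMV e e′ _ = contradiction (trans (cong suc e) (sym e′)) λ ()
genMat-MatEq (gMI _ _) gMVbar e e′ _ = contradiction (trans (cong suc e) (sym e′)) λ ()
genMat-MatEq (gMIbar _ _) gMV e e′ _ = contradiction (trans (cong suc e) (sym e′)) λ ()
genMat-MatEq (gMIbar _ _) gMVbar e e′ _ = contradiction (trans (cong suc e) (sym e′)) λ ()
genMat-MatEq (gOdot _ _) gMV e e′ _ = contradiction (trans (cong suc e) (sym e′)) λ ()
genMat-MatEq (gOdot _ _) gMVbar e e′ _ = contradiction (trans (cong suc e) (sym e′)) λ ()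
genMat-MatEq gMV (gMI _ _) e e′ _ = contradiction (trans (cong suc (sym e)) e′) λ ()
genMat-MatEq gMV (gMIbar _ _) e e′ _ = contradiction (trans (cong suc (sym e)) e′) λ ()
genMat-MatEq gMV (gOdot _ _) e e′ _ = contradiction (trans (cong suc (sym e)) e′) λ ()
genMat-MatEq gMVbar (gMI _ _) e e′ _ = contradiction (trans (cong suc (sym e)) e′) λ ()
genMat-MatEq gMVbar (gMIbar _ _) e e′ _ = contradiction (trans (cong suc (sym e)) e′) λ ()
genMat-MatEq gMVbar (gOdot _ _) e e′ _ = contradiction (trans (cong suc (sym e)) e′) λ ()

-- Separates F from its transposes: matrices from the two sides never have the same size.
genRows<genCols : ∀ g → genRows g < genCols g
genRows<genCols (gMI _ _) = ≤-refl
genRows<genCols (gMIbar _ _) = ≤-refl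
genRows<genCols (gOdot _ _) = ≤-refl
genRows<genCols gMV = n≤1+n 5
genRows<genCols gMVbar = n≤1+n 5

Contains-transpose : ∀ {m n p q} (M : Mat m n) (N : Mat p q) → Contains M N → Contains (transpose M) (transpose N)
Contains-transpose M N (f , g , f-inj , g-inj , h) = g , f , g-inj , f-inj , λ j i → h i j

-- A smaller copy would lie in a proper submatrix of `fMat x`, which is circular in both directions,
-- whereas `fMat y` is not.
fMat-size : ∀ x y → Contains (fMat x) (fMat y) → fRows y ≡ fRows x × fCols y ≡ fCols x
fMat-size x y (f , g , f-inj , g-inj , h) with m≤n⇒m<n∨m≡n (Fin.injective⇒≤ f-inj) | m≤n⇒m<n∨m≡n (Fin.injective⇒≤ g-inj)
... | inj₂ e | inj₂ e′ = e , e′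
... | inj₁ l | _ = contradiction (C1RowCol-Contains (λ i j → fMat x (f i) (g j)) (fMat y) (id , id , id , id , h) (fMat-sub x f g f-inj g-inj (inj₁ l))) (fMat-not-C1 y)
... | inj₂ _ | inj₁ l = contradiction (C1RowCol-Contains (λ i j → fMat x (f i) (g j)) (fMat y) (id , id , id , id , h) (fMat-sub x f g f-inj g-inj (inj₂ l))) (fMat-not-C1 y)

fMat-MatEq : ∀ x y → Contains (fMat x) (fMat y) → MatEq (fMat y) (fMat x)
fMat-MatEq x y c with fMat-size x y c
fMat-MatEq (g , false) (h , false) c | e , e′ = genMat-MatEq g h e e′ c
fMat-MatEq (g , true) (h , true) c | e , e′ = MatEq-transpose (genMat h) (genMat g)
  (genMat-MatEq g h e′ e (Contains-transpose (transpose (genMat g)) (transpose (genMat h)) c))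
fMat-MatEq (g , false) (h , true) c | e , e′ =
  contradiction (genRows<genCols h) (<⇒≯ (subst₂ _<_ (sym e) (sym e′) (genRows<genCols g)))
fMat-MatEq (g , true) (h , false) c | e , e′ =
  contradiction (genRows<genCols h) (<⇒≯ (subst₂ _<_ (sym e′) (sym e) (genRows<genCols g)))

theorem16 : ((m n : ℕ) (M : Mat m n) →
    (C1RowCol M → ∀ (x : FIdx) → ¬ Contains M (fMat x))
    × ((∀ (x : FIdx) → ¬ Contains M (fMat x)) → C1RowCol M))
    × (∀ (x : FIdx) →
    Σ ℕ λ m → Σ ℕ λ n → Σ (Mat m n) λ M →
    ¬ C1RowCol M
    × (∀ (y : FIdx) → ¬ MatEq (fMat y) (fMat x) → ¬ Contains M (fMat y)))
    × (∀ (x : FIdx) → MinForbidden (fMat x))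
theorem16 =
  (λ m n M → (λ c1 x c → fMat-not-C1 x (C1RowCol-Contains M (fMat x) c c1)) , λ free → pick M (C1RowCol-or-Contains M) free) ,
  (λ x → fRows x , fCols x , fMat x , fMat-not-C1 x , λ y ne c → ne (fMat-MatEq x y c)) ,
  λ x → fMat-not-C1 x , λ p q f g f-inc g-inc → fMat-sub x f g (increasing⇒injective f-inc) (increasing⇒injective g-inc)
  where
  pick : ∀ {m n} (M : Mat m n) → C1RowCol M ⊎ (∃ λ x → Contains M (fMat x)) → (∀ x → ¬ Contains M (fMat x)) → C1RowCol M
  pick M (inj₁ c1) _ = c1
  pick M (inj₂ (x , c)) free = contradiction c (free x)
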